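{- Let $\mathbb{I}$ be a set of intervals of length $\lambda$ (with $\lambda>0$) in the real line that arrive in a data stream. There is a data stream algorithm to compute a $(3/2)$-approximation to the largest independent subset of $\mathbb{I}$ that uses $O(\alpha(\mathbb{I}))$ space and handles each interval of the stream in $O(\log \alpha(\mathbb{I}))$ time.
   Context: Input intervals are closed intervals of $\mathbb{R}$, all of the same length $\lambda>0$. A set of intervals is independent if its members are pairwise disjoint; $\alpha(\mathbb{I})$ denotes the largest cardinality of an independent subset of $\mathbb{I}$. A $(3/2)$-approximation to the largest independent subset is an independent set $\mathbb{J}\subseteq\mathbb{I}$ with $|\mathbb{J}|\ge \tfrac23\alpha(\mathbb{I})$. In the data stream model the intervals of $\mathbb{I}$ arrive one at a time, in arbitrary order, and the algorithm makes a single pass: past input cannot be accessed unless it was stored in memory. One unit of memory can store an interval; space is counted in such units. -}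

module Defs where

open import Algebra.Bundles.Raw using (RawRing)
open import Algebra.Core using (Op₁; Op₂)
import Algebra.Definitions.RawMonoid as RawMonoidDefs
open import Algebra.Structures using (IsCommutativeRing)
open import Data.Bool.Base using (Bool; true; false; not; if_then_else_)
open import Data.Fin.Base using (Fin)
open import Data.Integer.Base using (ℤ; +_; -[1+_])
open import Data.List.Base using (List; []; _∷_; length)
open import Data.List.Relation.Binary.Subset.Propositional using (_⊆_)
open import Data.List.Relation.Unary.AllPairs using (AllPairs)
open import Data.Maybe.Base using (Maybe; just; nothing; is-nothing)
import Data.Maybe.Base as Maybe
open import Data.Maybe.Properties using (≡-dec)
open import Data.Nat.Base as ℕ using (ℕ; suc)
import Data.Nat.Properties as ℕₚ
open import Data.Product.Base using (∃; _×_)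
open import Data.Vec.Base using (Vec; lookup; replicate; _[_]≔_)
open import Level using (0ℓ)
open import Relation.Binary.Core using (Rel)
open import Relation.Binary.PropositionalEquality using (_≡_; _≢_)
import Relation.Binary.Construct.NonStrictToStrict as Strict
open import Relation.Binary.Structures using (IsDecTotalOrder)
open import Relation.Nullary.Decidable.Core using (does; yes; no)
open import Relation.Nullary.Negation.Core using (¬_)

-- The real line, as a complete ordered field

record OrderedField : Set₁ where
  infix  8 -_ _⁻¹
  infixl 7 _*_
  infixl 6 _+_ _-_
  infix  4 _≤_ _<_
  field
    Carrier           : Set
    _+_ _*_           : Op₂ Carrier
    -_ _⁻¹            : Op₁ Carrier
    0# 1#             : Carrier
    _≤_               : Rel Carrier 0ℓ
    isCommutativeRing : IsCommutativeRing _≡_ _+_ _*_ -_ 0# 1#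
    0≢1               : 0# ≢ 1#
    -- As x ⁻¹ is total, its value at 0# is left unspecified.
    *-inverseʳ        : ∀ x → x ≢ 0# → x * x ⁻¹ ≡ 1#
    isDecTotalOrder   : IsDecTotalOrder _≡_ _≤_
    +-monoʳ-≤         : ∀ x {y z} → y ≤ z → x + y ≤ x + z
    *-nonNegative     : ∀ {x y} → 0# ≤ x → 0# ≤ y → 0# ≤ x * y

  _<_ : Rel Carrier 0ℓ
  _<_ = Strict._<_ _≡_ _≤_

  _-_ : Op₂ Carrier
  x - y = x + (- y)

  rawRing : RawRing 0ℓ 0ℓ
  rawRing = record
    { Carrier = Carrier ; _≈_ = _≡_ ; _+_ = _+_ ; _*_ = _*_ ; -_ = -_
    ; 0# = 0# ; 1# = 1# }

module _ (F : OrderedField) where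
  open OrderedField F
  private module Mult = RawMonoidDefs (RawRing.+-rawMonoid rawRing)

  fromℤ : ℤ → Carrier
  fromℤ (+ n)    = n Mult.× 1#
  fromℤ -[1+ n ] = - (suc n Mult.× 1#)

  UpperBound : (Carrier → Set) → Carrier → Set
  UpperBound P u = ∀ x → P x → x ≤ u

  LeastUpperBound : (Carrier → Set) → Carrier → Set
  LeastUpperBound P s = UpperBound P s × (∀ u → UpperBound P u → s ≤ u)

record Reals : Set₁ where
  field
    orderedField : OrderedField
  open OrderedField orderedField public
  field
    complete : (P : Carrier → Set) → ∃ P → ∃ (UpperBound orderedField P) →
               ∃ (LeastUpperBound orderedField P)
    -- Classically the floor function exists by completeness and is unique; it
    -- is a field because the Archimedean property that completeness yields
    -- constructively does not provide the integer.
    ⌊_⌋      : Carrier → ℤ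
    ⌊⌋-lower : ∀ x → fromℤ orderedField ⌊ x ⌋ ≤ x
    ⌊⌋-upper : ∀ x → x < fromℤ orderedField ⌊ x ⌋ + 1#

-- The machine is a pointer machine over the reals.  A program is a finite
-- piece of syntax containing no real constant other than 1.  Pointers are
-- opaque and there is no integer type, so no data can be hidden in addresses;
-- multiplication of reals is left out as well.

record Layout : Set where
  field
    realRegs  ptrRegs  : ℕ     -- registers
    realSlots ptrSlots : ℕ     -- contents of one heap node

module _ (L : Layout) where
  open Layout L

  data Test : Set where
    leq    : (r s : Fin realRegs) → Test
    isNil  : (p : Fin ptrRegs) → Test
    same   : (p q : Fin ptrRegs) → Test
    negate : Test → Test

  -- The first argument is the destination, except in setReal and setPtr, which
  -- write the register given last into a slot of the node that p points to.
  data Instr : Set where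
    one      : (r : Fin realRegs) → Instr
    copyReal : (r s : Fin realRegs) → Instr
    add sub  : (r s t : Fin realRegs) → Instr
    floorDiv : (r s t : Fin realRegs) → Instr     -- r := ⌊ s / t ⌋
    nil      : (p : Fin ptrRegs) → Instr
    copyPtr  : (p q : Fin ptrRegs) → Instr
    new      : (p : Fin ptrRegs) → Instr
    getReal  : (r : Fin realRegs) (p : Fin ptrRegs) (i : Fin realSlots) → Instr
    getPtr   : (q : Fin ptrRegs) (p : Fin ptrRegs) (i : Fin ptrSlots) → Instr
    setReal  : (p : Fin ptrRegs) (i : Fin realSlots) (r : Fin realRegs) → Instr
    setPtr   : (p : Fin ptrRegs) (i : Fin ptrSlots) (q : Fin ptrRegs) → Instr
    emit     : (r s : Fin realRegs) → Instr       -- output the interval [r , s]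

  infixr 5 _⨾_
  data Cmd : Set where
    skip  : Cmd
    instr : Instr → Cmd
    _⨾_   : Cmd → Cmd → Cmd
    cond  : Test → Cmd → Cmd → Cmd
    while : Test → Cmd → Cmd

-- Before each run of handle, the endpoints of the arriving interval are placed
-- in registers inLo and inHi; all the other memory is kept from one interval to
-- the next, and there is no other access to the stream.  After the last
-- interval, finish is run to report the answer.
record StreamAlgorithm : Set where
  field
    layout        : Layout
    inLo inHi     : Fin (Layout.realRegs layout)
    handle finish : Cmd layout

module IntervalStreams (R : Reals) where
  open Reals R
  open IsDecTotalOrder isDecTotalOrder using (_≟_; _≤?_)

  record Interval : Set where
    constructor [_,_]
    field
      lo hi : Carrier
  open Interval public

  HasLength : Carrier → Interval → Set
  HasLength len I = hi I - lo I ≡ len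

  infix 4 _∈ᴵ_
  _∈ᴵ_ : Carrier → Interval → Set
  x ∈ᴵ I = lo I ≤ x × x ≤ hi I

  Disjoint : Interval → Interval → Set
  Disjoint I J = ∀ x → ¬ (x ∈ᴵ I × x ∈ᴵ J)

  -- Finite sets of intervals are given by lists.  As intervals of positive
  -- length are nonempty, an independent list of them has no repetitions, so
  -- that its length is its cardinality.
  Independent : List Interval → Set
  Independent = AllPairs Disjoint

  IndependentSubset : List Interval → List Interval → Set
  IndependentSubset 𝕀 𝕁 = 𝕁 ⊆ 𝕀 × Independent 𝕁

  IsIndependenceNumber : List Interval → ℕ → Set
  IsIndependenceNumber 𝕀 α =
    (∃ λ 𝕁 → IndependentSubset 𝕀 𝕁 × length 𝕁 ≡ α) ×
    (∀ 𝕁 → IndependentSubset 𝕀 𝕁 → length 𝕁 ℕ.≤ α)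

  module Semantics (L : Layout) where
    open Layout L

    Pointer : Set
    Pointer = Maybe ℕ

    record Node : Set where
      constructor node
      field
        reals : Vec Carrier realSlots
        ptrs  : Vec Pointer ptrSlots
    open Node public

    -- The nodes allocated so far are those at addresses below size.
    record State : Set where
      constructor state
      field
        realReg : Vec Carrier realRegs
        ptrReg  : Vec Pointer ptrRegs
        size    : ℕ
        heap    : ℕ → Node
        output  : List Interval
    open State public

    blank : Node
    blank = node (replicate realSlots 0#) (replicate ptrSlots nothing)

    initial : State
    initial = state (replicate realRegs 0#) (replicate ptrRegs nothing)
                    0 (λ _ → blank) []

    assignReal : Fin realRegs → Carrier → State → State
    assignReal r x σ = record σ { realReg = realReg σ [ r ]≔ x }

    assignPtr : Fin ptrRegs → Pointer → State → State
    assignPtr p a σ = record σ { ptrReg = ptrReg σ [ p ]≔ a }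

    storeNode : ℕ → Node → State → State
    storeNode a n σ =
      record σ { heap = λ b → if does (b ℕₚ.≟ a) then n else heap σ b }

    holds : Test L → State → Bool
    holds (leq r s)  σ = does (lookup (realReg σ) r ≤? lookup (realReg σ) s)
    holds (isNil p)  σ = is-nothing (lookup (ptrReg σ) p)
    holds (same p q) σ =
      does (≡-dec ℕₚ._≟_ (lookup (ptrReg σ) p) (lookup (ptrReg σ) q))
    holds (negate b) σ = not (holds b σ)

    -- Division by zero and access through a nil pointer have no result.
    exec : Instr L → State → Maybe State
    exec (one r) σ        = just (assignReal r 1# σ)
    exec (copyReal r s) σ = just (assignReal r (lookup (realReg σ) s) σ)
    exec (add r s t) σ    =
      just (assignReal r (lookup (realReg σ) s + lookup (realReg σ) t) σ)
    exec (sub r s t) σ    =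
      just (assignReal r (lookup (realReg σ) s - lookup (realReg σ) t) σ)
    exec (floorDiv r s t) σ with lookup (realReg σ) t ≟ 0#
    ... | yes _ = nothing
    ... | no  _ = just (assignReal r (fromℤ orderedField ⌊ x * y ⁻¹ ⌋) σ)
      where
        x = lookup (realReg σ) s
        y = lookup (realReg σ) t
    exec (nil p) σ        = just (assignPtr p nothing σ)
    exec (copyPtr p q) σ  = just (assignPtr p (lookup (ptrReg σ) q) σ)
    exec (new p) σ        =
      just (assignPtr p (just (size σ))
             (storeNode (size σ) blank (record σ { size = suc (size σ) })))
    exec (getReal r p i) σ =
      Maybe.map (λ a → assignReal r (lookup (reals (heap σ a)) i) σ)
                (lookup (ptrReg σ) p)
    exec (getPtr q p i) σ =
      Maybe.map (λ a → assignPtr q (lookup (ptrs (heap σ a)) i) σ)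
                (lookup (ptrReg σ) p)
    exec (setReal p i r) σ =
      Maybe.map
        (λ a → let n = heap σ a in storeNode a
          (record n { reals = reals n [ i ]≔ lookup (realReg σ) r }) σ)
        (lookup (ptrReg σ) p)
    exec (setPtr p i q) σ =
      Maybe.map
        (λ a → let n = heap σ a in storeNode a
          (record n { ptrs = ptrs n [ i ]≔ lookup (ptrReg σ) q }) σ)
        (lookup (ptrReg σ) p)
    exec (emit r s) σ     =
      just (record σ
        { output = [ lookup (realReg σ) r , lookup (realReg σ) s ] ∷ output σ })

    -- ⟨ c , σ ⟩⇓⟨ τ , t ⟩: started in σ, c terminates in τ after t time units,
    -- one for each instruction executed and each test evaluated.
    infix 4 ⟨_,_⟩⇓⟨_,_⟩
    data ⟨_,_⟩⇓⟨_,_⟩ : Cmd L → State → State → ℕ → Set where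
      skip-⇓   : ∀ {σ} → ⟨ skip , σ ⟩⇓⟨ σ , 0 ⟩
      instr-⇓  : ∀ {i σ τ} → exec i σ ≡ just τ → ⟨ instr i , σ ⟩⇓⟨ τ , 1 ⟩
      seq-⇓    : ∀ {c d σ τ υ t u} →
                 ⟨ c , σ ⟩⇓⟨ τ , t ⟩ → ⟨ d , τ ⟩⇓⟨ υ , u ⟩ →
                 ⟨ c ⨾ d , σ ⟩⇓⟨ υ , t ℕ.+ u ⟩
      cond-⇓   : ∀ {b c d σ τ t} →
                 ⟨ (if holds b σ then c else d) , σ ⟩⇓⟨ τ , t ⟩ →
                 ⟨ cond b c d , σ ⟩⇓⟨ τ , suc t ⟩
      while-⇓₀ : ∀ {b c σ} → holds b σ ≡ false →
                 ⟨ while b c , σ ⟩⇓⟨ σ , 1 ⟩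
      while-⇓₁ : ∀ {b c σ τ υ t u} → holds b σ ≡ true →
                 ⟨ c , σ ⟩⇓⟨ τ , t ⟩ → ⟨ while b c , τ ⟩⇓⟨ υ , u ⟩ →
                 ⟨ while b c , σ ⟩⇓⟨ υ , suc (t ℕ.+ u) ⟩

    -- Number of memory cells in use, a cell holding one real or one pointer;
    -- two cells thus hold an interval.  The write-only output is not counted.
    cells : State → ℕ
    cells σ = (realRegs ℕ.+ ptrRegs) ℕ.+ size σ ℕ.* (realSlots ℕ.+ ptrSlots)

  module _ (A : StreamAlgorithm) where
    open StreamAlgorithm A
    open Semantics layout

    receive : Interval → State → State
    receive I σ = assignReal inHi (hi I) (assignReal inLo (lo I) σ)

    -- The list of naturals collects the time spent on each interval.
    data Pass : State → List Interval → State → List ℕ → Set where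
      []  : ∀ {σ} → Pass σ [] σ []
      _∷_ : ∀ {σ τ υ I 𝕀 t ts} → ⟨ handle , receive I σ ⟩⇓⟨ τ , t ⟩ →
            Pass τ 𝕀 υ ts → Pass σ (I ∷ 𝕀) υ (t ∷ ts)

    record Run (𝕀 : List Interval) : Set where
      field
        {endOfStream final} : State
        {times}             : List ℕ
        {finishTime}        : ℕ
        pass                : Pass initial 𝕀 endOfStream times
        finishing           : ⟨ finish , endOfStream ⟩⇓⟨ final , finishTime ⟩

      answer : List Interval
      answer = output final

      -- Nodes are never released, so the final footprint is the peak one.
      space : ℕ
      space = cells final

    open Run public using (times; answer; space)

-- Cut the line into half-open cells of length len, and keep for every cell that
-- contains left endpoints the least and the greatest of them.  For ℓ = 0, 1, 2
-- consider the windows of three consecutive cells whose first cell has index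
-- ℓ modulo 3.  An interval of an independent set 𝕁 that lies within a window
-- starts in the first or the second cell; moving it to the least left endpoint
-- of the first cell, or to the greatest one of the second, keeps the intervals
-- disjoint.  Every interval lies within a window for exactly two of the three ℓ,
-- so that one of the resulting sets has at least 2/3 |𝕁| members.  Hence so has a
-- greedy, and thus largest, independent set of stored intervals.
--
-- Taking every other nonempty cell shows that there are at most 2α of them.  They
-- are found by their indices in a 2-4 tree, which is split from the top down
-- during insertion, so that neither a stack nor parent pointers are needed.

module Submission where

open import Defs
open import Algebra.Bundles using (CommutativeRing)
import Algebra.Properties.Ring as RingProperties
open import Data.Bool.Base using (true; false; if_then_else_)
open import Data.Empty using (⊥)
open import Data.Fin.Base using (suc)
open import Data.Fin.Patterns
open import Data.Integer.Base as ℤ using (ℤ; -[1+_]; -≤-; -≤+; +≤+)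
import Data.Integer.Properties as ℤₚ
open import Data.List.Base using (List; []; _∷_; _++_; length; filter; map)
open import Data.List.Membership.Propositional using (_∈_; lose)
open import Data.List.Membership.Propositional.Properties using (∈-++⁺ʳ; ∈-filter⁺)
import Data.List.Properties as Listₚ
open import Data.List.Relation.Binary.Subset.Propositional using (_⊆_)
open import Data.List.Relation.Unary.All as All using (All; []; _∷_)
import Data.List.Relation.Unary.All.Properties as Allₚ
open import Data.List.Relation.Unary.AllPairs as AllPairs using (AllPairs; []; _∷_)
import Data.List.Relation.Unary.AllPairs.Properties as AllPairsₚ
open import Data.List.Relation.Unary.Any using (here; there)
open import Data.List.Relation.Unary.Unique.Propositional using (Unique)
open import Data.Maybe.Base using (Maybe; just; nothing)
open import Data.Maybe.Properties using (≡-dec; just-injective)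
open import Data.Nat.Base as ℕ using (ℕ; zero; suc; z≤n; s≤s)
open import Data.Nat.Logarithm using (⌈log₂_⌉; ⌈log₂⌉-mono-≤; ⌈log₂2*n⌉≡1+⌈log₂n⌉; ⌈log₂2^n⌉≡n)
import Data.Nat.Properties as ℕₚ
open import Data.Nat.Tactic.RingSolver using (solve-∀)
open import Data.Product.Base using (Σ; Σ-syntax; ∃; _×_; _,_; proj₁; proj₂)
open import Data.Sum.Base using (_⊎_; inj₁; inj₂)
open import Data.Unit.Base using (⊤; tt)
open import Data.Vec.Base using (Vec; []; _∷_; lookup; _[_]≔_)
import Relation.Binary.Construct.NonStrictToStrict as Strict
open import Relation.Binary.PropositionalEquality hiding (isPartialOrder; [_])
open import Relation.Binary.Structures using (IsDecTotalOrder)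
open import Relation.Nullary using (¬_; Dec; yes; no; does; contradiction)
open import Relation.Nullary.Decidable using (dec-true; dec-false)

-- Moving the intervals is harmless for two reasons. Left endpoints whose cell indices differ by at
-- least 2 are more than `len` apart wherever they lie in their cells. Two adjacent cells can both
-- be in use only as the first and second cell of one window, and there the left interval moves
-- further left and the right one further right.
--
-- The machine has no smallest key. The dummy leaf stands for it; its key, and every copy of that
-- key in an ancestor, is never compared with anything. Since every insertion takes place to the
-- right of some leaf, the first leaf below a node never changes, and no key of an inner node ever
-- has to be corrected.
--
-- Time is bounded through the height: a tree of height `H` has at least `2 ^ H` leaves, and there
-- are at most `2 * α + 1` of them, the dummy included. Space is bounded through the same number,
-- because no allocated node ever leaves the tree.

module OrderedFieldProperties (F : OrderedField) where
  open OrderedField F public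
  open IsDecTotalOrder isDecTotalOrder public
    using (_≟_; _≤?_; antisym; total; isPartialOrder)
    renaming (refl to ≤-refl; trans to ≤-trans; reflexive to ≤-reflexive)

  private
    commutativeRing : CommutativeRing _ _
    commutativeRing = record { isCommutativeRing = isCommutativeRing }

  open CommutativeRing commutativeRing public
    using (+-comm; +-assoc; +-identityˡ; +-identityʳ; -‿inverseʳ; -‿inverseˡ;
           *-comm; *-assoc; *-identityˡ; *-identityʳ; distribʳ)
  open RingProperties (CommutativeRing.ring commutativeRing) public
    using (-‿distribˡ-*; -‿distribʳ-*; -‿involutive; -0#≈0#)

  <⇒≤ : ∀ {x y} → x < y → x ≤ y
  <⇒≤ = proj₁

  <⇒≱ : ∀ {x y} → x < y → ¬ y ≤ x
  <⇒≱ = Strict.<⇒≱ _≡_ _≤_ antisym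

  ≰⇒> : ∀ {x y} → ¬ x ≤ y → y < x
  ≰⇒> = Strict.≰⇒> _≡_ _≤_ sym ≤-reflexive total

  <-trans : ∀ {x y z} → x < y → y < z → x < z
  <-trans = Strict.<-trans _≡_ _≤_ isPartialOrder

  <-≤-trans : ∀ {x y z} → x < y → y ≤ z → x < z
  <-≤-trans = Strict.<-≤-trans _≡_ _≤_ sym ≤-trans antisym (λ { refl p → p })

  ≤-<-trans : ∀ {x y z} → x ≤ y → y < z → x < z
  ≤-<-trans = Strict.≤-<-trans _≡_ _≤_ ≤-trans antisym (λ { refl p → p })

  _<?_ : ∀ x y → Dec (x < y)
  _<?_ = Strict.<-decidable _≡_ _≤_ _≟_ _≤?_

  <-irrefl : ∀ {x} → ¬ x < x
  <-irrefl (_ , x≢x) = x≢x refl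

  infix 4 _<?_

  +-monoˡ-≤ : ∀ z {x y} → x ≤ y → x + z ≤ y + z
  +-monoˡ-≤ z {x} {y} x≤y = subst₂ _≤_ (+-comm z x) (+-comm z y) (+-monoʳ-≤ z x≤y)

  x+z-z≡x : ∀ x z → x + z + - z ≡ x
  x+z-z≡x x z = trans (+-assoc x z (- z))
    (trans (cong (x +_) (-‿inverseʳ z)) (+-identityʳ x))

  x-z+z≡x : ∀ x z → x + - z + z ≡ x
  x-z+z≡x x z = trans (+-assoc x (- z) z)
    (trans (cong (x +_) (-‿inverseˡ z)) (+-identityʳ x))

  +-cancelʳ-≤ : ∀ z {x y} → x + z ≤ y + z → x ≤ y
  +-cancelʳ-≤ z {x} {y} p = subst₂ _≤_ (x+z-z≡x x z) (x+z-z≡x y z) (+-monoˡ-≤ (- z) p)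

  +-monoˡ-< : ∀ z {x y} → x < y → x + z < y + z
  +-monoˡ-< z x<y = ≰⇒> λ p → <⇒≱ x<y (+-cancelʳ-≤ z p)

  +-cancelʳ-< : ∀ z {x y} → x + z < y + z → x < y
  +-cancelʳ-< z p = ≰⇒> λ y≤x → <⇒≱ p (+-monoˡ-≤ z y≤x)

  x<x+z : ∀ x {z} → 0# < z → x < x + z
  x<x+z x {z} 0<z = subst₂ _<_ (+-identityˡ x) (+-comm z x) (+-monoˡ-< x 0<z)

  x-z<x : ∀ x {z} → 0# < z → x - z < x
  x-z<x x {z} 0<z = subst (x - z <_) (x-z+z≡x x z) (x<x+z (x - z) 0<z)

  x≤0⇒0≤-x : ∀ {x} → x ≤ 0# → 0# ≤ - x
  x≤0⇒0≤-x {x} x≤0 = subst₂ _≤_ (-‿inverseʳ x) (+-identityˡ (- x)) (+-monoˡ-≤ (- x) x≤0)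

  neg-antimono-≤ : ∀ {x y} → x ≤ y → - y ≤ - x
  neg-antimono-≤ {x} {y} x≤y = +-cancelʳ-≤ y
    (subst₂ _≤_ (sym (-‿inverseˡ y)) (+-comm y (- x))
      (subst (_≤ y + - x) (-‿inverseʳ x) (+-monoˡ-≤ (- x) x≤y)))

  -- Otherwise `1# ≤ 0#`, hence `0# ≤ - 1#`, and the square of `- 1#` gives `0# ≤ 1#`; antisymmetry
  -- then yields `0# ≡ 1#`.
  0<1 : 0# < 1#
  0<1 = ≰⇒> λ 1≤0 → 0≢1 (antisym
    (subst (0# ≤_) (trans (sym (-‿distribˡ-* 1# (- 1#)))
                   (trans (cong -_ (*-identityˡ (- 1#))) (-‿involutive 1#)))
       (*-nonNegative (x≤0⇒0≤-x 1≤0) (x≤0⇒0≤-x 1≤0)))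
    1≤0)

  *-monoˡ-≤-nonNeg : ∀ {z} → 0# ≤ z → ∀ {x y} → x ≤ y → x * z ≤ y * z
  *-monoˡ-≤-nonNeg {z} 0≤z {x} {y} x≤y = +-cancelʳ-≤ (- (x * z))
    (subst₂ _≤_ (sym (-‿inverseʳ (x * z)))
       (trans (distribʳ z y (- x)) (cong (y * z +_) (sym (-‿distribˡ-* x z))))
       (*-nonNegative (subst (_≤ y - x) (-‿inverseʳ x) (+-monoˡ-≤ (- x) x≤y)) 0≤z))

  module _ {z} (0<z : 0# < z) where
    private
      z≢0 : z ≢ 0#
      z≢0 z≡0 = proj₂ 0<z (sym z≡0)

    x*z*z⁻¹≡x : ∀ x → x * z * z ⁻¹ ≡ x
    x*z*z⁻¹≡x x = trans (*-assoc x z (z ⁻¹))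
      (trans (cong (x *_) (*-inverseʳ z z≢0)) (*-identityʳ x))

    x*z⁻¹*z≡x : ∀ x → x * z ⁻¹ * z ≡ x
    x*z⁻¹*z≡x x = trans (*-assoc x (z ⁻¹) z)
      (trans (cong (x *_) (trans (*-comm (z ⁻¹) z) (*-inverseʳ z z≢0))) (*-identityʳ x))

    0≤z⁻¹ : 0# ≤ z ⁻¹
    0≤z⁻¹ with total 0# (z ⁻¹)
    ... | inj₁ p = p
    ... | inj₂ z⁻¹≤0 = contradiction
      (subst (0# ≤_) (trans (sym (-‿distribʳ-* z (z ⁻¹))) (cong -_ (*-inverseʳ z z≢0)))
         (*-nonNegative (<⇒≤ 0<z) (x≤0⇒0≤-x z⁻¹≤0)))
      (λ 0≤-1 → <⇒≱ 0<1 (subst₂ _≤_ (-‿involutive 1#) -0#≈0# (neg-antimono-≤ 0≤-1)))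

    *-monoˡ-< : ∀ {x y} → x < y → x * z < y * z
    *-monoˡ-< {x} {y} x<y = ≰⇒> λ p → <⇒≱ x<y
      (subst₂ _≤_ (x*z*z⁻¹≡x y) (x*z*z⁻¹≡x x) (*-monoˡ-≤-nonNeg 0≤z⁻¹ p))

    *⁻¹-monoˡ-< : ∀ {x y} → x < y → x * z ⁻¹ < y * z ⁻¹
    *⁻¹-monoˡ-< {x} {y} x<y = ≰⇒> λ p → <⇒≱ x<y
      (subst₂ _≤_ (x*z⁻¹*z≡x y) (x*z⁻¹*z≡x x) (*-monoˡ-≤-nonNeg (<⇒≤ 0<z) p))

  fromℤ-suc : ∀ i → fromℤ F (ℤ.suc i) ≡ fromℤ F i + 1#
  fromℤ-suc (ℤ.+ n) = +-comm 1# (fromℤ F (ℤ.+ n))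
  fromℤ-suc -[1+ zero ] = sym (trans (cong (λ x → - x + 1#) (+-identityʳ 1#)) (-‿inverseˡ 1#))
  fromℤ-suc -[1+ suc n ] = sym (begin
      - (1# + x) + 1#         ≡⟨ cong (_+ 1#) (sym neg-sum) ⟩
      - x + - 1# + 1#         ≡⟨ x-z+z≡x (- x) 1# ⟩
      - x                     ∎)
    where
    open ≡-Reasoning
    x = fromℤ F (ℤ.+ suc n)
    neg-sum : - x + - 1# ≡ - (1# + x)
    neg-sum = begin
      - x + - 1#                              ≡⟨ sym (x+z-z≡x _ (1# + x)) ⟩
      - x + - 1# + (1# + x) + - (1# + x)      ≡⟨ cong (_+ - (1# + x)) (sym (+-assoc (- x + - 1#) 1# x)) ⟩
      - x + - 1# + 1# + x + - (1# + x)        ≡⟨ cong (λ y → y + x + - (1# + x)) (x-z+z≡x (- x) 1#) ⟩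
      - x + x + - (1# + x)                    ≡⟨ cong (_+ - (1# + x)) (-‿inverseˡ x) ⟩
      0# + - (1# + x)                         ≡⟨ +-identityˡ _ ⟩
      - (1# + x)                              ∎

  fromℤ-nonNeg : ∀ n → 0# ≤ fromℤ F (ℤ.+ n)
  fromℤ-nonNeg zero    = ≤-refl
  fromℤ-nonNeg (suc n) = ≤-trans (fromℤ-nonNeg n)
    (subst (fromℤ F (ℤ.+ n) ≤_) (+-comm _ 1#) (<⇒≤ (x<x+z _ 0<1)))

  fromℤ-+-mono-≤ : ∀ {m n} → m ℕ.≤ n → fromℤ F (ℤ.+ m) ≤ fromℤ F (ℤ.+ n)
  fromℤ-+-mono-≤ {n = n} z≤n = fromℤ-nonNeg n
  fromℤ-+-mono-≤ (s≤s m≤n)   = +-monoʳ-≤ 1# (fromℤ-+-mono-≤ m≤n)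

  fromℤ-mono-≤ : ∀ {i j} → i ℤ.≤ j → fromℤ F i ≤ fromℤ F j
  fromℤ-mono-≤ (-≤- n≤m) = neg-antimono-≤ (fromℤ-+-mono-≤ (s≤s n≤m))
  fromℤ-mono-≤ (-≤+ {m} {n}) = ≤-trans
    (subst (- fromℤ F (ℤ.+ suc m) ≤_) -0#≈0# (neg-antimono-≤ (fromℤ-nonNeg (suc m))))
    (fromℤ-nonNeg n)
  fromℤ-mono-≤ (+≤+ m≤n) = fromℤ-+-mono-≤ m≤n

  fromℤ-cancel-< : ∀ {i j} → fromℤ F i < fromℤ F j → i ℤ.< j
  fromℤ-cancel-< p = ℤₚ.≰⇒> λ j≤i → <⇒≱ p (fromℤ-mono-≤ j≤i)

  -- The machine keeps cell indices as reals; this recovers an equality of cells from an equality of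
  -- keys.
  fromℤ-injective : ∀ {i j} → fromℤ F i ≡ fromℤ F j → i ≡ j
  fromℤ-injective {i} {j} eq = ℤₚ.≤-antisym (reflect eq) (reflect (sym eq))
    where
    reflect : ∀ {i j} → fromℤ F i ≡ fromℤ F j → i ℤ.≤ j
    reflect {i} {j} eq = ℤₚ.≮⇒≥ λ j<i → <⇒≱
      (<-≤-trans (subst (fromℤ F j <_) (sym (fromℤ-suc j)) (x<x+z _ 0<1))
                 (fromℤ-mono-≤ (ℤₚ.i<j⇒suc[i]≤j j<i)))
      (≤-reflexive eq)

-- Residues of cell indices modulo 3.

data Colour : Set where
  c₀ c₁ c₂ : Colour

next prev : Colour → Colour
next c₀ = c₁
next c₁ = c₂
next c₂ = c₀
prev c₀ = c₂
prev c₁ = c₀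
prev c₂ = c₁

next-prev : ∀ k → next (prev k) ≡ k
next-prev c₀ = refl
next-prev c₁ = refl
next-prev c₂ = refl

-- The residue modulo 3, by recursion on the constructors, which makes `colour-suc` almost
-- definitional.
colour : ℤ → Colour
colour (ℤ.+ zero)     = c₀
colour (ℤ.+ suc n)    = next (colour (ℤ.+ n))
colour -[1+ zero ]    = c₂
colour -[1+ suc n ]   = prev (colour -[1+ n ])

colour-suc : ∀ i → colour (ℤ.suc i) ≡ next (colour i)
colour-suc (ℤ.+ n)        = refl
colour-suc -[1+ zero ]    = refl
colour-suc -[1+ suc n ]   = sym (next-prev (colour -[1+ n ]))

-- The ℓ-th shift cuts the line into windows of three cells, beginning with a
-- cell of colour ℓ.  An interval starting in the third cell of a window is not
-- contained in it.
data Role : Set where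
  leftmost rightmost dropped : Role

role : Colour → Colour → Role
role c₀ c₀ = leftmost
role c₀ c₁ = rightmost
role c₀ c₂ = dropped
role c₁ c₀ = dropped
role c₁ c₁ = leftmost
role c₁ c₂ = rightmost
role c₂ c₀ = rightmost
role c₂ c₁ = dropped
role c₂ c₂ = leftmost

-- In the cyclic order of the colours `rightmost` is followed by `dropped`, so that the only
-- consecutive pair avoiding `dropped` begins with `leftmost`.
role-next : ∀ ℓ k → role ℓ k ≢ dropped → role ℓ (next k) ≢ dropped →
            role ℓ k ≡ leftmost × role ℓ (next k) ≡ rightmost
role-next c₀ c₀ p q = refl , refl
role-next c₀ c₁ p q = contradiction refl q
role-next c₀ c₂ p q = contradiction refl p
role-next c₁ c₀ p q = contradiction refl p
role-next c₁ c₁ p q = refl , refl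
role-next c₁ c₂ p q = contradiction refl q
role-next c₂ c₀ p q = contradiction refl q
role-next c₂ c₁ p q = contradiction refl p
role-next c₂ c₂ p q = refl , refl

everyOther : ∀ {A : Set} → List A → List A
everyOther []           = []
everyOther (x ∷ [])     = x ∷ []
everyOther (x ∷ _ ∷ xs) = x ∷ everyOther xs

length-everyOther : ∀ {A : Set} (xs : List A) → length xs ℕ.≤ 2 ℕ.* length (everyOther xs)
length-everyOther []           = z≤n
length-everyOther (x ∷ [])     = s≤s z≤n
length-everyOther (x ∷ _ ∷ xs) = ℕₚ.≤-trans (s≤s (s≤s (length-everyOther xs)))
  (ℕₚ.≤-reflexive (sym (ℕₚ.*-suc 2 _)))

All-everyOther : ∀ {A : Set} {P : A → Set} {xs} → All P xs → All P (everyOther xs)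
All-everyOther []             = []
All-everyOther (p ∷ [])       = p ∷ []
All-everyOther (p ∷ _ ∷ ps)   = p ∷ All-everyOther ps

-- Left endpoints and their cells.

module Cells (R : Reals) (len : Reals.Carrier R)
             (0<len : OrderedField._<_ (Reals.orderedField R) (Reals.0# R) len) where
  open Reals R using (orderedField; ⌊_⌋; ⌊⌋-lower; ⌊⌋-upper)
  open OrderedFieldProperties orderedField
  open IntervalStreams R using (Interval; [_,_]; lo; hi; HasLength; Disjoint)

  cell : Carrier → ℤ
  cell x = ⌊ x * len ⁻¹ ⌋

  -- After division by `len` the two numbers differ by more than 1, and so their floors differ.
  -- Hence members of an independent set start in different cells.
  cell-< : ∀ {x y} → x + len < y → cell x ℤ.< cell y
  cell-< {x} {y} x+len<y = fromℤ-cancel-< (+-cancelʳ-< 1#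
    (≤-<-trans (+-monoˡ-≤ 1# (⌊⌋-lower _))
      (<-trans (subst (_< y * len ⁻¹) x+len/len (*⁻¹-monoˡ-< 0<len x+len<y)) (⌊⌋-upper _))))
    where
    x+len/len : (x + len) * len ⁻¹ ≡ x * len ⁻¹ + 1#
    x+len/len = trans (distribʳ (len ⁻¹) x len)
      (cong (x * len ⁻¹ +_) (*-inverseʳ len λ len≡0 → proj₂ 0<len (sym len≡0)))

  -- Strictness comes from `⌊⌋-upper`, that is, from the cells being half-open. It is essential, as
  -- closed intervals with a common endpoint intersect.
  cell-gap : ∀ {x y} → ℤ.suc (ℤ.suc (cell x)) ℤ.≤ cell y → x + len < y
  cell-gap {x} {y} gap = subst₂ _<_
      (trans (distribʳ len (x * len ⁻¹) 1#)
             (cong₂ _+_ (x*z⁻¹*z≡x 0<len x) (*-identityˡ len)))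
      (x*z⁻¹*z≡x 0<len y)
      (*-monoˡ-< 0<len (<-≤-trans x/len+1<2+cell (≤-trans (fromℤ-mono-≤ gap) (⌊⌋-lower _))))
    where
    x/len+1<2+cell : x * len ⁻¹ + 1# < fromℤ orderedField (ℤ.suc (ℤ.suc (cell x)))
    x/len+1<2+cell = subst (x * len ⁻¹ + 1# <_)
      (sym (trans (fromℤ-suc (ℤ.suc (cell x))) (cong (_+ 1#) (fromℤ-suc (cell x)))))
      (+-monoˡ-< 1# (⌊⌋-upper _))

  Apart : Carrier → Carrier → Set
  Apart x y = x + len < y ⊎ y + len < x

  interval : Carrier → Interval
  interval x = [ x , x + len ]

  HasLength⇒≡interval : ∀ {I} → HasLength len I → I ≡ interval (lo I)
  HasLength⇒≡interval {[ x , y ]} y-x≡len = cong [ x ,_]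
    (trans (sym (x-z+z≡x y x)) (trans (cong (_+ x) y-x≡len) (+-comm len x)))

  +len<⇒Disjoint : ∀ {x y} → x + len < y → Disjoint (interval x) (interval y)
  +len<⇒Disjoint x+len<y z ((_ , z≤x+len) , (y≤z , _)) = <⇒≱ x+len<y (≤-trans y≤z z≤x+len)

  Apart⇒Disjoint : ∀ {x y} → Apart x y → Disjoint (interval x) (interval y)
  Apart⇒Disjoint (inj₁ p) z zs         = +len<⇒Disjoint p z zs
  Apart⇒Disjoint (inj₂ p) z (z₁ , z₂)  = +len<⇒Disjoint p z (z₂ , z₁)

  Disjoint⇒Apart : ∀ {x y} → Disjoint (interval x) (interval y) → Apart x y
  Disjoint⇒Apart {x} {y} disjoint with total x y
  ... | inj₁ x≤y = inj₁ (≰⇒> λ y≤x+len →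
          disjoint y ((x≤y , y≤x+len) , ≤-refl , <⇒≤ (x<x+z y 0<len)))
  ... | inj₂ y≤x = inj₂ (≰⇒> λ x≤y+len →
          disjoint x ((≤-refl , <⇒≤ (x<x+z x 0<len)) , y≤x , x≤y+len))

  -- The cell of a skipped element lies strictly between those of its neighbours, so that the
  -- indices of kept elements differ by at least 2 and `cell-gap` applies.
  everyOther-apart : ∀ {xs} → AllPairs (λ x y → cell x ℤ.< cell y) xs →
                     AllPairs Apart (everyOther xs)
  everyOther-apart []         = []
  everyOther-apart ([] ∷ [])  = [] ∷ []
  everyOther-apart {x ∷ y ∷ xs} ((x<y ∷ _) ∷ y<xs ∷ ps) =
    All-everyOther (All.map (λ y<z → inj₁ (cell-gap (ℤₚ.i<j⇒suc[i]≤j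
      (ℤₚ.≤-<-trans (ℤₚ.i<j⇒suc[i]≤j x<y) y<z)))) y<xs)
    ∷ everyOther-apart ps

  -- A left endpoint x together with values low and high in its cell that the
  -- data structure offers as replacements.
  record Sandwich (V : Carrier → Set) : Set where
    field
      low x high           : Carrier
      low∈V                : V low
      high∈V               : V high
      low≤x                : low ≤ x
      x≤high               : x ≤ high
      cell-low             : cell low ≡ cell x
      cell-high            : cell high ≡ cell x

  -- Moving the members of an independent set to stored values.

  module _ {V : Carrier → Set} where
    open Sandwich

    roleIn : Colour → Sandwich V → Role
    roleIn ℓ s = role ℓ (colour (cell (x s)))

    value : Role → Sandwich V → Carrier
    value leftmost  s = low s
    value rightmost s = high s
    value dropped   s = x s

    cell-value : ∀ r s → cell (value r s) ≡ cell (x s)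
    cell-value leftmost  s = cell-low s
    cell-value rightmost s = cell-high s
    cell-value dropped   s = refl

    -- If the two cells are not consecutive, `cell-gap` allows the values to be anywhere in them. If
    -- they are, `role-next` makes the left one `leftmost` and the right one `rightmost`; then `low`
    -- moves left, `high` moves right, and the gap does not shrink.
    value-+len< : ∀ ℓ s s′ → roleIn ℓ s ≢ dropped → roleIn ℓ s′ ≢ dropped →
                  x s + len < x s′ → value (roleIn ℓ s) s + len < value (roleIn ℓ s′) s′
    value-+len< ℓ s s′ r≢ r′≢ p with ℤ.suc (cell (x s)) ℤₚ.≟ cell (x s′)
    ... | no ≢next = cell-gap (subst₂ (λ i j → ℤ.suc (ℤ.suc i) ℤ.≤ j)
            (sym (cell-value (roleIn ℓ s) s)) (sym (cell-value (roleIn ℓ s′) s′))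
            (ℤₚ.i<j⇒suc[i]≤j (ℤₚ.≤∧≢⇒< (ℤₚ.i<j⇒suc[i]≤j (cell-< p)) ≢next)))
    ... | yes ≡next = subst₂ (λ r r′ → value r s + len < value r′ s′) (sym (proj₁ roles))
            (trans (sym (proj₂ roles)) (sym role-s′))
            (≤-<-trans (+-monoˡ-≤ len (low≤x s)) (<-≤-trans p (x≤high s′)))
      where
      role-s′ : roleIn ℓ s′ ≡ role ℓ (next (colour (cell (x s))))
      role-s′ = cong (role ℓ) (trans (cong colour (sym ≡next)) (colour-suc (cell (x s))))
      roles = role-next ℓ (colour (cell (x s))) r≢ (λ eq → r′≢ (trans role-s′ eq))

    value-apart : ∀ ℓ s s′ → roleIn ℓ s ≢ dropped → roleIn ℓ s′ ≢ dropped →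
                  Apart (x s) (x s′) → Apart (value (roleIn ℓ s) s) (value (roleIn ℓ s′) s′)
    value-apart ℓ s s′ r r′ (inj₁ p) = inj₁ (value-+len< ℓ s s′ r r′ p)
    value-apart ℓ s s′ r r′ (inj₂ p) = inj₂ (value-+len< ℓ s′ s r′ r p)

    pick : Colour → List (Sandwich V) → List Carrier
    pick ℓ []       = []
    pick ℓ (s ∷ ss) with roleIn ℓ s
    ... | leftmost  = low s ∷ pick ℓ ss
    ... | rightmost = high s ∷ pick ℓ ss
    ... | dropped   = pick ℓ ss

    pick-All : ∀ {P : Carrier → Set} ℓ {ss} →
               All (λ s → roleIn ℓ s ≢ dropped → P (value (roleIn ℓ s) s)) ss →
               All P (pick ℓ ss)
    pick-All ℓ [] = []
    pick-All ℓ {s ∷ ss} (p ∷ ps) with roleIn ℓ s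
    ... | leftmost  = p (λ ()) ∷ pick-All ℓ ps
    ... | rightmost = p (λ ()) ∷ pick-All ℓ ps
    ... | dropped   = pick-All ℓ ps

    pick-∈ : ∀ ℓ ss → All V (pick ℓ ss)
    pick-∈ ℓ []       = []
    pick-∈ ℓ (s ∷ ss) with roleIn ℓ s
    ... | leftmost  = low∈V s ∷ pick-∈ ℓ ss
    ... | rightmost = high∈V s ∷ pick-∈ ℓ ss
    ... | dropped   = pick-∈ ℓ ss

    value-apart-pick : ∀ ℓ s {ss} → All (λ s′ → Apart (x s) (x s′)) ss →
                       roleIn ℓ s ≢ dropped → All (Apart (value (roleIn ℓ s) s)) (pick ℓ ss)
    value-apart-pick ℓ s ps r≢ =
      pick-All ℓ (All.map (λ {s′} p r′≢ → value-apart ℓ s s′ r≢ r′≢ p) ps)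

    pick-apart : ∀ ℓ {ss} → AllPairs (λ s s′ → Apart (x s) (x s′)) ss →
                 AllPairs Apart (pick ℓ ss)
    pick-apart ℓ [] = []
    pick-apart ℓ {s ∷ ss} (ps ∷ pss) with roleIn ℓ s | value-apart-pick ℓ s ps
    ... | leftmost  | qs = qs (λ ()) ∷ pick-apart ℓ pss
    ... | rightmost | qs = qs (λ ()) ∷ pick-apart ℓ pss
    ... | dropped   | _  = pick-apart ℓ pss

    -- For exactly one of the three shifts a member has the role `dropped`, so that it is counted
    -- twice.
    length-pick : ∀ ss → 2 ℕ.* length ss ≡
                  length (pick c₀ ss) ℕ.+ length (pick c₁ ss) ℕ.+ length (pick c₂ ss)
    length-pick [] = refl
    length-pick (s ∷ ss) with colour (cell (x s))
    ... | c₀ = trans (ℕₚ.*-suc 2 _) (trans (cong (2 ℕ.+_) (length-pick ss))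
          (shift₀ (length (pick c₀ ss)) (length (pick c₁ ss)) (length (pick c₂ ss))))
      where
      shift₀ : ∀ a b c → 2 ℕ.+ (a ℕ.+ b ℕ.+ c) ≡ suc a ℕ.+ b ℕ.+ suc c
      shift₀ = solve-∀
    ... | c₁ = trans (ℕₚ.*-suc 2 _) (trans (cong (2 ℕ.+_) (length-pick ss))
          (shift₁ (length (pick c₀ ss)) (length (pick c₁ ss)) (length (pick c₂ ss))))
      where
      shift₁ : ∀ a b c → 2 ℕ.+ (a ℕ.+ b ℕ.+ c) ≡ suc a ℕ.+ suc b ℕ.+ c
      shift₁ = solve-∀
    ... | c₂ = trans (ℕₚ.*-suc 2 _) (trans (cong (2 ℕ.+_) (length-pick ss))
          (shift₂ (length (pick c₀ ss)) (length (pick c₁ ss)) (length (pick c₂ ss))))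
      where
      shift₂ : ∀ a b c → 2 ℕ.+ (a ℕ.+ b ℕ.+ c) ≡ a ℕ.+ suc b ℕ.+ suc c
      shift₂ = solve-∀

    -- Averaging over the three shifts: each selection consists of stored values and is independent,
    -- so that none is longer than `g`.
    two-thirds : ∀ {n g} (ss : List (Sandwich V)) → AllPairs (λ s s′ → Apart (x s) (x s′)) ss →
                 length ss ≡ n → (∀ {ys} → All V ys → AllPairs Apart ys → length ys ℕ.≤ g) →
                 2 ℕ.* n ℕ.≤ 3 ℕ.* g
    two-thirds {g = g} ss apart refl optimal = subst (ℕ._≤ 3 ℕ.* g) (sym (length-pick ss))
      (subst (length (pick c₀ ss) ℕ.+ length (pick c₁ ss) ℕ.+ length (pick c₂ ss) ℕ.≤_)
        (thrice g) (ℕₚ.+-mono-≤ (ℕₚ.+-mono-≤ (bound c₀) (bound c₁)) (bound c₂)))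
      where
      bound : ∀ ℓ → length (pick ℓ ss) ℕ.≤ g
      bound ℓ = optimal (pick-∈ ℓ ss) (pick-apart ℓ apart)
      thrice : ∀ g → g ℕ.+ g ℕ.+ g ≡ 3 ℕ.* g
      thrice = solve-∀

  -- Here `y` lies between `v` and `v + len`. A value `z` apart from `y` cannot be on its left,
  -- since `z + len < y` together with `v ≤ z` would put `y` beyond `v + len`.
  near-excludes : ∀ {v y z} → v ≤ y → ¬ v + len < y → v ≤ z × Apart y z → v + len < z
  near-excludes v≤y v+len≮y (v≤z , inj₁ y+len<z) = ≤-<-trans (+-monoˡ-≤ len v≤y) y+len<z
  near-excludes v≤y v+len≮y (v≤z , inj₂ z+len<y) =
    contradiction (≤-<-trans (+-monoˡ-≤ len v≤z) z+len<y) v+len≮y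

  -- At most one member of an independent set meets the interval with the
  -- smallest left endpoint.
  greedy-exchange : ∀ {v ys} → All (v ≤_) ys → AllPairs Apart ys →
                    length ys ℕ.≤ suc (length (filter (v + len <?_) ys))
  greedy-exchange [] [] = z≤n
  greedy-exchange {v} {y ∷ ys} (v≤y ∷ v≤ys) (y# ∷ apart) with v + len <? y
  ... | yes v+len<y
          rewrite Listₚ.filter-accept (v + len <?_) {xs = ys} v+len<y =
        s≤s (greedy-exchange v≤ys apart)
  ... | no v+len≮y
          rewrite Listₚ.filter-reject (v + len <?_) {xs = ys} v+len≮y
                | Listₚ.filter-all (v + len <?_) (All.zipWith (near-excludes v≤y v+len≮y) (v≤ys , y#)) =
        ℕₚ.≤-refl

-- The stream program.

layout : Layout
layout = record { realRegs = 7 ; ptrRegs = 11 ; realSlots = 3 ; ptrSlots = 3 }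

module Program where
  pattern rLo    = 0F
  pattern rHi    = 1F
  pattern rLen   = 2F
  pattern rCell  = 3F
  pattern rLast  = 4F
  pattern rTmp   = 5F
  pattern rBest  = 6F

  -- During an insertion `pY` is the current node, `pU` its right sibling, `pD`, `pZ`, `pW`, `pV`
  -- are its first to fourth child, and `pT` is a new node. `pG` serves as a flag: it is non-nil
  -- while the search goes on and, in a greedy round, once a candidate has been found.
  pattern pRoot  = 0F
  pattern pDummy = 1F
  pattern pChain = 2F
  pattern pY     = 3F
  pattern pU     = 4F
  pattern pD     = 5F
  pattern pZ     = 6F
  pattern pW     = 7F
  pattern pV     = 8F
  pattern pT     = 9F
  pattern pG     = suc 9F

  pattern fKey   = 0F
  pattern fMin   = 1F
  pattern fMax   = 2F

  pattern fDown  = 0F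
  pattern fRight = 1F
  pattern fNext  = 2F

  -- The dictionary is a 2-4 tree with all the records in the leaves, in the
  -- first-child (fDown), next-sibling (fRight) representation.  The key of a node
  -- is the key of the first leaf below it.  The very first leaf is a dummy, so
  -- that every insertion takes place to the right of some leaf.
  insertLeaf widenLeaf visitLeaf splitNode descend stay body loop : Cmd layout
  insertLeaf =
    instr (new pT) ⨾ instr (setReal pT fKey rCell) ⨾ instr (setReal pT fMin rLo) ⨾
    instr (setReal pT fMax rLo) ⨾ instr (setPtr pT fRight pU) ⨾
    instr (setPtr pT fNext pChain) ⨾ instr (copyPtr pChain pT) ⨾
    instr (setPtr pY fRight pT) ⨾ instr (nil pG)
  widenLeaf =
    instr (getReal rTmp pY fMin) ⨾
    -- The final `skip` provides the continuation that the rule `storeReal` asks for.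
    cond (leq rTmp rLo) skip (instr (setReal pY fMin rLo) ⨾ skip) ⨾
    instr (getReal rTmp pY fMax) ⨾
    cond (leq rLo rTmp) skip (instr (setReal pY fMax rLo) ⨾ skip) ⨾ instr (nil pG)
  visitLeaf =
    cond (same pY pDummy) insertLeaf
      (instr (getReal rTmp pY fKey) ⨾ cond (leq rCell rTmp) widenLeaf insertLeaf)

  -- A node is split on the way down if it has four children, so that its
  -- children have room for one more.
  splitNode =
    instr (new pT) ⨾ instr (setPtr pT fDown pW) ⨾ instr (setPtr pT fRight pU) ⨾
    instr (getReal rTmp pW fKey) ⨾ instr (setReal pT fKey rTmp) ⨾
    instr (setPtr pY fRight pT) ⨾ instr (nil pV) ⨾ instr (setPtr pZ fRight pV) ⨾
    cond (leq rTmp rCell) (instr (copyPtr pY pW)) (instr (copyPtr pY pD))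
  descend =
    instr (getPtr pZ pD fRight) ⨾ instr (getPtr pW pZ fRight) ⨾
    cond (isNil pW) (instr (copyPtr pY pD))
      (instr (getPtr pV pW fRight) ⨾ cond (isNil pV) (instr (copyPtr pY pD)) splitNode)
  stay = instr (getPtr pD pY fDown) ⨾ cond (isNil pD) visitLeaf descend
  body =
    instr (getPtr pU pY fRight) ⨾
    cond (isNil pU) stay
      (instr (getReal rTmp pU fKey) ⨾ cond (leq rTmp rCell) (instr (copyPtr pY pU)) stay)
  loop = while (negate (isNil pG)) body

  -- The register rLast is kept below all the left endpoints seen so far.
  prologue growRoot handle : Cmd layout
  prologue =
    instr (sub rLen rHi rLo) ⨾ instr (floorDiv rCell rLo rLen) ⨾
    cond (leq rLo rLast) (instr (sub rLast rLo rLen)) skip ⨾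
    cond (isNil pRoot) (instr (new pRoot) ⨾ instr (copyPtr pDummy pRoot)) skip ⨾
    instr (copyPtr pY pRoot) ⨾ instr (copyPtr pG pRoot)
  -- The root has no parent, so that a split leaves its second half as a right sibling of the root;
  -- both halves are then put under a new root.
  growRoot =
    instr (getPtr pU pRoot fRight) ⨾
    cond (isNil pU) skip
      (instr (new pT) ⨾ instr (setPtr pT fDown pRoot) ⨾ instr (getReal rTmp pRoot fKey) ⨾
       instr (setReal pT fKey rTmp) ⨾ instr (copyPtr pRoot pT))
  handle = prologue ⨾ loop ⨾ growRoot

  -- Greedy selection among the stored left endpoints: each round scans the chain
  -- of records for the least value above rLast.
  consider scanBody scan round finish : Cmd layout
  consider =
    cond (leq rTmp rLast) skip
      (cond (isNil pG) (instr (copyReal rBest rTmp) ⨾ instr (copyPtr pG pY))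
        (cond (leq rBest rTmp) skip (instr (copyReal rBest rTmp) ⨾ instr (copyPtr pG pY))))
  scanBody =
    instr (getReal rTmp pY fMin) ⨾ consider ⨾ instr (getReal rTmp pY fMax) ⨾ consider ⨾
    instr (getPtr pY pY fNext)
  scan = while (negate (isNil pY)) scanBody
  round =
    instr (nil pG) ⨾ instr (copyPtr pY pChain) ⨾ scan ⨾
    cond (isNil pG) skip (instr (add rLast rBest rLen) ⨾ instr (emit rBest rLast))
  finish = instr (copyPtr pG pChain) ⨾ while (negate (isNil pG)) round

  algorithm : StreamAlgorithm
  algorithm = record
    { layout = layout ; inLo = rLo ; inHi = rHi ; handle = handle ; finish = finish }

-- Execution, time and heap updates.

LoopFree : ∀ {L} → Cmd L → Set
LoopFree skip         = ⊤
LoopFree (instr _)    = ⊤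
LoopFree (c ⨾ d)      = LoopFree c × LoopFree d
LoopFree (cond _ c d) = LoopFree c × LoopFree d
LoopFree (while _ _)  = ⊥

-- A bound on the time of loop-free commands; the value 0 for `while` is a placeholder. Charging
-- both branches of a conditional avoids taking a maximum.
cost : ∀ {L} → Cmd L → ℕ
cost skip         = 0
cost (instr _)    = 1
cost (c ⨾ d)      = cost c ℕ.+ cost d
cost (cond _ c d) = suc (cost c ℕ.+ cost d)
cost (while _ _)  = 0

module Execution (R : Reals) (L : Layout) where
  open OrderedFieldProperties (Reals.orderedField R) using (Carrier; _≤_; _≤?_)
  open IntervalStreams R
  open Semantics L

  time≤cost : ∀ c {σ τ t} → LoopFree c → ⟨ c , σ ⟩⇓⟨ τ , t ⟩ → t ℕ.≤ cost c
  time≤cost skip      _ skip-⇓      = z≤n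
  time≤cost (instr _) _ (instr-⇓ _) = ℕₚ.≤-refl
  time≤cost (c ⨾ d) (p , q) (seq-⇓ x y) = ℕₚ.+-mono-≤ (time≤cost c p x) (time≤cost d q y)
  time≤cost (cond b c d) {σ} (p , q) (cond-⇓ x) with holds b σ
  ... | true  = s≤s (ℕₚ.≤-trans (time≤cost c p x) (ℕₚ.m≤m+n _ _))
  ... | false = s≤s (ℕₚ.≤-trans (time≤cost d q x) (ℕₚ.m≤n+m _ _))

  -- Total correctness. As `Q` may itself be a `Reach` of the remaining command, a program can be
  -- verified from front to back along its text.
  Reach : Cmd L → State → (State → Set) → Set
  Reach c σ Q = Σ State λ τ → Σ ℕ λ t → ⟨ c , σ ⟩⇓⟨ τ , t ⟩ × Q τ

  ReachIn : ℕ → Cmd L → State → (State → Set) → Set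
  ReachIn n c σ Q = Σ State λ τ → Σ ℕ λ t → ⟨ c , σ ⟩⇓⟨ τ , t ⟩ × t ℕ.≤ n × Q τ

  module _ {Q : State → Set} where
    done : ∀ {σ} → Q σ → Reach skip σ Q
    done q = _ , _ , skip-⇓ , q

    final : ∀ {i σ τ} → exec i σ ≡ just τ → Q τ → Reach (instr i) σ Q
    final eq q = _ , _ , instr-⇓ eq , q

    infixr 4 _then_
    _then_ : ∀ {c d σ} {P : State → Set} → Reach c σ P → (∀ {τ} → P τ → Reach d τ Q) →
             Reach (c ⨾ d) σ Q
    (_ , _ , r , p) then k = let (_ , _ , r′ , q) = k p in _ , _ , seq-⇓ r r′ , q

    via : ∀ {c d σ} → Reach c σ (λ τ → Reach d τ Q) → Reach (c ⨾ d) σ Q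
    via r = r then λ q → q

    step : ∀ {i c σ τ} → exec i σ ≡ just τ → Reach c τ Q → Reach (instr i ⨾ c) σ Q
    step eq r = via (_ , _ , instr-⇓ eq , r)

    if-true : ∀ {b c d σ} → holds b σ ≡ true → Reach c σ Q → Reach (cond b c d) σ Q
    if-true {c = c} {d} {σ} eq (τ , t , r , q) =
      τ , suc t , cond-⇓ (subst (λ x → ⟨ if x then c else d , σ ⟩⇓⟨ τ , t ⟩) (sym eq) r) , q

    if-false : ∀ {b c d σ} → holds b σ ≡ false → Reach d σ Q → Reach (cond b c d) σ Q
    if-false {c = c} {d} {σ} eq (τ , t , r , q) =
      τ , suc t , cond-⇓ (subst (λ x → ⟨ if x then c else d , σ ⟩⇓⟨ τ , t ⟩) (sym eq) r) , q

    if-leq : ∀ {r s c d σ} →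
             (lookup (realReg σ) r ≤ lookup (realReg σ) s → Reach c σ Q) →
             (¬ lookup (realReg σ) r ≤ lookup (realReg σ) s → Reach d σ Q) →
             Reach (cond (leq r s) c d) σ Q
    if-leq {r} {s} {σ = σ} yes-case no-case
      with lookup (realReg σ) r ≤? lookup (realReg σ) s
    ... | yes p = if-true (dec-true (_ ≤? _) p) (yes-case p)
    ... | no ¬p = if-false (dec-false (_ ≤? _) ¬p) (no-case ¬p)

    stop : ∀ {b c σ} → holds b σ ≡ false → Q σ → Reach (while b c) σ Q
    stop eq q = _ , _ , while-⇓₀ eq , q

    iterate : ∀ {b c σ} → holds b σ ≡ true → Reach c σ (λ τ → Reach (while b c) τ Q) →
              Reach (while b c) σ Q
    iterate eq (_ , _ , r , _ , _ , r′ , q) = _ , _ , while-⇓₁ eq r r′ , q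

    iterateIn : ∀ {b c σ n} → LoopFree c → holds b σ ≡ true →
                Reach c σ (λ τ → ReachIn n (while b c) τ Q) →
                ReachIn (suc (cost c ℕ.+ n)) (while b c) σ Q
    iterateIn {c = c} lf eq (_ , _ , r , _ , _ , r′ , t≤n , q) =
      _ , _ , while-⇓₁ eq r r′ , s≤s (ℕₚ.+-mono-≤ (time≤cost c lf r) t≤n) , q

    loadReal : ∀ {r p i c σ a x} → lookup (ptrReg σ) p ≡ just a →
               lookup (reals (heap σ a)) i ≡ x →
               Reach c (assignReal r x σ) Q → Reach (instr (getReal r p i) ⨾ c) σ Q
    loadReal {r} {p} {i} {c} {σ} {a} p≡a refl k = step eq k
      where
      eq : exec (getReal r p i) σ ≡ just (assignReal r (lookup (reals (heap σ a)) i) σ)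
      eq rewrite p≡a = refl

    loadPtr : ∀ {q p i c σ a x} → lookup (ptrReg σ) p ≡ just a →
              lookup (ptrs (heap σ a)) i ≡ x →
              Reach c (assignPtr q x σ) Q → Reach (instr (getPtr q p i) ⨾ c) σ Q
    loadPtr {q} {p} {i} {c} {σ} {a} p≡a refl k = step eq k
      where
      eq : exec (getPtr q p i) σ ≡ just (assignPtr q (lookup (ptrs (heap σ a)) i) σ)
      eq rewrite p≡a = refl

  -- Hides the conditional in `storeNode`. Several writes to one node combine into a single `Update`
  -- of the heap before the first of them.
  record Update (h : ℕ → Node) (a : ℕ) (n : Node) (h′ : ℕ → Node) : Set where
    constructor update
    field
      updated  : h′ a ≡ n
      kept : ∀ {x} → x ≢ a → h′ x ≡ h x
  open Update public

  Update-refl : ∀ {h a} → Update h a (h a) h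
  Update-refl = update refl (λ _ → refl)

  Update-store : ∀ {h a n} m h′ → Update h a n h′ →
                 Update h a m (λ b → if does (b ℕₚ.≟ a) then m else h′ b)
  Update-store {h} {a} m h′ u = update at-a elsewhere
    where
    at-a : (if does (a ℕₚ.≟ a) then m else h′ a) ≡ m
    at-a rewrite dec-true (a ℕₚ.≟ a) refl = refl
    elsewhere : ∀ {x} → x ≢ a → (if does (x ℕₚ.≟ a) then m else h′ x) ≡ h x
    elsewhere {x} x≢a rewrite dec-false (x ℕₚ.≟ a) x≢a = kept u x≢a

  module _ {Q : State → Set} where
    storeReal : ∀ {r p i c σ a h₀ n} → lookup (ptrReg σ) p ≡ just a → Update h₀ a n (heap σ) →
      (∀ h′ → Update h₀ a (record n { reals = reals n [ i ]≔ lookup (realReg σ) r }) h′ →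
       Reach c (record σ { heap = h′ }) Q) →
      Reach (instr (setReal p i r) ⨾ c) σ Q
    storeReal {r} {p} {i} {c} {σ} {a} {h₀} {n} p≡a u k = step eq (k _ (Update-store _ (heap σ) u))
      where
      eq : exec (setReal p i r) σ ≡
           just (storeNode a (record n { reals = reals n [ i ]≔ lookup (realReg σ) r }) σ)
      eq rewrite p≡a | updated u = refl

    storePtr : ∀ {q p i c σ a h₀ n} → lookup (ptrReg σ) p ≡ just a → Update h₀ a n (heap σ) →
      (∀ h′ → Update h₀ a (record n { ptrs = ptrs n [ i ]≔ lookup (ptrReg σ) q }) h′ →
       Reach c (record σ { heap = h′ }) Q) →
      Reach (instr (setPtr p i q) ⨾ c) σ Q
    storePtr {q} {p} {i} {c} {σ} {a} {h₀} {n} p≡a u k = step eq (k _ (Update-store _ (heap σ) u))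
      where
      eq : exec (setPtr p i q) σ ≡
           just (storeNode a (record n { ptrs = ptrs n [ i ]≔ lookup (ptrReg σ) q }) σ)
      eq rewrite p≡a | updated u = refl

    allocate : ∀ {p c σ} →
      (∀ h′ → Update (heap σ) (size σ) blank h′ →
       Reach c (assignPtr p (just (size σ)) (record σ { size = suc (size σ) ; heap = h′ })) Q) →
      Reach (instr (new p) ⨾ c) σ Q
    allocate {σ = σ} k = step refl (k _ (Update-store blank (heap σ) Update-refl))

-- 2-4 trees in the heap.

module Dictionary (R : Reals) where
  open Reals R using (orderedField)
  open OrderedFieldProperties orderedField
  open IntervalStreams R using (Interval)
  open IntervalStreams.Semantics R layout
  open Execution R layout
  open Program

  Heap : Set
  Heap = ℕ → Node

  key minLo maxLo : Node → Carrier
  key n   = lookup (reals n) fKey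
  minLo n = lookup (reals n) fMin
  maxLo n = lookup (reals n) fMax

  down right link : Node → Pointer
  down n  = lookup (ptrs n) fDown
  right n = lookup (ptrs n) fRight
  link n  = lookup (ptrs n) fNext

  setRight : Node → Pointer → Node
  setRight n p = record n { ptrs = ptrs n [ fRight ]≔ p }

  right-setRight : ∀ n p → right (setRight n p) ≡ p
  right-setRight (node _ (_ ∷ _ ∷ _ ∷ [])) p = refl

  down-setRight : ∀ n p → down (setRight n p) ≡ down n
  down-setRight (node _ (_ ∷ _ ∷ _ ∷ [])) p = refl

  link-setRight : ∀ n p → link (setRight n p) ≡ link n
  link-setRight (node _ (_ ∷ _ ∷ _ ∷ [])) p = refl

  -- Covers what the tree structure depends on; it survives the widening of a record.
  record SameShape (n n′ : Node) : Set where
    constructor sameShape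
    field
      key-≡   : key n′ ≡ key n
      down-≡  : down n′ ≡ down n
      right-≡ : right n′ ≡ right n

  -- Covers what the chain of records depends on; it survives the redirection of `fRight` in splits
  -- and insertions.
  record SameRecord (n n′ : Node) : Set where
    constructor sameRecord
    field
      key-≡  : key n′ ≡ key n
      min-≡  : minLo n′ ≡ minLo n
      max-≡  : maxLo n′ ≡ maxLo n
      link-≡ : link n′ ≡ link n

  ≡⇒SameShape : ∀ {n n′} → n′ ≡ n → SameShape n n′
  ≡⇒SameShape refl = sameShape refl refl refl

  SameShape-trans : ∀ {n n′ n″} → SameShape n n′ → SameShape n′ n″ → SameShape n n″
  SameShape-trans (sameShape k d r) (sameShape k′ d′ r′) =
    sameShape (trans k′ k) (trans d′ d) (trans r′ r)

  ≡⇒SameRecord : ∀ {n n′} → n′ ≡ n → SameRecord n n′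
  ≡⇒SameRecord refl = sameRecord refl refl refl refl

  SameRecord-trans : ∀ {n n′ n″} → SameRecord n n′ → SameRecord n′ n″ → SameRecord n n″
  SameRecord-trans (sameRecord k a b l) (sameRecord k′ a′ b′ l′) =
    sameRecord (trans k′ k) (trans a′ a) (trans b′ b) (trans l′ l)

  setRight-SameRecord : ∀ {n p n′} → n′ ≡ setRight n p → SameRecord n n′
  setRight-SameRecord {n} {p} refl = sameRecord refl refl refl (link-setRight n p)

  -- A list of sibling trees in first-child, next-sibling form: bin a k d r is
  -- the tree with its root at address a, children d and following siblings r.
  data Tree : Set where
    nil : Tree
    bin : (a : ℕ) (k : Carrier) (d r : Tree) → Tree

  root : Tree → Pointer
  root nil           = nothing
  root (bin a _ _ _) = just a

  rootKey : Tree → Maybe Carrier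
  rootKey nil           = nothing
  rootKey (bin _ k _ _) = just k

  nodes : Tree → ℕ
  nodes nil           = 0
  nodes (bin _ _ d r) = suc (nodes d ℕ.+ nodes r)

  infix 4 _∈ᵗ_ _∉ᵗ_
  _∈ᵗ_ _∉ᵗ_ : ℕ → Tree → Set
  x ∈ᵗ nil         = ⊥
  x ∈ᵗ bin a _ d r = x ≡ a ⊎ x ∈ᵗ d ⊎ x ∈ᵗ r
  x ∉ᵗ f = ¬ x ∈ᵗ f

  Entry : Set
  Entry = ℕ × Carrier

  -- A node without children is a leaf.
  own : ℕ → Carrier → Tree → List Entry → List Entry
  own a k nil           _  = (a , k) ∷ []
  own a k (bin _ _ _ _) es = es

  entries : Tree → List Entry
  entries nil           = []
  entries (bin a k d r) = own a k d (entries d) ++ entries r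

  Rep : Heap → Tree → Set
  Rep h nil           = ⊤
  Rep h (bin a k d r) =
    (key (h a) ≡ k × down (h a) ≡ root d × right (h a) ≡ root r) × Rep h d × Rep h r

  -- Excludes sharing, so that a write inside one subtree leaves the others as they are.
  Separated : Tree → Set
  Separated nil           = ⊤
  Separated (bin a _ d r) =
    (a ∉ᵗ d × a ∉ᵗ r × (∀ {x} → x ∈ᵗ d → x ∉ᵗ r)) × Separated d × Separated r

  record Stored (h : Heap) (sz : ℕ) (f : Tree) : Set where
    constructor stored
    field
      rep       : Rep h f
      separated : Separated f
      bounded   : ∀ {x} → x ∈ᵗ f → x ℕ.< sz
  open Stored public

  Stored-down : ∀ {h sz a k d r} → Stored h sz (bin a k d r) → Stored h sz d
  Stored-down (stored (_ , p , _) (_ , s , _) b) = stored p s λ x∈d → b (inj₂ (inj₁ x∈d))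

  Stored-right : ∀ {h sz a k d r} → Stored h sz (bin a k d r) → Stored h sz r
  Stored-right (stored (_ , _ , p) (_ , _ , s) b) = stored p s λ x∈r → b (inj₂ (inj₂ x∈r))

  Rep-cong : ∀ {h h′} f → (∀ {x} → x ∈ᵗ f → SameShape (h x) (h′ x)) → Rep h f → Rep h′ f
  Rep-cong nil eqs _ = tt
  Rep-cong (bin a k d r) eqs ((p , q , s) , pd , pr) =
    (trans key-≡ p , trans down-≡ q , trans right-≡ s) ,
    Rep-cong d (λ x∈d → eqs (inj₂ (inj₁ x∈d))) pd ,
    Rep-cong r (λ x∈r → eqs (inj₂ (inj₂ x∈r))) pr
    where open SameShape (eqs (inj₁ refl))

  -- As the root stays at its address, the pointers to f from outside remain valid.
  record Local (f : Tree) (sz : ℕ) (h : Heap) (f′ : Tree) (sz′ : ℕ) (h′ : Heap) : Set where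
    field
      size-≤    : sz ℕ.≤ sz′
      origin    : ∀ {x} → x ∈ᵗ f′ → x ∈ᵗ f ⊎ sz ℕ.≤ x
      frame     : ∀ {x} → x ℕ.< sz → x ∉ᵗ f → SameShape (h x) (h′ x)
      count     : sz′ ℕ.+ nodes f ≡ sz ℕ.+ nodes f′
      root-≡    : root f′ ≡ root f
      rootKey-≡ : rootKey f′ ≡ rootKey f
  open Local public

  Local-trans : ∀ {f sz h f′ sz′ h′ f″ sz″ h″} → Local f sz h f′ sz′ h′ →
                Local f′ sz′ h′ f″ sz″ h″ → (∀ {x} → x ∈ᵗ f → x ℕ.< sz) → Local f sz h f″ sz″ h″
  Local-trans {f} {sz} {h} {f′} {sz′} {h′} {f″} {sz″} {h″} p q b = record
    { size-≤    = ℕₚ.≤-trans (size-≤ p) (size-≤ q)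
    ; origin    = from
    ; frame     = λ x<sz x∉f → SameShape-trans (frame p x<sz x∉f)
        (frame q (ℕₚ.<-≤-trans x<sz (size-≤ p)) λ x∈f′ → stay-out x<sz x∉f (origin p x∈f′))
    ; count     = ℕₚ.+-cancelʳ-≡ (nodes f′) _ _ (begin
        sz″ ℕ.+ nodes f ℕ.+ nodes f′   ≡⟨ swap₂ sz″ (nodes f) (nodes f′) ⟩
        sz″ ℕ.+ nodes f′ ℕ.+ nodes f   ≡⟨ cong (ℕ._+ nodes f) (count q) ⟩
        sz′ ℕ.+ nodes f″ ℕ.+ nodes f   ≡⟨ swap₂ sz′ (nodes f″) (nodes f) ⟩
        sz′ ℕ.+ nodes f ℕ.+ nodes f″   ≡⟨ cong (ℕ._+ nodes f″) (count p) ⟩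
        sz ℕ.+ nodes f′ ℕ.+ nodes f″   ≡⟨ swap₂ sz (nodes f′) (nodes f″) ⟩
        sz ℕ.+ nodes f″ ℕ.+ nodes f′   ∎)
    ; root-≡    = trans (root-≡ q) (root-≡ p)
    ; rootKey-≡ = trans (rootKey-≡ q) (rootKey-≡ p)
    }
    where
    open ≡-Reasoning
    swap₂ : ∀ a b c → a ℕ.+ b ℕ.+ c ≡ a ℕ.+ c ℕ.+ b
    swap₂ = solve-∀
    from : ∀ {x} → x ∈ᵗ f″ → x ∈ᵗ f ⊎ sz ℕ.≤ x
    from x∈f″ with origin q x∈f″
    ... | inj₁ x∈f′  = origin p x∈f′
    ... | inj₂ sz′≤x = inj₂ (ℕₚ.≤-trans (size-≤ p) sz′≤x)
    stay-out : ∀ {x} → x ℕ.< sz → x ∉ᵗ f → ¬ (x ∈ᵗ f ⊎ sz ℕ.≤ x)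
    stay-out x<sz x∉f (inj₁ x∈f)  = x∉f x∈f
    stay-out x<sz x∉f (inj₂ sz≤x) = ℕₚ.<⇒≱ x<sz sz≤x

  module _ {a k d r} {sz sz′ : ℕ} {h h′ : Heap} (wf : Stored h sz (bin a k d r)) where
    private
      a<sz : a ℕ.< sz
      a<sz = bounded wf (inj₁ refl)
      a∉d  = proj₁ (proj₁ (separated wf))
      a∉r  = proj₁ (proj₂ (proj₁ (separated wf)))
      d#r  = λ {x} → proj₂ (proj₂ (proj₁ (separated wf))) {x}

    -- The root of `d` keeps its address, so the `fDown` pointer of `a` stays valid. Addresses new
    -- in `d′` are at least `sz` and thus differ from `a` and from those in `r`.
    under-down : ∀ {d′} → Stored h′ sz′ d′ → Local d sz h d′ sz′ h′ →
                 Stored h′ sz′ (bin a k d′ r) ×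
                 Local (bin a k d r) sz h (bin a k d′ r) sz′ h′
    under-down {d′} wf′ loc = stored rep′ sep′ bounded′ , record
      { size-≤    = size-≤ loc
      ; origin    = origin′
      ; frame     = λ x<sz x∉ → frame loc x<sz λ x∈d → x∉ (inj₂ (inj₁ x∈d))
      ; count     = trans (out sz′ (nodes d) (nodes r))
                      (trans (cong (λ m → suc (m ℕ.+ nodes r)) (count loc))
                             (sym (out sz (nodes d′) (nodes r))))
      ; root-≡    = refl
      ; rootKey-≡ = refl
      }
      where
      open SameShape (frame loc a<sz a∉d)
      out : ∀ x y z → x ℕ.+ suc (y ℕ.+ z) ≡ suc (x ℕ.+ y ℕ.+ z)
      out = solve-∀
      rep′ : Rep h′ (bin a k d′ r)
      rep′ with rep wf
      ... | ((p , q , s) , _ , pr) =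
        (trans key-≡ p , trans down-≡ (trans q (sym (root-≡ loc))) , trans right-≡ s) ,
        rep wf′ ,
        Rep-cong r (λ x∈r → frame loc (bounded wf (inj₂ (inj₂ x∈r))) λ x∈d → d#r x∈d x∈r) pr
      a∉d′ : a ∉ᵗ d′
      a∉d′ a∈d′ with origin loc a∈d′
      ... | inj₁ a∈d  = a∉d a∈d
      ... | inj₂ sz≤a = ℕₚ.<⇒≱ a<sz sz≤a
      d′#r : ∀ {x} → x ∈ᵗ d′ → x ∉ᵗ r
      d′#r x∈d′ x∈r with origin loc x∈d′
      ... | inj₁ x∈d  = d#r x∈d x∈r
      ... | inj₂ sz≤x = ℕₚ.<⇒≱ (bounded wf (inj₂ (inj₂ x∈r))) sz≤x
      sep′ : Separated (bin a k d′ r)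
      sep′ = (a∉d′ , a∉r , d′#r) , separated wf′ , proj₂ (proj₂ (separated wf))
      bounded′ : ∀ {x} → x ∈ᵗ bin a k d′ r → x ℕ.< sz′
      bounded′ (inj₁ refl)        = ℕₚ.<-≤-trans a<sz (size-≤ loc)
      bounded′ (inj₂ (inj₁ x∈d′)) = bounded wf′ x∈d′
      bounded′ (inj₂ (inj₂ x∈r))  = ℕₚ.<-≤-trans (bounded wf (inj₂ (inj₂ x∈r))) (size-≤ loc)
      origin′ : ∀ {x} → x ∈ᵗ bin a k d′ r → x ∈ᵗ bin a k d r ⊎ sz ℕ.≤ x
      origin′ (inj₁ x≡a)         = inj₁ (inj₁ x≡a)
      origin′ (inj₂ (inj₂ x∈r))  = inj₁ (inj₂ (inj₂ x∈r))
      origin′ (inj₂ (inj₁ x∈d′)) with origin loc x∈d′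
      ... | inj₁ x∈d  = inj₁ (inj₂ (inj₁ x∈d))
      ... | inj₂ sz≤x = inj₂ sz≤x

    under-right : ∀ {r′} → Stored h′ sz′ r′ → Local r sz h r′ sz′ h′ →
                  Stored h′ sz′ (bin a k d r′) ×
                  Local (bin a k d r) sz h (bin a k d r′) sz′ h′
    under-right {r′} wf′ loc = stored rep′ sep′ bounded′ , record
      { size-≤    = size-≤ loc
      ; origin    = origin′
      ; frame     = λ x<sz x∉ → frame loc x<sz λ x∈r → x∉ (inj₂ (inj₂ x∈r))
      ; count     = trans (out sz′ (nodes d) (nodes r))
                      (trans (cong (λ m → suc (m ℕ.+ nodes d)) (count loc))
                             (sym (out sz (nodes d) (nodes r′))))
      ; root-≡    = refl
      ; rootKey-≡ = refl
      }
      where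
      open SameShape (frame loc a<sz a∉r)
      out : ∀ x y z → x ℕ.+ suc (y ℕ.+ z) ≡ suc (x ℕ.+ z ℕ.+ y)
      out = solve-∀
      rep′ : Rep h′ (bin a k d r′)
      rep′ with rep wf
      ... | ((p , q , s) , pd , _) =
        (trans key-≡ p , trans down-≡ q , trans right-≡ (trans s (sym (root-≡ loc)))) ,
        Rep-cong d (λ x∈d → frame loc (bounded wf (inj₂ (inj₁ x∈d))) λ x∈r → d#r x∈d x∈r) pd ,
        rep wf′
      a∉r′ : a ∉ᵗ r′
      a∉r′ a∈r′ with origin loc a∈r′
      ... | inj₁ a∈r  = a∉r a∈r
      ... | inj₂ sz≤a = ℕₚ.<⇒≱ a<sz sz≤a
      d#r′ : ∀ {x} → x ∈ᵗ d → x ∉ᵗ r′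
      d#r′ x∈d x∈r′ with origin loc x∈r′
      ... | inj₁ x∈r  = d#r x∈d x∈r
      ... | inj₂ sz≤x = ℕₚ.<⇒≱ (bounded wf (inj₂ (inj₁ x∈d))) sz≤x
      sep′ : Separated (bin a k d r′)
      sep′ = (a∉d , a∉r′ , d#r′) , proj₁ (proj₂ (separated wf)) , separated wf′
      bounded′ : ∀ {x} → x ∈ᵗ bin a k d r′ → x ℕ.< sz′
      bounded′ (inj₁ refl)        = ℕₚ.<-≤-trans a<sz (size-≤ loc)
      bounded′ (inj₂ (inj₂ x∈r′)) = bounded wf′ x∈r′
      bounded′ (inj₂ (inj₁ x∈d))  = ℕₚ.<-≤-trans (bounded wf (inj₂ (inj₁ x∈d))) (size-≤ loc)
      origin′ : ∀ {x} → x ∈ᵗ bin a k d r′ → x ∈ᵗ bin a k d r ⊎ sz ℕ.≤ x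
      origin′ (inj₁ x≡a)         = inj₁ (inj₁ x≡a)
      origin′ (inj₂ (inj₁ x∈d))  = inj₁ (inj₂ (inj₁ x∈d))
      origin′ (inj₂ (inj₂ x∈r′)) with origin loc x∈r′
      ... | inj₁ x∈r  = inj₁ (inj₂ (inj₂ x∈r))
      ... | inj₂ sz≤x = inj₂ sz≤x

  mutual
    -- The first index is the height, the second the number of siblings. The restriction to two,
    -- three or four is imposed by the parent, in `Children`; a list of siblings by itself may have
    -- any length, so that its growth by one can be expressed on every level, including that of the
    -- root.
    data Bal : ℕ → ℕ → Tree → Set where
      nil  : ∀ {H} → Bal H 0 nil
      cons : ∀ {H n a k d r} → Children H k d → Bal H n r → Bal H (suc n) (bin a k d r)

    data Children : ℕ → Carrier → Tree → Set where
      leaf : ∀ {k} → Children 0 k nil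
      node : ∀ {H m k d} → 2 ℕ.≤ m → m ℕ.≤ 4 → rootKey d ≡ just k → Bal H m d →
             Children (suc H) k d

  Bal⇒bin : ∀ {H n f} → Bal H (suc n) f →
            Σ ℕ λ a → Σ Carrier λ k → Σ Tree λ d → Σ Tree λ r → f ≡ bin a k d r
  Bal⇒bin (cons _ _) = _ , _ , _ , _ , refl

  first-entry : ∀ {H n a k d r} → Bal H n (bin a k d r) →
                Σ ℕ λ q → Σ (List Entry) λ es → entries (bin a k d r) ≡ (q , k) ∷ es
  first-entry (cons leaf _) = _ , _ , refl
  first-entry (cons {r = r} (node {d = bin _ _ _ _} _ _ refl b) _) with first-entry b
  ... | q , es , eq = q , es ++ entries r , cong (_++ entries r) eq

  -- Every inner node has at least two children, so that the number of leaves at least doubles with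
  -- each level.
  ≤-entries : ∀ {H n f} → Bal H n f → n ℕ.* 2 ℕ.^ H ℕ.≤ length (entries f)
  ≤-entries nil = z≤n
  ≤-entries (cons leaf b) = s≤s (≤-entries b)
  ≤-entries {suc H} (cons {n = n} {r = r} (node {m = m} {d = bin a k d s} 2≤m _ _ b) b′) =
    subst (suc n ℕ.* 2 ℕ.^ suc H ℕ.≤_) (sym (Listₚ.length-++ (entries (bin a k d s))))
      (ℕₚ.+-mono-≤ (ℕₚ.≤-trans (ℕₚ.*-monoˡ-≤ (2 ℕ.^ H) 2≤m) (≤-entries b)) (≤-entries b′))
  ≤-entries (cons (node () _ _ nil) _)

  -- The summand `n` makes the induction work: the surplus of at least 2 provided by the children
  -- pays for their parent and for its own share in the surplus one level up.
  nodes-≤ : ∀ {H n f} → Bal H n f → nodes f ℕ.+ n ℕ.≤ 2 ℕ.* length (entries f)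
  nodes-≤ nil = z≤n
  nodes-≤ (cons {n = n} {r = r} leaf b) = subst₂ ℕ._≤_
    (cong suc (sym (ℕₚ.+-suc (nodes r) n))) (sym (ℕₚ.*-suc 2 _)) (s≤s (s≤s (nodes-≤ b)))
  nodes-≤ (cons {n = n} {r = r} (node {m = m} {d = d@(bin _ _ _ _)} 2≤m _ _ b) b′) = begin
    suc (nodes d ℕ.+ nodes r) ℕ.+ suc n      ≡⟨ regroup (nodes d) (nodes r) n ⟩
    (nodes d ℕ.+ 2) ℕ.+ (nodes r ℕ.+ n)      ≤⟨ ℕₚ.+-monoˡ-≤ _ (ℕₚ.+-monoʳ-≤ (nodes d) 2≤m) ⟩
    (nodes d ℕ.+ m) ℕ.+ (nodes r ℕ.+ n)      ≤⟨ ℕₚ.+-mono-≤ (nodes-≤ b) (nodes-≤ b′) ⟩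
    2 ℕ.* length (entries d) ℕ.+ 2 ℕ.* length (entries r)
      ≡⟨ sym (ℕₚ.*-distribˡ-+ 2 (length (entries d)) _) ⟩
    2 ℕ.* (length (entries d) ℕ.+ length (entries r))
      ≡⟨ cong (2 ℕ.*_) (sym (Listₚ.length-++ (entries d))) ⟩
    2 ℕ.* length (entries d ++ entries r)    ∎
    where
    open ℕₚ.≤-Reasoning
    regroup : ∀ x y z → suc (x ℕ.+ y) ℕ.+ suc z ≡ (x ℕ.+ 2) ℕ.+ (y ℕ.+ z)
    regroup = solve-∀
  nodes-≤ (cons (node () _ _ nil) _)

-- Insertion: the search and its effect.

module Search (R : Reals) (iLo iHi len c last best : Reals.Carrier R)
              (rt : Maybe ℕ) (out : List (IntervalStreams.Interval R)) where
  open Reals R using (orderedField)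
  open OrderedFieldProperties orderedField
  open IntervalStreams R using (Interval)
  open IntervalStreams.Semantics R layout
  open Execution R layout
  open Program
  open Dictionary R

  record Scratch : Set where
    constructor scratch
    field
      tmp             : Carrier
      u d z w v t     : Pointer
  open Scratch

  -- The register files are explicit vectors, so that register accesses compute and most execution
  -- steps hold by `refl`. The dummy is always the node at address 0.
  searchState : Scratch → (g y ch : Pointer) → ℕ → Heap → State
  searchState s g y ch sz h = state
    (iLo ∷ iHi ∷ len ∷ c ∷ last ∷ tmp s ∷ best ∷ [])
    (rt ∷ just 0 ∷ ch ∷ y ∷ u s ∷ d s ∷ z s ∷ w s ∷ v s ∷ t s ∷ g ∷ [])
    sz h out

  Beyond : List Entry → Set
  Beyond []            = ⊤
  Beyond ((_ , k) ∷ _) = ¬ k ≤ c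

  Beyond-++ : ∀ es {es′} → Beyond es → Beyond es′ → Beyond (es ++ es′)
  Beyond-++ []      _ p = p
  Beyond-++ (_ ∷ _) p _ = p

  record Widened (n n′ : Node) : Set where
    field
      key-≡    : key n′ ≡ key n
      link-≡   : link n′ ≡ link n
      min-≤    : minLo n′ ≤ minLo n
      min-≤lo  : minLo n′ ≤ iLo
      min-from : minLo n′ ≡ minLo n ⊎ minLo n′ ≡ iLo
      ≤-max    : maxLo n ≤ maxLo n′
      lo≤-max  : iLo ≤ maxLo n′
      max-from : maxLo n′ ≡ maxLo n ⊎ maxLo n′ ≡ iLo

  module _ (es es′ : List Entry) (ch : Pointer) (sz : ℕ) (h : Heap)
           (ch′ : Pointer) (sz′ : ℕ) (h′ : Heap) where
    record Found (q : ℕ) (k : Carrier) : Set where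
      field
        not-dummy : q ≢ 0
        c≤k       : c ≤ k
        entries-≡ : es′ ≡ es
        chain-≡   : ch′ ≡ ch
        others    : ∀ {x} → x ℕ.< sz → x ≢ q → SameRecord (h x) (h′ x)
        -- The premise lets the claim be carried back over splits; it is discharged once the leaf is
        -- known to be an old record.
        widened   : q ℕ.< sz → Widened (h q) (h′ q)

    record Fresh (before : List Entry) (q : ℕ) (k : Carrier) (after : List Entry) : Set where
      field
        q′        : ℕ
        absent    : q ≡ 0 ⊎ ¬ c ≤ k
        entries-≡ : es′ ≡ before ++ (q , k) ∷ (q′ , c) ∷ after
        sz≤q′     : sz ℕ.≤ q′
        q′<sz′    : q′ ℕ.< sz′
        chain-≡   : ch′ ≡ just q′
        key-new   : key (h′ q′) ≡ c
        min-new   : minLo (h′ q′) ≡ iLo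
        max-new   : maxLo (h′ q′) ≡ iLo
        link-new  : link (h′ q′) ≡ ch
        others    : ∀ {x} → x ℕ.< sz → SameRecord (h x) (h′ x)

    -- The leaf where the search ends splits the entries into `before` and `after`. The alternative
    -- `before ≡ []` is needed because the first leaf of a list of trees is reached without any
    -- comparison with its key.
    record Effect : Set where
      field
        {before after} : List Entry
        {q}            : ℕ
        {k}            : Carrier
        located        : es ≡ before ++ (q , k) ∷ after
        lower          : before ≡ [] ⊎ k ≤ c
        upper          : Beyond after
        outcome        : Found q k ⊎ Fresh before q k after

  Effect-++ʳ : ∀ {es es′ ch sz h ch′ sz′ h′} post → Beyond post →
               Effect es es′ ch sz h ch′ sz′ h′ →
               Effect (es ++ post) (es′ ++ post) ch sz h ch′ sz′ h′
  Effect-++ʳ post beyond e = record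
    { located = trans (cong (_++ post) located) (Listₚ.++-assoc before _ post)
    ; lower   = lower
    ; upper   = Beyond-++ after upper beyond
    ; outcome = outcome′ outcome
    }
    where
    open Effect e
    outcome′ : Found _ _ _ _ _ _ _ _ q k ⊎ Fresh _ _ _ _ _ _ _ _ before q k after →
               Found _ _ _ _ _ _ _ _ q k ⊎ Fresh _ _ _ _ _ _ _ _ before q k (after ++ post)
    outcome′ (inj₁ found) = inj₁ record
      { Found found ; entries-≡ = cong (_++ post) (Found.entries-≡ found) }
    outcome′ (inj₂ fresh) = inj₂ record
      { Fresh fresh
      ; entries-≡ = trans (cong (_++ post) (Fresh.entries-≡ fresh)) (Listₚ.++-assoc before _ post)
      }

  -- The search enters `es` only after a comparison with its first key `k₀`. This comparison
  -- supplies `k ≤ c` when the search ends in the first leaf of `es`.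
  Effect-++ˡ : ∀ {es es′ ch sz h ch′ sz′ h′} pre {q₀ k₀ es₀} → es ≡ (q₀ , k₀) ∷ es₀ → k₀ ≤ c →
               Effect es es′ ch sz h ch′ sz′ h′ →
               Effect (pre ++ es) (pre ++ es′) ch sz h ch′ sz′ h′
  Effect-++ˡ {es} pre {k₀ = k₀} head k₀≤c e = record
    { before  = pre ++ before
    ; located = trans (cong (pre ++_) located) (sym (Listₚ.++-assoc pre before _))
    ; lower   = inj₂ (k≤c lower)
    ; upper   = upper
    ; outcome = outcome′ outcome
    }
    where
    open Effect e
    k≤c : before ≡ [] ⊎ k ≤ c → k ≤ c
    k≤c (inj₂ p) = p
    k≤c (inj₁ before≡[]) = subst (_≤ c)
      (sym (cong proj₂ (Listₚ.∷-injectiveˡ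
        (trans (sym (cong (_++ (q , k) ∷ after) before≡[])) (trans (sym located) head))))) k₀≤c
    outcome′ : Found _ _ _ _ _ _ _ _ q k ⊎ Fresh _ _ _ _ _ _ _ _ before q k after →
               Found _ _ _ _ _ _ _ _ q k ⊎ Fresh _ _ _ _ _ _ _ _ (pre ++ before) q k after
    outcome′ (inj₁ found) = inj₁ record
      { Found found ; entries-≡ = cong (pre ++_) (Found.entries-≡ found) }
    outcome′ (inj₂ fresh) = inj₂ record
      { Fresh fresh
      ; entries-≡ = trans (cong (pre ++_) (Fresh.entries-≡ fresh))
                          (sym (Listₚ.++-assoc pre before _))
      }

  Effect-trans : ∀ {es es′ ch sz h sz₁ h₁ ch′ sz′ h′} → sz ℕ.≤ sz₁ →
                 (∀ {x} → x ℕ.< sz → SameRecord (h x) (h₁ x)) →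
                 Effect es es′ ch sz₁ h₁ ch′ sz′ h′ → Effect es es′ ch sz h ch′ sz′ h′
  Effect-trans {es} {es′} {ch} {sz} {h} {sz₁} {h₁} {ch′} {sz′} {h′} sz≤sz₁ same₁ e = record
    { located = located ; lower = lower ; upper = upper ; outcome = outcome′ outcome }
    where
    open Effect e
    outcome′ : Found _ _ _ _ _ _ _ _ q k ⊎ Fresh _ _ _ _ _ _ _ _ before q k after →
               Found es es′ ch sz h ch′ sz′ h′ q k ⊎
               Fresh es es′ ch sz h ch′ sz′ h′ before q k after
    outcome′ (inj₁ found) = inj₁ record
      { Found found
      ; others  = λ x<sz x≢q → SameRecord-trans (same₁ x<sz)
                    (Found.others found (ℕₚ.<-≤-trans x<sz sz≤sz₁) x≢q)
      ; widened = widened′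
      }
      where
      widened′ : q ℕ.< sz → Widened (h q) (h′ q)
      widened′ q<sz = record
        { key-≡    = trans W.key-≡ S.key-≡
        ; link-≡   = trans W.link-≡ S.link-≡
        ; min-≤    = subst (_ ≤_) S.min-≡ W.min-≤
        ; min-≤lo  = W.min-≤lo
        ; min-from = subst (λ x → _ ≡ x ⊎ _ ≡ iLo) S.min-≡ W.min-from
        ; ≤-max    = subst (_≤ _) S.max-≡ W.≤-max
        ; lo≤-max  = W.lo≤-max
        ; max-from = subst (λ x → _ ≡ x ⊎ _ ≡ iLo) S.max-≡ W.max-from
        }
        where
        module W = Widened (Found.widened found (ℕₚ.<-≤-trans q<sz sz≤sz₁))
        module S = SameRecord (same₁ q<sz)
    outcome′ (inj₂ fresh) = inj₂ record
      { Fresh fresh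
      ; sz≤q′ = ℕₚ.≤-trans sz≤sz₁ (Fresh.sz≤q′ fresh)
      ; others = λ x<sz → SameRecord-trans (same₁ x<sz)
                   (Fresh.others fresh (ℕₚ.<-≤-trans x<sz sz≤sz₁))
      }

  record Post (M : Tree → Set) (f : Tree) (ch : Pointer) (sz : ℕ) (h : Heap) (τ : State) :
              Set where
    constructor post
    field
      {s′}     : Scratch
      {y′ ch′} : Pointer
      {sz′}    : ℕ
      {h′}     : Heap
      {f′}     : Tree
      final-≡  : τ ≡ searchState s′ nothing y′ ch′ sz′ h′
      shape    : M f′
      stored′  : Stored h′ sz′ f′
      local    : Local f sz h f′ sz′ h′
      effect   : Effect (entries f) (entries f′) ch sz h ch′ sz′ h′

  entries-own : ∀ {a k d r x} → root d ≡ just x → entries (bin a k d r) ≡ entries d ++ entries r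
  entries-own {d = bin _ _ _ _} _ = refl

  post-down : ∀ {M M′ : Tree → Set} {a k d r x ch sz h} → Stored h sz (bin a k d r) →
              root d ≡ just x → Beyond (entries r) →
              (∀ {d′} → rootKey d′ ≡ rootKey d → M d′ → M′ (bin a k d′ r)) →
              ∀ {τ} → Post M d ch sz h τ → Post M′ (bin a k d r) ch sz h τ
  post-down {a = a} {k} {d} {r} wf d≡ beyond f (post eq m wf′ loc eff) =
    post eq (f (rootKey-≡ loc) m) (proj₁ (under-down wf wf′ loc)) (proj₂ (under-down wf wf′ loc))
      (subst₂ (λ es es′ → Effect es es′ _ _ _ _ _ _)
        (sym (entries-own {a} {k} {r = r} d≡))
        (sym (entries-own {a} {k} {r = r} (trans (root-≡ loc) d≡)))
        (Effect-++ʳ (entries r) beyond eff))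

  post-right : ∀ {M M′ : Tree → Set} {H n a k d b kb db rb ch sz h} →
               Stored h sz (bin a k d (bin b kb db rb)) → Bal H n (bin b kb db rb) → kb ≤ c →
               (∀ {r′} → M r′ → M′ (bin a k d r′)) →
               ∀ {τ} → Post M (bin b kb db rb) ch sz h τ →
               Post M′ (bin a k d (bin b kb db rb)) ch sz h τ
  post-right {a = a} {k} {d} wf br kb≤c f (post eq m wf′ loc eff) =
    post eq (f m) (proj₁ (under-right wf wf′ loc)) (proj₂ (under-right wf wf′ loc))
      (Effect-++ˡ (own a k d (entries d)) (proj₂ (proj₂ (first-entry br))) kb≤c eff)

  post-after : ∀ {M f f₁ ch sz h sz₁ h₁} → Stored h sz f → Local f sz h f₁ sz₁ h₁ →
               entries f₁ ≡ entries f → (∀ {x} → x ℕ.< sz → SameRecord (h x) (h₁ x)) →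
               ∀ {τ} → Post M f₁ ch sz₁ h₁ τ → Post M f ch sz h τ
  post-after wf loc₁ es≡ same₁ (post eq m wf′ loc eff) =
    post eq m wf′ (Local-trans loc₁ loc (bounded wf))
      (Effect-trans (size-≤ loc₁) same₁
        (subst (λ es → Effect es _ _ _ _ _ _ _) es≡ eff))

  -- Splitting a node.

  module _ {a k a₁ k₁ d₁ a₂ k₂ d₂ b₃ r sz h}
           (wf : Stored h sz (bin a k (bin a₁ k₁ d₁ (bin a₂ k₂ d₂ b₃)) r)) (k₃ : Carrier) where
    private
      b₂ b₂′ d₀ d₀′ t₀ f₀ f₁ : Tree
      b₂  = bin a₂ k₂ d₂ b₃
      b₂′ = bin a₂ k₂ d₂ nil
      d₀  = bin a₁ k₁ d₁ b₂
      d₀′ = bin a₁ k₁ d₁ b₂′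
      t₀  = bin sz k₃ b₃ r
      f₀  = bin a k d₀ r
      f₁  = bin a k d₀′ t₀

      wf-d  = Stored-down {a = a} {k} {d₀} {r} wf
      wf-r  = Stored-right {a = a} {k} {d₀} {r} wf
      wf-d₁ = Stored-down {a = a₁} {k₁} {d₁} {b₂} wf-d
      wf-b₂ = Stored-right {a = a₁} {k₁} {d₁} {b₂} wf-d
      wf-d₂ = Stored-down {a = a₂} {k₂} {d₂} {b₃} wf-b₂
      wf-b₃ = Stored-right {a = a₂} {k₂} {d₂} {b₃} wf-b₂

      a∉d  = proj₁ (proj₁ (separated wf))
      a∉r  = proj₁ (proj₂ (proj₁ (separated wf)))
      d#r  = λ {x} → proj₂ (proj₂ (proj₁ (separated wf))) {x}
      a₁∉d₁ = proj₁ (proj₁ (separated wf-d))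
      a₁∉b₂ = proj₁ (proj₂ (proj₁ (separated wf-d)))
      d₁#b₂ = λ {x} → proj₂ (proj₂ (proj₁ (separated wf-d))) {x}
      a₂∉d₂ = proj₁ (proj₁ (separated wf-b₂))
      a₂∉b₃ = proj₁ (proj₂ (proj₁ (separated wf-b₂)))
      d₂#b₃ = λ {x} → proj₂ (proj₂ (proj₁ (separated wf-b₂))) {x}

      b₃⊆d : ∀ {x} → x ∈ᵗ b₃ → x ∈ᵗ d₀
      b₃⊆d p = inj₂ (inj₂ (inj₂ (inj₂ p)))

      d′⊆d : ∀ {x} → x ∈ᵗ d₀′ → x ∈ᵗ d₀
      d′⊆d (inj₁ p)                      = inj₁ p
      d′⊆d (inj₂ (inj₁ p))               = inj₂ (inj₁ p)
      d′⊆d (inj₂ (inj₂ (inj₁ p)))        = inj₂ (inj₂ (inj₁ p))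
      d′⊆d (inj₂ (inj₂ (inj₂ (inj₁ p)))) = inj₂ (inj₂ (inj₂ (inj₁ p)))

      d′#b₃ : ∀ {x} → x ∈ᵗ d₀′ → x ∉ᵗ b₃
      d′#b₃ (inj₁ refl) q                      = a₁∉b₂ (inj₂ (inj₂ q))
      d′#b₃ (inj₂ (inj₁ p)) q                  = d₁#b₂ p (inj₂ (inj₂ q))
      d′#b₃ (inj₂ (inj₂ (inj₁ refl))) q        = a₂∉b₃ q
      d′#b₃ (inj₂ (inj₂ (inj₂ (inj₁ p)))) q    = d₂#b₃ p q

      d<sz : ∀ {x} → x ∈ᵗ d₀ → x ℕ.< sz
      d<sz p = bounded wf-d p

      sz-fresh : ∀ {x} → x ≡ sz → ¬ x ℕ.< sz
      sz-fresh refl = ℕₚ.<-irrefl refl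

    -- Up to associativity nothing happens to the leaves: `b₃` is nonempty, so that the new node
    -- above it is not a leaf and contributes no entry of its own.
    split-entries : ∀ {H m n} → Bal H (suc m) b₃ → Bal H n d₀ → entries f₁ ≡ entries f₀
    split-entries b (cons _ (cons _ _)) =
      trans (cong (entries d₀′ ++_) (entries-own {sz} {k₃} {b₃} {r}
              (cong root (proj₂ (proj₂ (proj₂ (proj₂ (Bal⇒bin b))))))))
      (trans (sym (Listₚ.++-assoc (entries d₀′) (entries b₃) (entries r)))
      (cong (_++ entries r) entries-d))
      where
      e₁ = own a₁ k₁ d₁ (entries d₁)
      e₂ = own a₂ k₂ d₂ (entries d₂)
      entries-d : entries d₀′ ++ entries b₃ ≡ entries d₀
      entries-d = trans (Listₚ.++-assoc e₁ (e₂ ++ []) (entries b₃))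
        (cong (e₁ ++_) (trans (cong (_++ entries b₃) (Listₚ.++-identityʳ e₂)) refl))

    module _ {h′ : Heap}
             (elsewhere : ∀ {x} → x ℕ.< sz → x ≢ a → x ≢ a₂ → h′ x ≡ h x)
             (at-a  : h′ a ≡ setRight (h a) (just sz))
             (at-a₂ : h′ a₂ ≡ setRight (h a₂) nothing)
             (key-t : key (h′ sz) ≡ k₃)
             (down-t : down (h′ sz) ≡ root b₃)
             (right-t : right (h′ sz) ≡ root r) where
      private
        outside : ∀ {x} → x ℕ.< sz → x ≢ a → x ≢ a₂ → SameShape (h x) (h′ x)
        outside x<sz x≢a x≢a₂ = ≡⇒SameShape (elsewhere x<sz x≢a x≢a₂)

        a₂∈d : a₂ ∈ᵗ d₀
        a₂∈d = inj₂ (inj₂ (inj₁ refl))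

        rep′ : Rep h′ f₁
        rep′ =
          (trans (cong key at-a) (proj₁ (proj₁ (rep wf))) ,
           trans (cong down at-a)
             (trans (down-setRight (h a) _) (proj₁ (proj₂ (proj₁ (rep wf))))) ,
           trans (cong right at-a) (right-setRight (h a) _)) ,
          ((trans S₁.key-≡ (proj₁ (proj₁ (rep wf-d))) ,
            trans S₁.down-≡ (proj₁ (proj₂ (proj₁ (rep wf-d)))) ,
            trans S₁.right-≡ (proj₂ (proj₂ (proj₁ (rep wf-d))))) ,
           Rep-cong d₁ (λ p → outside (bounded wf-d₁ p) (λ { refl → a∉d (inj₂ (inj₁ p)) })
             (λ { refl → d₁#b₂ p (inj₁ refl) })) (rep wf-d₁) ,
           (trans (cong key at-a₂) (proj₁ (proj₁ (rep wf-b₂))) ,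
            trans (cong down at-a₂)
              (trans (down-setRight (h a₂) _) (proj₁ (proj₂ (proj₁ (rep wf-b₂))))) ,
            trans (cong right at-a₂) (right-setRight (h a₂) _)) ,
           Rep-cong d₂ (λ p → outside (bounded wf-d₂ p)
             (λ { refl → a∉d (inj₂ (inj₂ (inj₂ (inj₁ p)))) })
             (λ { refl → a₂∉d₂ p })) (rep wf-d₂) ,
           tt) ,
          (key-t , down-t , right-t) ,
          Rep-cong b₃ (λ p → outside (bounded wf-b₃ p) (λ { refl → a∉d (b₃⊆d p) })
            (λ { refl → a₂∉b₃ p })) (rep wf-b₃) ,
          Rep-cong r (λ p → outside (bounded wf-r p) (λ { refl → a∉r p })
            (λ { refl → d#r a₂∈d p })) (rep wf-r)
          where
          shape₁ : SameShape (h a₁) (h′ a₁)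
          shape₁ = outside (d<sz (inj₁ refl)) (λ { refl → a∉d (inj₁ refl) })
                     (λ { refl → a₁∉b₂ (inj₁ refl) })
          module S₁ = SameShape shape₁

        separated′ : Separated f₁
        separated′ =
          ((λ p → a∉d (d′⊆d p)) , a∉t , d′#t) ,
          ((a₁∉d₁ , (λ { (inj₁ p) → a₁∉b₂ (inj₁ p) ; (inj₂ (inj₁ p)) → a₁∉b₂ (inj₂ (inj₁ p)) }) ,
            λ { p (inj₁ q) → d₁#b₂ p (inj₁ q) ; p (inj₂ (inj₁ q)) → d₁#b₂ p (inj₂ (inj₁ q)) }) ,
           separated wf-d₁ , (a₂∉d₂ , (λ ()) , λ _ ()) , separated wf-d₂ , tt) ,
          ((λ p → sz-fresh refl (bounded wf-b₃ p)) , (λ p → sz-fresh refl (bounded wf-r p)) ,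
           λ p → d#r (b₃⊆d p)) , separated wf-b₃ , separated wf-r
          where
          a∉t : a ∉ᵗ t₀
          a∉t (inj₁ p)        = sz-fresh p (bounded wf (inj₁ refl))
          a∉t (inj₂ (inj₁ p)) = a∉d (b₃⊆d p)
          a∉t (inj₂ (inj₂ p)) = a∉r p
          d′#t : ∀ {x} → x ∈ᵗ d₀′ → x ∉ᵗ t₀
          d′#t p (inj₁ q)        = sz-fresh q (d<sz (d′⊆d p))
          d′#t p (inj₂ (inj₁ q)) = d′#b₃ p q
          d′#t p (inj₂ (inj₂ q)) = d#r (d′⊆d p) q

        origin′ : ∀ {x} → x ∈ᵗ f₁ → x ∈ᵗ f₀ ⊎ sz ℕ.≤ x
        origin′ (inj₁ p)                      = inj₁ (inj₁ p)
        origin′ (inj₂ (inj₁ p))               = inj₁ (inj₂ (inj₁ (d′⊆d p)))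
        origin′ (inj₂ (inj₂ (inj₁ refl)))     = inj₂ ℕₚ.≤-refl
        origin′ (inj₂ (inj₂ (inj₂ (inj₁ p)))) = inj₁ (inj₂ (inj₁ (b₃⊆d p)))
        origin′ (inj₂ (inj₂ (inj₂ (inj₂ p)))) = inj₁ (inj₂ (inj₂ p))

        bounded′ : ∀ {x} → x ∈ᵗ f₁ → x ℕ.< suc sz
        bounded′ (inj₂ (inj₂ (inj₁ refl)))     = ℕₚ.n<1+n sz
        bounded′ (inj₁ p)                      = ℕₚ.m<n⇒m<1+n (bounded wf (inj₁ p))
        bounded′ (inj₂ (inj₁ p))               = ℕₚ.m<n⇒m<1+n (d<sz (d′⊆d p))
        bounded′ (inj₂ (inj₂ (inj₂ (inj₁ p)))) = ℕₚ.m<n⇒m<1+n (d<sz (b₃⊆d p))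
        bounded′ (inj₂ (inj₂ (inj₂ (inj₂ p)))) = ℕₚ.m<n⇒m<1+n (bounded wf-r p)

      split-stored : Stored h′ (suc sz) f₁
      split-stored = stored rep′ separated′ bounded′

      split-local : Local f₀ sz h f₁ (suc sz) h′
      split-local = record
        { size-≤    = ℕₚ.n≤1+n sz
        ; origin    = origin′
        ; frame     = λ x<sz x∉ → outside x<sz (λ { refl → x∉ (inj₁ refl) })
                        (λ { refl → x∉ (inj₂ (inj₁ a₂∈d)) })
        ; count     = regroup sz (nodes d₁) (nodes d₂) (nodes b₃) (nodes r)
        ; root-≡    = refl
        ; rootKey-≡ = refl
        }
        where
        regroup : ∀ s x₁ x₂ y z →
          suc s ℕ.+ suc (suc (x₁ ℕ.+ suc (x₂ ℕ.+ y)) ℕ.+ z) ≡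
          s ℕ.+ suc (suc (x₁ ℕ.+ suc (x₂ ℕ.+ 0)) ℕ.+ suc (y ℕ.+ z))
        regroup = solve-∀

      split-records : ∀ {x} → x ℕ.< sz → SameRecord (h x) (h′ x)
      split-records {x} x<sz with x ℕₚ.≟ a | x ℕₚ.≟ a₂
      ... | yes refl | _        = setRight-SameRecord at-a
      ... | no _     | yes refl = setRight-SameRecord at-a₂
      ... | no x≢a   | no x≢a₂  = ≡⇒SameRecord (elsewhere x<sz x≢a x≢a₂)

  -- Counting the iterations of the search.

  opaque
    -- Time for `m` iterations, each with its test, and for the failing test at the end. Kept opaque
    -- so that bounds are compared through `m` alone.
    ticks : ℕ → ℕ
    ticks m = suc (m ℕ.* suc (cost body))

    ticks-≡ : ∀ m → ticks m ≡ suc (m ℕ.* suc (cost body))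
    ticks-≡ m = refl

    ticks-mono-≤ : ∀ {m n} → m ℕ.≤ n → ticks m ℕ.≤ ticks n
    ticks-mono-≤ m≤n = s≤s (ℕₚ.*-monoˡ-≤ (suc (cost body)) m≤n)

    ticks-suc : ∀ m → suc (cost body ℕ.+ ticks m) ℕ.≤ ticks (suc m)
    ticks-suc m = ℕₚ.≤-reflexive (cong suc (ℕₚ.+-suc (cost body) (m ℕ.* suc (cost body))))

  Loops : ℕ → State → (State → Set) → Set
  Loops m = ReachIn (ticks m) loop

  Loops-weaken : ∀ {m n σ Q Q′} → m ℕ.≤ n → (∀ {τ} → Q τ → Q′ τ) → Loops m σ Q → Loops n σ Q′
  Loops-weaken m≤n f (_ , _ , r , t≤ , q) = _ , _ , r , ℕₚ.≤-trans t≤ (ticks-mono-≤ m≤n) , f q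

  tick : ∀ {m s g y ch sz h Q} → Reach body (searchState s (just g) y ch sz h) (λ τ → Loops m τ Q) →
         Loops (suc m) (searchState s (just g) y ch sz h) Q
  tick {m} r with iterateIn _ refl r
  ... | _ , _ , r′ , t≤ , q = _ , _ , r′ , ℕₚ.≤-trans t≤ (ticks-suc m) , q

  halt : ∀ {s y ch sz h Q} → Q (searchState s nothing y ch sz h) → Loops 0 (searchState s nothing y ch sz h) Q
  halt q = _ , _ , while-⇓₀ refl , ℕₚ.≤-reflexive (sym (ticks-≡ 0)) , q

  BeyondRoot : Tree → Set
  BeyondRoot nil           = ⊤
  BeyondRoot (bin _ k _ _) = ¬ k ≤ c

  BeyondRoot⇒Beyond : ∀ {H n r} → Bal H n r → BeyondRoot r → Beyond (entries r)
  BeyondRoot⇒Beyond {r = nil}         _ _ = tt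
  BeyondRoot⇒Beyond {r = bin _ _ _ _} b p rewrite proj₂ (proj₂ (first-entry b)) = p

  module _ {ch : Pointer} {sz : ℕ} {h : Heap} {g : ℕ} {Q : State → Set} where
    body-right : ∀ {s a b kb} → right (h a) ≡ just b → key (h b) ≡ kb → kb ≤ c →
                 (∀ s′ → Q (searchState s′ (just g) (just b) ch sz h)) →
                 Reach body (searchState s (just g) (just a) ch sz h) Q
    body-right {s} {kb = kb} right≡ key≡ kb≤c k =
      loadPtr refl right≡ (if-false refl (loadReal refl key≡
        (if-true (dec-true (kb ≤? c) kb≤c) (final refl (k _)))))

    body-stay : ∀ {s a} r → right (h a) ≡ root r → Rep h r → BeyondRoot r →
                (∀ s′ → u s′ ≡ root r → Reach stay (searchState s′ (just g) (just a) ch sz h) Q) →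
                Reach body (searchState s (just g) (just a) ch sz h) Q
    body-stay {s} nil right≡ _ _ k =
      loadPtr refl right≡ (if-true refl (k (record s { u = nothing }) refl))
    body-stay {s} (bin b kb _ _) right≡ ((key≡ , _) , _) kb≰c k =
      loadPtr refl right≡ (if-false refl (loadReal refl key≡
        (if-false (dec-false (kb ≤? c) kb≰c)
          (k (record s { u = just b ; tmp = kb }) refl))))

    insertLeaf-reach : ∀ {s a} →
      (∀ s′ h₁ h′ →
         Update h sz (node (c ∷ iLo ∷ iLo ∷ []) (nothing ∷ u s ∷ ch ∷ [])) h₁ →
         Update h₁ a (setRight (h₁ a) (just sz)) h′ →
         Q (searchState s′ nothing (just a) (just sz) (suc sz) h′)) →
      Reach insertLeaf (searchState s (just g) (just a) ch sz h) Q
    insertLeaf-reach k =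
      allocate λ _ u₁ → storeReal refl u₁ λ _ u₂ → storeReal refl u₂ λ _ u₃ →
      storeReal refl u₃ λ _ u₄ → storePtr refl u₄ λ _ u₅ → storePtr refl u₅ λ _ u₆ →
      step refl (storePtr refl Update-refl λ _ u₇ → final refl (k _ _ _ u₆ u₇))

    splitNode-reach : ∀ {s a a₁ a₂ a₃ k₃} → d s ≡ just a₁ → z s ≡ just a₂ → w s ≡ just a₃ →
      a₃ ≢ sz → key (h a₃) ≡ k₃ →
      (∀ s′ y′ h₁ h₂ h′ →
         Update h sz (node (k₃ ∷ 0# ∷ 0# ∷ []) (just a₃ ∷ u s ∷ nothing ∷ [])) h₁ →
         Update h₁ a (setRight (h₁ a) (just sz)) h₂ →
         Update h₂ a₂ (setRight (h₂ a₂) nothing) h′ →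
         (k₃ ≤ c × y′ ≡ just a₃) ⊎ (¬ k₃ ≤ c × y′ ≡ just a₁) →
         Q (searchState s′ (just g) y′ ch (suc sz) h′)) →
      Reach splitNode (searchState s (just g) (just a) ch sz h) Q
    splitNode-reach {k₃ = k₃} refl refl refl a₃≢sz key≡ k =
      allocate λ _ u₁ → storePtr refl u₁ λ _ u₂ → storePtr refl u₂ λ h₃ u₃ →
      loadReal refl (trans (cong key (kept u₃ a₃≢sz)) key≡) (
      storeReal refl u₃ λ _ u₄ → storePtr refl Update-refl λ _ u₅ →
      step refl (storePtr refl Update-refl λ _ u₆ → if-leq
        (λ p → final refl (k _ _ _ _ _ u₄ u₅ u₆ (inj₁ (p , refl))))
        (λ p → final refl (k _ _ _ _ _ u₄ u₅ u₆ (inj₂ (p , refl))))))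

  setMin setMax : Node → Carrier → Node
  setMin n x = record n { reals = reals n [ fMin ]≔ x }
  setMax n x = record n { reals = reals n [ fMax ]≔ x }

  -- Describes the leaf between the two conditional writes of `widenLeaf`.
  record MinWidened (n n′ : Node) : Set where
    field
      ptrs-≡   : ptrs n′ ≡ ptrs n
      key-≡    : key n′ ≡ key n
      max-≡    : maxLo n′ ≡ maxLo n
      min-≤    : minLo n′ ≤ minLo n
      min-≤lo  : minLo n′ ≤ iLo
      min-from : minLo n′ ≡ minLo n ⊎ minLo n′ ≡ iLo

  setMin-MinWidened : ∀ {n} → ¬ minLo n ≤ iLo → MinWidened n (setMin n iLo)
  setMin-MinWidened {node (_ ∷ _ ∷ _ ∷ []) _} min≰lo = record
    { ptrs-≡ = refl ; key-≡ = refl ; max-≡ = refl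
    ; min-≤ = <⇒≤ (≰⇒> min≰lo) ; min-≤lo = ≤-refl ; min-from = inj₂ refl }

  max-kept : ∀ {n n₁} → MinWidened n n₁ → iLo ≤ maxLo n → Widened n n₁
  max-kept m lo≤max = record
    { key-≡ = key-≡ ; link-≡ = cong (λ p → lookup p fNext) ptrs-≡
    ; min-≤ = min-≤ ; min-≤lo = min-≤lo ; min-from = min-from
    ; ≤-max = ≤-reflexive (sym max-≡) ; lo≤-max = subst (iLo ≤_) (sym max-≡) lo≤max
    ; max-from = inj₁ max-≡ }
    where open MinWidened m

  max-raised : ∀ {n n₁} → MinWidened n n₁ → ¬ iLo ≤ maxLo n →
               Widened n (setMax n₁ iLo) × SameShape n (setMax n₁ iLo)
  max-raised {n₁ = node (_ ∷ _ ∷ _ ∷ []) _} m lo≰max = record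
    { key-≡ = key-≡ ; link-≡ = cong (λ p → lookup p fNext) ptrs-≡
    ; min-≤ = min-≤ ; min-≤lo = min-≤lo ; min-from = min-from
    ; ≤-max = <⇒≤ (≰⇒> lo≰max) ; lo≤-max = ≤-refl ; max-from = inj₂ refl } ,
    sameShape key-≡ (cong (λ p → lookup p fDown) ptrs-≡) (cong (λ p → lookup p fRight) ptrs-≡)
    where open MinWidened m

  module _ {ch : Pointer} {sz : ℕ} {h : Heap} {g : ℕ} {Q : State → Set} where
    widenLeaf-reach : ∀ {s a} →
      (∀ s′ n′ h′ → Update h a n′ h′ → SameShape (h a) n′ → Widened (h a) n′ →
       Q (searchState s′ nothing (just a) ch sz h′)) →
      Reach widenLeaf (searchState s (just g) (just a) ch sz h) Q
    widenLeaf-reach {s} {a} k =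
      loadReal refl refl (via (if-leq
        (λ p → done (widenMax Update-refl (record
          { ptrs-≡ = refl ; key-≡ = refl ; max-≡ = refl
          ; min-≤ = ≤-refl ; min-≤lo = p ; min-from = inj₁ refl })))
        (λ p → storeReal refl Update-refl λ _ u₁ → done (widenMax u₁ (setMin-MinWidened p)))))
      where
      widenMax : ∀ {s n₁ h₁} → Update h a n₁ h₁ → MinWidened (h a) n₁ →
        Reach (instr (getReal rTmp pY fMax) ⨾
               cond (leq rLo rTmp) skip (instr (setReal pY fMax rLo) ⨾ skip) ⨾ instr (nil pG))
              (searchState s (just g) (just a) ch sz h₁) Q
      widenMax {h₁ = h₁} u₁ m =
        loadReal refl (trans (cong maxLo (updated u₁)) max-≡) (via (if-leq
          (λ p → done (final refl (k _ _ _ u₁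
            (sameShape key-≡ (cong (λ q → lookup q fDown) ptrs-≡)
                             (cong (λ q → lookup q fRight) ptrs-≡))
            (max-kept m p))))
          (λ p → storeReal refl u₁ λ _ u₂ → done (final refl (k _ _ _ u₂
            (proj₂ (max-raised m p)) (proj₁ (max-raised m p)))))))
        where open MinWidened m

  leaf-inserted : ∀ {M : Tree → Set} {a k r s s′ ch sz h h₁ h′} → Stored h sz (bin a k nil r) →
    u s ≡ root r → Beyond (entries r) → a ≡ 0 ⊎ ¬ c ≤ k →
    M (bin a k nil (bin sz c nil r)) →
    Update h sz (node (c ∷ iLo ∷ iLo ∷ []) (nothing ∷ u s ∷ ch ∷ [])) h₁ →
    Update h₁ a (setRight (h₁ a) (just sz)) h′ →
    Post M (bin a k nil r) ch sz h (searchState s′ nothing (just a) (just sz) (suc sz) h′)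
  leaf-inserted {a = a} {k} {r} {s} {ch = ch} {sz} {h} {h₁} {h′} wf us beyond absent m u₁ u₂ =
    post refl m (stored rep′ separated′ bounded′) (record
      { size-≤    = ℕₚ.n≤1+n sz
      ; origin    = origin′
      ; frame     = λ x<sz x∉ → ≡⇒SameShape (elsewhere x<sz λ x≡a → x∉ (inj₁ x≡a))
      ; count     = regroup sz (nodes r)
      ; root-≡    = refl
      ; rootKey-≡ = refl
      }) (record
      { located = refl ; lower = inj₁ refl ; upper = beyond
      ; outcome = inj₂ (record
          { absent = absent ; entries-≡ = refl ; sz≤q′ = ℕₚ.≤-refl ; q′<sz′ = ℕₚ.n<1+n sz
          ; chain-≡ = refl ; key-new = cong key at-sz ; min-new = cong minLo at-sz
          ; max-new = cong maxLo at-sz ; link-new = cong link at-sz ; others = others })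
      })
    where
    a<sz : a ℕ.< sz
    a<sz = bounded wf (inj₁ refl)
    a≢sz : a ≢ sz
    a≢sz = ℕₚ.<⇒≢ a<sz
    at-sz : h′ sz ≡ node (c ∷ iLo ∷ iLo ∷ []) (nothing ∷ u s ∷ ch ∷ [])
    at-sz = trans (kept u₂ (λ eq → a≢sz (sym eq))) (updated u₁)
    at-a : h′ a ≡ setRight (h a) (just sz)
    at-a = trans (updated u₂) (cong (λ n → setRight n (just sz)) (kept u₁ a≢sz))
    elsewhere : ∀ {x} → x ℕ.< sz → x ≢ a → h′ x ≡ h x
    elsewhere x<sz x≢a = trans (kept u₂ x≢a) (kept u₁ (ℕₚ.<⇒≢ x<sz))
    others : ∀ {x} → x ℕ.< sz → SameRecord (h x) (h′ x)
    others {x} x<sz with x ℕₚ.≟ a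
    ... | yes refl = setRight-SameRecord at-a
    ... | no x≢a   = ≡⇒SameRecord (elsewhere x<sz x≢a)
    a∉r : a ∉ᵗ r
    a∉r = proj₁ (proj₂ (proj₁ (separated wf)))
    r<sz : ∀ {x} → x ∈ᵗ r → x ℕ.< sz
    r<sz x∈r = bounded wf (inj₂ (inj₂ x∈r))
    rep′ : Rep h′ (bin a k nil (bin sz c nil r))
    rep′ =
      (trans (cong key at-a) (proj₁ (proj₁ (rep wf))) ,
       trans (cong down at-a) (trans (down-setRight (h a) _) (proj₁ (proj₂ (proj₁ (rep wf))))) ,
       trans (cong right at-a) (right-setRight (h a) _)) , tt ,
      (cong key at-sz , cong down at-sz , trans (cong right at-sz) us) , tt ,
      Rep-cong r (λ x∈r → ≡⇒SameShape (elsewhere (r<sz x∈r) (λ { refl → a∉r x∈r })))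
        (proj₂ (proj₂ (rep wf)))
    separated′ : Separated (bin a k nil (bin sz c nil r))
    separated′ =
      ((λ ()) , (λ { (inj₁ a≡sz) → a≢sz a≡sz ; (inj₂ (inj₂ a∈r)) → a∉r a∈r }) , (λ ())) , tt ,
      ((λ ()) , (λ sz∈r → ℕₚ.<-irrefl refl (r<sz sz∈r)) , (λ ())) , tt ,
      proj₂ (proj₂ (separated wf))
    origin′ : ∀ {x} → x ∈ᵗ bin a k nil (bin sz c nil r) → x ∈ᵗ bin a k nil r ⊎ sz ℕ.≤ x
    origin′ (inj₁ p)                      = inj₁ (inj₁ p)
    origin′ (inj₂ (inj₂ (inj₁ refl)))     = inj₂ ℕₚ.≤-refl
    origin′ (inj₂ (inj₂ (inj₂ (inj₂ p)))) = inj₁ (inj₂ (inj₂ p))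
    bounded′ : ∀ {x} → x ∈ᵗ bin a k nil (bin sz c nil r) → x ℕ.< suc sz
    bounded′ (inj₁ refl)                   = ℕₚ.m<n⇒m<1+n a<sz
    bounded′ (inj₂ (inj₂ (inj₁ refl)))     = ℕₚ.n<1+n sz
    bounded′ (inj₂ (inj₂ (inj₂ (inj₂ p)))) = ℕₚ.m<n⇒m<1+n (r<sz p)
    regroup : ∀ x y → suc x ℕ.+ suc y ≡ x ℕ.+ suc (suc y)
    regroup = solve-∀

  leaf-widened : ∀ {M : Tree → Set} {a k r s′ ch sz h n′ h′} → Stored h sz (bin a k nil r) →
    Beyond (entries r) → a ≢ 0 → c ≤ k → M (bin a k nil r) →
    Update h a n′ h′ → SameShape (h a) n′ → Widened (h a) n′ →
    Post M (bin a k nil r) ch sz h (searchState s′ nothing (just a) ch sz h′)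
  leaf-widened {a = a} {k} {r} {sz = sz} {h} {n′} {h′} wf beyond a≢0 c≤k m u₁ shape′ wide =
    post refl m (stored (Rep-cong (bin a k nil r) (λ _ → same-shape) (rep wf)) (separated wf) (bounded wf))
      (record
        { size-≤ = ℕₚ.≤-refl ; origin = inj₁ ; frame = λ _ _ → same-shape
        ; count = refl ; root-≡ = refl ; rootKey-≡ = refl })
      (record
        { located = refl ; lower = inj₁ refl ; upper = beyond
        ; outcome = inj₁ (record
            { not-dummy = a≢0 ; c≤k = c≤k ; entries-≡ = refl ; chain-≡ = refl
            ; others = λ _ x≢a → ≡⇒SameRecord (kept u₁ x≢a)
            ; widened = λ _ → subst (Widened (h a)) (sym (updated u₁)) wide }) })
    where
    same-shape : ∀ {x} → SameShape (h x) (h′ x)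
    same-shape {x} with x ℕₚ.≟ a
    ... | yes refl = subst (SameShape (h a)) (sym (updated u₁)) shape′
    ... | no x≢a   = ≡⇒SameShape (kept u₁ x≢a)

  visitLeaf-correct : ∀ {M : Tree → Set} {a k r s g ch sz h} → Stored h sz (bin a k nil r) →
    Beyond (entries r) → u s ≡ root r →
    M (bin a k nil r) → M (bin a k nil (bin sz c nil r)) →
    Reach visitLeaf (searchState s (just g) (just a) ch sz h)
      (λ τ → Loops 0 τ (Post M (bin a k nil r) ch sz h))
  visitLeaf-correct {M} {a} {k} {r} {s} {g} {ch} {sz} {h} wf beyond us m m′ = cases (a ℕₚ.≟ 0)
    where
    insertion : ∀ {s} → u s ≡ root r → a ≡ 0 ⊎ ¬ c ≤ k →
                Reach insertLeaf (searchState s (just g) (just a) ch sz h)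
                  (λ τ → Loops 0 τ (Post M (bin a k nil r) ch sz h))
    insertion {s} us absent = insertLeaf-reach λ _ _ _ u₁ u₂ →
      halt (leaf-inserted {s = s} wf us beyond absent m′ u₁ u₂)
    cases : Dec (a ≡ 0) → Reach visitLeaf (searchState s (just g) (just a) ch sz h)
              (λ τ → Loops 0 τ (Post M (bin a k nil r) ch sz h))
    cases (yes a≡0) = if-true (dec-true (≡-dec ℕₚ._≟_ (just a) (just 0)) (cong just a≡0))
      (insertion {s} us (inj₁ a≡0))
    cases (no a≢0) =
      if-false (dec-false (≡-dec ℕₚ._≟_ (just a) (just 0)) (λ eq → a≢0 (just-injective eq)))
        (loadReal refl (proj₁ (proj₁ (rep wf))) (if-leq
          (λ c≤k → widenLeaf-reach λ _ _ _ u₁ shape′ wide →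
            halt (leaf-widened wf beyond a≢0 c≤k m u₁ shape′ wide))
          (λ c≰k → insertion us (inj₂ c≰k))))

  Grown : ℕ → ℕ → Tree → Set
  Grown H n f = Bal H n f ⊎ Bal H (suc n) f

  -- The summand `suc n` pays for the siblings on the current level. Each level below adds four
  -- iterations: one that descends to it and three for the siblings met there, of which there are at
  -- most three because a node with four children is split first.
  Correct : ℕ → ℕ → Set
  Correct H n = ∀ {f s g ch sz h} → Bal H (suc n) f → Stored h sz f →
    Loops (suc n ℕ.+ 4 ℕ.* H) (searchState s (just g) (root f) ch sz h) (Post (Grown H (suc n)) f ch sz h)

  Grown-node : ∀ {H m n a k e e′ r} → 2 ℕ.≤ m → m ℕ.≤ 3 → rootKey e ≡ just k →
               Bal (suc H) n r → rootKey e′ ≡ rootKey e → Grown H m e′ →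
               Bal (suc H) (suc n) (bin a k e′ r)
  Grown-node 2≤m m≤3 key≡ br key′≡ (inj₁ b) =
    cons (node 2≤m (ℕₚ.m≤n⇒m≤1+n m≤3) (trans key′≡ key≡) b) br
  Grown-node 2≤m m≤3 key≡ br key′≡ (inj₂ b) =
    cons (node (ℕₚ.m≤n⇒m≤1+n 2≤m) (s≤s m≤3) (trans key′≡ key≡) b) br

  module _ {H : ℕ} (ih : ∀ n → Correct H n) where
    -- A node with at most three children absorbs the growth of its list of children, so that its
    -- own level does not grow.
    into-children : ∀ {m n a k e r x s g ch sz h} → 2 ℕ.≤ suc m → suc m ℕ.≤ 3 →
      root e ≡ just x → rootKey e ≡ just k → Bal H (suc m) e → Bal (suc H) n r →
      BeyondRoot r → Stored h sz (bin a k e r) →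
      Loops (3 ℕ.+ 4 ℕ.* H) (searchState s (just g) (root e) ch sz h)
        (Post (Bal (suc H) (suc n)) (bin a k e r) ch sz h)
    into-children {m} 2≤m m≤3 root≡ key≡ be br beyond wf =
      Loops-weaken (ℕₚ.+-monoˡ-≤ _ m≤3)
        (post-down wf root≡ (BeyondRoot⇒Beyond br beyond) (Grown-node 2≤m m≤3 key≡ br))
        (ih m be (Stored-down wf))

    descend-correct : ∀ {m n a k a₁ k₁ e₁ r′ r s g ch sz h} →
      (let e = bin a₁ k₁ e₁ r′) →
      2 ℕ.≤ m → m ℕ.≤ 4 → rootKey e ≡ just k → Bal H m e → Bal (suc H) n r →
      BeyondRoot r → Stored h sz (bin a k e r) → u s ≡ root r →
      Reach descend (searchState (record s { d = just a₁ }) (just g) (just a) ch sz h)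
        (λ τ → Loops (3 ℕ.+ 4 ℕ.* H) τ (Post (Grown (suc H) (suc n)) (bin a k e r) ch sz h))
    descend-correct (s≤s ()) _ _ (cons _ nil)
    descend-correct 2≤m m≤4 key≡ be@(cons _ (cons _ nil)) br beyond wf us =
      loadPtr refl (proj₂ (proj₂ (proj₁ (proj₁ (proj₂ (rep wf))))))
      (loadPtr refl (proj₂ (proj₂ (proj₁ (proj₂ (proj₂ (proj₁ (proj₂ (rep wf))))))))
      (if-true refl (final refl
        (Loops-weaken ℕₚ.≤-refl (λ { (post p q w l e) → post p (inj₁ q) w l e })
          (into-children 2≤m (s≤s (s≤s z≤n)) refl key≡ be br beyond wf)))))
    descend-correct 2≤m m≤4 key≡ be@(cons _ (cons _ (cons _ nil))) br beyond wf us =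
      loadPtr refl (proj₂ (proj₂ (proj₁ (proj₁ (proj₂ (rep wf))))))
      (loadPtr refl (proj₂ (proj₂ (proj₁ (proj₂ (proj₂ (proj₁ (proj₂ (rep wf))))))))
      (if-false refl
      (loadPtr refl (proj₂ (proj₂ (proj₁ (proj₂ (proj₂ (proj₂ (proj₂ (proj₁ (proj₂ (rep wf))))))))))
      (if-true refl (final refl
        (Loops-weaken ℕₚ.≤-refl (λ { (post p q w l e) → post p (inj₁ q) w l e })
          (into-children 2≤m (s≤s (s≤s (s≤s z≤n))) refl key≡ be br beyond wf)))))))
    -- Four children: two stay below `a`, two go below the new node at `sz`. The level of `a` has
    -- now grown by one; it does not grow a second time, since both halves have room.
    descend-correct {n = n} {a} {k} {r = r} {s} {g} {ch} {sz} {h} 2≤m m≤4 key≡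
      be@(cons {a = a₁} {k₁} {e₁} child₁ (cons {a = a₂} {k₂} {e₂} child₂
           b₃@(cons {a = a₃} {k₃} {e₃} child₃ (cons {a = a₄} {k₄} {e₄} child₄ nil))))
      br beyond wf us =
      loadPtr refl (proj₂ (proj₂ (proj₁ (proj₁ (proj₂ (rep wf))))))
      (loadPtr refl (proj₂ (proj₂ (proj₁ (proj₂ (proj₂ (proj₁ (proj₂ (rep wf))))))))
      (if-false refl
      (loadPtr refl (proj₂ (proj₂ (proj₁ rep₃)))
      (if-false refl
      (splitNode-reach refl refl refl (λ eq → ℕₚ.<⇒≢ a₃<sz eq) (proj₁ (proj₁ rep₃)) after)))))
      where
      t₃ = bin a₃ k₃ e₃ (bin a₄ k₄ e₄ nil)
      f₀ = bin a k (bin a₁ k₁ e₁ (bin a₂ k₂ e₂ t₃)) r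
      rep₃ : Rep h t₃
      rep₃ = proj₂ (proj₂ (proj₂ (proj₂ (proj₁ (proj₂ (rep wf))))))
      in-d : ∀ {x} → x ∈ᵗ bin a₁ k₁ e₁ (bin a₂ k₂ e₂ t₃) → x ∈ᵗ f₀
      in-d p = inj₂ (inj₁ p)
      a₃<sz : a₃ ℕ.< sz
      a₃<sz = bounded wf (in-d (inj₂ (inj₂ (inj₂ (inj₂ (inj₁ refl))))))
      after : ∀ s′ y′ h₁ h₂ h′ →
         Update h sz (node (k₃ ∷ 0# ∷ 0# ∷ []) (just a₃ ∷ u s ∷ nothing ∷ [])) h₁ →
         Update h₁ a (setRight (h₁ a) (just sz)) h₂ →
         Update h₂ a₂ (setRight (h₂ a₂) nothing) h′ →
         (k₃ ≤ c × y′ ≡ just a₃) ⊎ (¬ k₃ ≤ c × y′ ≡ just a₁) →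
         Loops (3 ℕ.+ 4 ℕ.* H) (searchState s′ (just g) y′ ch (suc sz) h′)
           (Post (Grown (suc H) (suc n)) f₀ ch sz h)
      after s′ y′ h₁ h₂ h′ u₁ u₂ u₃ = branch
        where
        a<sz : a ℕ.< sz
        a<sz = bounded wf (inj₁ refl)
        a₂<sz : a₂ ℕ.< sz
        a₂<sz = bounded wf (in-d (inj₂ (inj₂ (inj₁ refl))))
        a≢a₂ : a ≢ a₂
        a≢a₂ refl = proj₁ (proj₁ (separated wf)) (inj₂ (inj₂ (inj₁ refl)))
        elsewhere : ∀ {x} → x ℕ.< sz → x ≢ a → x ≢ a₂ → h′ x ≡ h x
        elsewhere x<sz x≢a x≢a₂ =
          trans (kept u₃ x≢a₂) (trans (kept u₂ x≢a) (kept u₁ (ℕₚ.<⇒≢ x<sz)))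
        at-a : h′ a ≡ setRight (h a) (just sz)
        at-a = trans (kept u₃ a≢a₂) (trans (updated u₂)
          (cong (λ x → setRight x (just sz)) (kept u₁ (ℕₚ.<⇒≢ a<sz))))
        at-a₂ : h′ a₂ ≡ setRight (h a₂) nothing
        at-a₂ = trans (updated u₃) (cong (λ x → setRight x nothing)
          (trans (kept u₂ (λ eq → a≢a₂ (sym eq))) (kept u₁ (ℕₚ.<⇒≢ a₂<sz))))
        at-sz : h′ sz ≡ node (k₃ ∷ 0# ∷ 0# ∷ []) (just a₃ ∷ u s ∷ nothing ∷ [])
        at-sz = trans (kept u₃ (λ eq → ℕₚ.<⇒≢ a₂<sz (sym eq)))
          (trans (kept u₂ (λ eq → ℕₚ.<⇒≢ a<sz (sym eq))) (updated u₁))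
        d₁ t′ f₁ : Tree
        d₁ = bin a₁ k₁ e₁ (bin a₂ k₂ e₂ nil)
        t′ = bin sz k₃ t₃ r
        f₁ = bin a k d₁ t′
        wf₁ : Stored h′ (suc sz) f₁
        wf₁ = split-stored wf k₃ elsewhere at-a at-a₂ (cong key at-sz) (cong down at-sz)
                (trans (cong right at-sz) us)
        undo : ∀ {M τ} → Post M f₁ ch (suc sz) h′ τ → Post M f₀ ch sz h τ
        undo = post-after wf
          (split-local wf k₃ elsewhere at-a at-a₂ (cong key at-sz) (cong down at-sz)
            (trans (cong right at-sz) us))
          (split-entries wf k₃ b₃ be)
          (split-records wf k₃ elsewhere at-a at-a₂ (cong key at-sz) (cong down at-sz)
            (trans (cong right at-sz) us))
        b-d₁ : Bal H 2 d₁
        b-d₁ = cons child₁ (cons child₂ nil)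
        b-t : Bal (suc H) (suc n) t′
        b-t = cons (node ℕₚ.≤-refl (s≤s (s≤s z≤n)) refl b₃) br
        branch : (k₃ ≤ c × y′ ≡ just a₃) ⊎ (¬ k₃ ≤ c × y′ ≡ just a₁) →
                 Loops (3 ℕ.+ 4 ℕ.* H) (searchState s′ (just g) y′ ch (suc sz) h′)
                   (Post (Grown (suc H) (suc n)) f₀ ch sz h)
        branch (inj₁ (k₃≤c , refl)) = Loops-weaken ℕₚ.≤-refl
          (λ p → undo (post-right wf₁ b-t k₃≤c
            (λ b → inj₂ (cons (node ℕₚ.≤-refl (s≤s (s≤s z≤n)) key≡ b-d₁) b)) p))
          (into-children ℕₚ.≤-refl (s≤s (s≤s z≤n)) refl refl b₃ br beyond (Stored-right wf₁))
        branch (inj₂ (k₃≰c , refl)) = Loops-weaken ℕₚ.≤-refl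
          -- The insertion goes into the left half. As `k₃` is beyond `c`, the right half meets the
          -- condition on what follows.
          (λ { (post p q w l e) → undo (post p (inj₂ q) w l e) })
          (into-children ℕₚ.≤-refl (s≤s (s≤s z≤n)) refl key≡ b-d₁ b-t k₃≰c wf₁)
    descend-correct _ (s≤s (s≤s (s≤s (s≤s ())))) _ (cons _ (cons _ (cons _ (cons _ (cons _ _)))))

  stay-leaf-correct : ∀ {n a k r s g ch sz h} → Bal 0 n r → BeyondRoot r →
    Stored h sz (bin a k nil r) → u s ≡ root r →
    Reach stay (searchState s (just g) (just a) ch sz h)
      (λ τ → Loops 0 τ (Post (Grown 0 (suc n)) (bin a k nil r) ch sz h))
  stay-leaf-correct {s = s} br beyond wf us =
    loadPtr refl (proj₁ (proj₂ (proj₁ (rep wf)))) (if-true refl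
      (visitLeaf-correct {s = record s { d = nothing }} wf (BeyondRoot⇒Beyond br beyond) us
        (inj₁ (cons leaf br)) (inj₂ (cons leaf (cons leaf br)))))

  stay-correct : ∀ H n {a k e r} → (∀ {H′} → H ≡ suc H′ → ∀ n → Correct H′ n) →
    ∀ {s g ch sz h} → Children H k e → Bal H n r → BeyondRoot r → Stored h sz (bin a k e r) →
    Loops (suc n ℕ.+ 4 ℕ.* H) (searchState s (just g) (just a) ch sz h)
      (Post (Grown H (suc n)) (bin a k e r) ch sz h)
  stay-correct H n {r = r} ih leaf br beyond wf =
    Loops-weaken (s≤s z≤n) (λ p → p) (tick (body-stay r (proj₂ (proj₂ (proj₁ (rep wf))))
      (proj₂ (proj₂ (rep wf))) beyond λ s′ us → stay-leaf-correct br beyond wf us))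
  stay-correct (suc H) n {r = r} ih (node {d = bin _ _ _ _} 2≤m m≤4 key≡ be) br beyond wf =
    Loops-weaken (ℕₚ.≤-trans (ℕₚ.≤-reflexive (sym (ℕₚ.*-suc 4 H))) (ℕₚ.m≤n+m _ (suc n))) (λ p → p)
      (tick (body-stay r (proj₂ (proj₂ (proj₁ (rep wf)))) (proj₂ (proj₂ (rep wf))) beyond
        λ s′ us → loadPtr refl (proj₁ (proj₂ (proj₁ (rep wf)))) (if-false refl
          (descend-correct (ih refl) {s = s′} 2≤m m≤4 key≡ be br beyond wf us))))
  stay-correct _ n ih (node () _ _ nil) br beyond wf

  loop-correct : ∀ H n → Correct H n
  -- The recursion is lexicographic: moving right lowers `n`, descending lowers `H`. The equation
  -- allows the hypothesis for the lower level to be passed on without a case distinction on `H`.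
  loop-correct-below : ∀ H {H′} → H ≡ suc H′ → ∀ n → Correct H′ n

  loop-correct H zero (cons child nil) wf =
    stay-correct H 0 (loop-correct-below H) child nil tt wf
  loop-correct H (suc n) (cons {a = a} {k} child br@(cons {k = kb} _ _)) wf with kb ≤? c
  ... | no kb≰c  = stay-correct H (suc n) (loop-correct-below H) child br kb≰c wf
  ... | yes kb≤c = tick (body-right (proj₂ (proj₂ (proj₁ (rep wf))))
          (proj₁ (proj₁ (proj₂ (proj₂ (rep wf))))) kb≤c λ _ →
          Loops-weaken ℕₚ.≤-refl
            (post-right wf br kb≤c
              (λ { (inj₁ b) → inj₁ (cons child b) ; (inj₂ b) → inj₂ (cons child b) }))
            (loop-correct H n br (Stored-right wf)))

  loop-correct-below (suc H) refl = loop-correct H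

-- Greedy selection among the stored values.

module Greedy (R : Reals) (len : Reals.Carrier R)
              (0<len : OrderedField._<_ (Reals.orderedField R) (Reals.0# R) len) where
  open Reals R using (orderedField)
  open OrderedFieldProperties orderedField
  open Cells R len 0<len
  open IntervalStreams R using (Interval; lo; hi; Disjoint)
  open IntervalStreams.Semantics R layout
  open Execution R layout
  open Program
  open Dictionary R using (Heap; minLo; maxLo; link)

  Chain : Heap → Pointer → List ℕ → Set
  Chain h p []       = p ≡ nothing
  Chain h p (q ∷ qs) = p ≡ just q × Chain h (link (h q)) qs

  -- The accumulator mirrors the invariant of `scan`: `xs` consists of the values already
  -- considered, the latest first.
  values : Heap → List ℕ → List Carrier → List Carrier
  values h []       xs = xs
  values h (q ∷ qs) xs = values h qs (maxLo (h q) ∷ minLo (h q) ∷ xs)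

  ∈-values-acc : ∀ {h x} qs {xs} → x ∈ xs → x ∈ values h qs xs
  ∈-values-acc []       p = p
  ∈-values-acc (q ∷ qs) p = ∈-values-acc qs (there (there p))

  min∈values : ∀ {h q qs xs} → q ∈ qs → minLo (h q) ∈ values h qs xs
  min∈values {qs = _ ∷ qs} (here refl) = ∈-values-acc qs (there (here refl))
  min∈values (there q∈qs)              = min∈values q∈qs

  max∈values : ∀ {h q qs xs} → q ∈ qs → maxLo (h q) ∈ values h qs xs
  max∈values {qs = _ ∷ qs} (here refl) = ∈-values-acc qs (here refl)
  max∈values (there q∈qs)              = max∈values q∈qs

  All-values : ∀ {P : Carrier → Set} {h qs xs} → All (λ q → P (minLo (h q)) × P (maxLo (h q))) qs →
               All P xs → All P (values h qs xs)
  All-values []               ps = ps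
  All-values ((p , p′) ∷ pps) ps = All-values pps (p′ ∷ p ∷ ps)

  module _ (a₀ a₁ a₃ : Carrier) (p₀ p₁ p₄ p₅ p₆ p₇ p₈ p₉ ch : Pointer) (sz : ℕ) (h : Heap) where
    finishState : (last tmp best : Carrier) (y g : Pointer) → List Interval → State
    finishState last tmp best y g out = state
      (a₀ ∷ a₁ ∷ len ∷ a₃ ∷ last ∷ tmp ∷ best ∷ [])
      (p₀ ∷ p₁ ∷ ch ∷ y ∷ p₄ ∷ p₅ ∷ p₆ ∷ p₇ ∷ p₈ ∷ p₉ ∷ g ∷ [])
      sz h out

    -- Indexed by the content of `pG`, because no real could signal the absence of a candidate:
    -- while `pG` is nil, `rBest` means nothing.
    data Least (last : Carrier) (xs : List Carrier) (best : Carrier) : Pointer → Set where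
      none : All (_≤ last) xs → Least last xs best nothing
      some : ∀ {p} → best ∈ xs → last < best → All (λ x → x ≤ last ⊎ best ≤ x) xs →
             Least last xs best (just p)

    record Considered (last x : Carrier) (xs : List Carrier) (q : ℕ) (out : List Interval)
                      (τ : State) : Set where
      constructor considered
      field
        {best′} : Carrier
        {g′}    : Pointer
        state-≡ : τ ≡ finishState last x best′ (just q) g′ out
        least   : Least last (x ∷ xs) best′ g′

    consider-correct : ∀ {last x xs best q g out} → Least last xs best g →
      Reach consider (finishState last x best (just q) g out) (Considered last x xs q out)
    consider-correct {last} {x} {xs} {best} {q} {out = out} l = if-leq
        (λ x≤last → done (considered refl (skipped l x≤last)))
        (λ x≰last → improve l (≰⇒> x≰last))
      where
      skipped : ∀ {g} → Least last xs best g → x ≤ last → Least last (x ∷ xs) best g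
      skipped (none ps)       x≤last = none (x≤last ∷ ps)
      skipped (some b∈ lb ps) x≤last = some (there b∈) lb (inj₁ x≤last ∷ ps)
      improve : ∀ {g} → Least last xs best g → last < x → Reach
        (cond (isNil pG) (instr (copyReal rBest rTmp) ⨾ instr (copyPtr pG pY))
          (cond (leq rBest rTmp) skip (instr (copyReal rBest rTmp) ⨾ instr (copyPtr pG pY))))
        (finishState last x best (just q) g out) (Considered last x xs q out)
      improve (none ps) last<x = if-true refl (step refl (final refl
        (considered refl (some (here refl) last<x (inj₂ ≤-refl ∷ All.map inj₁ ps)))))
      improve (some b∈ lb ps) last<x = if-false refl (if-leq
        (λ b≤x → done (considered refl (some (there b∈) lb (inj₂ b≤x ∷ ps))))
        (λ b≰x → step refl (final refl (considered refl (some (here refl) last<x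
          (inj₂ ≤-refl ∷ All.map (λ { (inj₁ p) → inj₁ p
                                    ; (inj₂ p) → inj₂ (≤-trans (<⇒≤ (≰⇒> b≰x)) p) }) ps))))))

    record Scanned (last : Carrier) (xs : List Carrier) (out : List Interval) (τ : State) : Set where
      constructor scanned
      field
        {tmp′ best′} : Carrier
        {g′}         : Pointer
        state-≡      : τ ≡ finishState last tmp′ best′ nothing g′ out
        least        : Least last xs best′ g′

    scan-correct : ∀ {last tmp best y g out} qs {xs} → Chain h y qs → Least last xs best g →
      Reach scan (finishState last tmp best y g out) (Scanned last (values h qs xs) out)
    scan-correct [] refl l = stop refl (scanned refl l)
    scan-correct {last} {out = out} (q ∷ qs) {xs} (refl , chain) l = iterate refl
      (loadReal refl refl (consider-correct l then λ { (considered refl l₁) →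
       loadReal refl refl (consider-correct l₁ then λ { (considered refl l₂) →
       loadPtr-final (scan-correct qs chain l₂) }) }))
      where
      loadPtr-final : ∀ {tmp best g Q} → Reach scan (finishState last tmp best (link (h q)) g out) Q →
        Reach (instr (getPtr pY pY fNext)) (finishState last tmp best (just q) g out) (λ τ → Reach scan τ Q)
      loadPtr-final r = final refl r

    module _ (qs : List ℕ) (chain : Chain h ch qs) {P : Interval → Set}
             (P-values : All (λ x → P (interval x)) (values h qs [])) where
      private
        V : List Carrier
        V = values h qs []

      record Selected (last : Carrier) (out : List Interval) (τ : State) : Set where
        constructor selected
        field
          size-≡      : size τ ≡ sz
          independent : AllPairs Disjoint (output τ)
          subset      : All P (output τ)
          gain        : ℕ
          length-≡    : length (output τ) ≡ gain ℕ.+ length out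
          optimal     : ∀ {ys} → All (_∈ V) ys → All (last <_) ys → AllPairs Apart ys →
                        length ys ℕ.≤ gain

      nothing-left : ∀ {last ys} → All (_≤ last) V → All (_∈ V) ys → All (last <_) ys →
                     length ys ℕ.≤ 0
      nothing-left _ [] [] = z≤n
      nothing-left V≤last (y∈V ∷ _) (last<y ∷ _) = contradiction (All.lookup V≤last y∈V) (<⇒≱ last<y)

      -- The measure is the length of `W`, a list containing all the stored values above `last`. A
      -- successful round raises `last` to `best + len`, which removes at least `best` from `W`.
      rounds-correct : ∀ n {last tmp best y g out} {W : List Carrier} → length W ℕ.≤ n →
        (∀ {x} → x ∈ V → last < x → x ∈ W) →
        AllPairs Disjoint out → All (λ I → hi I ≤ last) out → All P out →
        Reach (while (negate (isNil pG)) round) (finishState last tmp best y (just g) out)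
          (Selected last out)
      rounds-correct n {last} {out = out} {W = W} W≤n V⊆W disjoint below inP =
        iterate refl (step refl (step refl
          (scan-correct qs chain (none []) then λ { (scanned refl l) → select n W≤n l })))
        where
        select : ∀ n {tmp best g} → length W ℕ.≤ n → Least last V best g →
          Reach (cond (isNil pG) skip (instr (add rLast rBest rLen) ⨾ instr (emit rBest rLast)))
            (finishState last tmp best nothing g out)
            (λ τ → Reach (while (negate (isNil pG)) round) τ (Selected last out))
        select n _ (none V≤last) = if-true refl (done (stop refl
          (selected refl disjoint inP 0 refl λ ys∈V last<ys _ → nothing-left V≤last ys∈V last<ys)))
        select n {best = best} W≤n (some best∈V last<best least) =
          if-false refl (step refl (final refl (continue n W≤n)))
          where
          best<new : best < best + len
          best<new = x<x+z best 0<len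
          W′ : List Carrier
          W′ = filter (best + len <?_) W
          W′<W : length W′ ℕ.< length W
          W′<W = Listₚ.filter-notAll (best + len <?_) W
            (lose (V⊆W best∈V last<best) λ p → <⇒≱ p (<⇒≤ best<new))
          -- Any competitor loses at most one member when restricted to the values above
          -- `best + len`, by `greedy-exchange`; the interval just emitted makes up for it.
          extend : ∀ {τ} → Selected (best + len) (interval best ∷ out) τ → Selected last out τ
          extend (selected size-≡ indep subs gain length-≡ optimal) = selected size-≡ indep subs (suc gain)
            (trans length-≡ (ℕₚ.+-suc gain (length out)))
            λ {ys} ys∈V last<ys apart → ℕₚ.≤-trans
              (greedy-exchange (All.zipWith (λ (y∈V , last<y) → best≤ (All.lookup least y∈V) last<y)
                                            (ys∈V , last<ys)) apart)
              (s≤s (optimal (Allₚ.filter⁺ (best + len <?_) ys∈V)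
                            (Allₚ.all-filter (best + len <?_) ys)
                            (AllPairsₚ.filter⁺ (best + len <?_) apart)))
            where
            best≤ : ∀ {y} → y ≤ last ⊎ best ≤ y → last < y → best ≤ y
            best≤ (inj₁ y≤last) last<y = contradiction y≤last (<⇒≱ last<y)
            best≤ (inj₂ best≤y) _      = best≤y
          continue : ∀ n {tmp g} → length W ℕ.≤ n →
            Reach (while (negate (isNil pG)) round)
              (finishState (best + len) tmp best nothing (just g) (interval best ∷ out)) (Selected last out)
          continue zero W≤0 = contradiction (ℕₚ.≤-trans W′<W W≤0) λ ()
          continue (suc n) W≤n with rounds-correct n (ℕₚ.≤-pred (ℕₚ.≤-trans W′<W W≤n))
            (λ x∈V new<x → ∈-filter⁺ (best + len <?_)
               (V⊆W x∈V (<-trans last<best (<-trans best<new new<x))) new<x)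
            -- The earlier intervals end at or before `last`, which is less than `best`.
            (All.map (λ hi≤last x ((best≤x , _) , (_ , x≤hi)) →
               <⇒≱ last<best (≤-trans best≤x (≤-trans x≤hi hi≤last))) below ∷ disjoint)
            (≤-refl ∷ All.map (λ hi≤last → ≤-trans hi≤last (≤-trans (<⇒≤ last<best) (<⇒≤ best<new))) below)
            (All.lookup P-values best∈V ∷ inP)
          ... | _ , _ , r , s = _ , _ , r , extend s

      -- Since `last` starts below every stored value, the restriction to values above it in
      -- `optimal` excludes no competitor, and the gain is the whole output.
      finish-correct : ∀ {last tmp best y g} → All (last <_) V →
        Reach finish (finishState last tmp best y g []) λ τ →
          size τ ≡ sz × AllPairs Disjoint (output τ) × All P (output τ) ×
          (∀ {ys} → All (_∈ V) ys → AllPairs Apart ys → length ys ℕ.≤ length (output τ))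
      finish-correct {last} last<V = step refl (start qs chain V≡)
        where
        V≡ : V ≡ values h qs []
        V≡ = refl
        Goal : State → Set
        Goal τ = size τ ≡ sz × AllPairs Disjoint (output τ) × All P (output τ) ×
          (∀ {ys} → All (_∈ V) ys → AllPairs Apart ys → length ys ℕ.≤ length (output τ))
        start : ∀ {p} rs → Chain h p rs → V ≡ values h rs [] → ∀ {tmp best y} →
                Reach (while (negate (isNil pG)) round) (finishState last tmp best y p []) Goal
        start [] refl V≡[] = stop refl (refl , [] , [] , λ
          { [] [] → z≤n ; (x∈V ∷ _) → contradiction (subst (_ ∈_) V≡[] x∈V) λ () })
        start (_ ∷ _) (refl , _) _
          with rounds-correct (length V) ℕₚ.≤-refl (λ x∈V _ → x∈V) [] [] []
        ... | _ , _ , r , selected size-≡ indep subs gain length-≡ optimal =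
          _ , _ , r , size-≡ , indep , subs , λ {ys} ys∈V apart →
            subst (length ys ℕ.≤_) (sym (trans length-≡ (ℕₚ.+-identityʳ gain)))
              (optimal ys∈V (All.map (All.lookup last<V) ys∈V) apart)

-- The records kept for a stream.

AllPairs-map-All : ∀ {A : Set} {P : A → Set} {R S : A → A → Set} →
                   (∀ {x y} → P x → P y → R x y → S x y) →
                   ∀ {xs} → All P xs → AllPairs R xs → AllPairs S xs
AllPairs-map-All f [] [] = []
AllPairs-map-All f (p ∷ ps) (r ∷ rs) =
  All.zipWith (λ (q , s) → f p q s) (ps , r) ∷ AllPairs-map-All f ps rs

All-insert : ∀ {A : Set} {P : A → Set} xs {y z : A} {ys} →
             All P (xs ++ y ∷ ys) → P z → All P (xs ++ y ∷ z ∷ ys)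
All-insert []       (p ∷ ps) q = p ∷ q ∷ ps
All-insert (_ ∷ xs) (p ∷ ps) q = p ∷ All-insert xs ps q

module Stream (R : Reals) (len : Reals.Carrier R)
              (0<len : OrderedField._<_ (Reals.orderedField R) (Reals.0# R) len)
              (𝕊 : List (IntervalStreams.Interval R))
              (lengths : All (IntervalStreams.HasLength R len) 𝕊) where
  open Reals R using (orderedField)
  open OrderedFieldProperties orderedField
  open Cells R len 0<len
  open IntervalStreams R hiding (module Semantics)
  open IntervalStreams.Semantics R layout
  open Execution R layout
  open Program
  open Dictionary R
  open Greedy R len 0<len

  keyOf : Carrier → Carrier
  keyOf x = fromℤ orderedField (cell x)

  keyOf-injective : ∀ {x y} → keyOf x ≡ keyOf y → cell x ≡ cell y
  keyOf-injective = fromℤ-injective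

  IsLeft : List Interval → Carrier → Set
  IsLeft P x = Σ Interval λ I → I ∈ P × lo I ≡ x

  record Genuine (P : List Interval) (n : Node) : Set where
    field
      min-left : IsLeft P (minLo n)
      max-left : IsLeft P (maxLo n)
      min-key  : keyOf (minLo n) ≡ key n
      max-key  : keyOf (maxLo n) ≡ key n
  open Genuine

  record Covers (n : Node) (x : Carrier) : Set where
    field
      key-≡  : key n ≡ keyOf x
      min≤   : minLo n ≤ x
      ≤max   : x ≤ maxLo n

  -- P lists the intervals that the records may stem from, Q those that they
  -- have to account for.
  record Records (P Q : List Interval) (es : List Entry) (ch : Pointer) (sz : ℕ) (h : Heap) :
                 Set where
    field
      qs      : List ℕ
      chain   : Chain h ch qs
      qs<sz   : All (ℕ._< sz) qs
      genuine : All (λ q → Genuine P (h q)) qs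
      cover   : ∀ {I} → I ∈ Q → Σ ℕ λ q → q ∈ qs × Covers (h q) (lo I)
      sorted  : AllPairs (λ e e′ → proj₂ e < proj₂ e′) es
      nonzero : All (λ e → proj₁ e ≢ 0) es
      listed  : All (λ e → proj₁ e ∈ qs) es
      keys    : All (λ e → key (h (proj₁ e)) ≡ proj₂ e) es

  -- A common weakening of `SameRecord` and of the widening by an interval of the same cell: the
  -- range of a record may grow, but its ends remain left endpoints of that cell.
  record Change (P : List Interval) (n n′ : Node) : Set where
    field
      key-≡    : key n′ ≡ key n
      link-≡   : link n′ ≡ link n
      min-≤    : minLo n′ ≤ minLo n
      ≤-max    : maxLo n ≤ maxLo n′
      min-from : minLo n′ ≡ minLo n ⊎ (IsLeft P (minLo n′) × keyOf (minLo n′) ≡ key n)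
      max-from : maxLo n′ ≡ maxLo n ⊎ (IsLeft P (maxLo n′) × keyOf (maxLo n′) ≡ key n)

  SameRecord⇒Change : ∀ {P n n′} → SameRecord n n′ → Change P n n′
  SameRecord⇒Change s = record
    { key-≡ = key-≡ ; link-≡ = link-≡ ; min-≤ = ≤-reflexive min-≡ ; ≤-max = ≤-reflexive (sym max-≡)
    ; min-from = inj₁ min-≡ ; max-from = inj₁ max-≡ }
    where open SameRecord s

  IsLeft-mono : ∀ {P P′ x} → P ⊆ P′ → IsLeft P x → IsLeft P′ x
  IsLeft-mono P⊆ (I , I∈P , eq) = I , P⊆ I∈P , eq

  Change-Genuine : ∀ {P P′ n n′} → P ⊆ P′ → Change P′ n n′ → Genuine P n → Genuine P′ n′
  Change-Genuine {P} {P′} {n} {n′} P⊆ ch g = record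
    { min-left = proj₁ min′ ; max-left = proj₁ max′
    ; min-key = trans (proj₂ min′) (sym key-≡) ; max-key = trans (proj₂ max′) (sym key-≡) }
    where
    open Change ch
    pick′ : ∀ {x′ x} → x′ ≡ x ⊎ (IsLeft P′ x′ × keyOf x′ ≡ key n) → IsLeft P x → keyOf x ≡ key n →
            IsLeft P′ x′ × keyOf x′ ≡ key n
    pick′ (inj₁ refl) l k = IsLeft-mono P⊆ l , k
    pick′ (inj₂ p)    _ _ = p
    min′ = pick′ min-from (min-left g) (min-key g)
    max′ = pick′ max-from (max-left g) (max-key g)

  Change-Covers : ∀ {P n n′ x} → Change P n n′ → Covers n x → Covers n′ x
  Change-Covers ch c = record
    { key-≡ = trans (Change.key-≡ ch) (Covers.key-≡ c)
    ; min≤  = ≤-trans (Change.min-≤ ch) (Covers.min≤ c)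
    ; ≤max  = ≤-trans (Covers.≤max c) (Change.≤-max ch) }

  Chain-cong : ∀ {h h′ p} qs → All (λ q → link (h′ q) ≡ link (h q)) qs → Chain h p qs → Chain h′ p qs
  Chain-cong []       []       p≡ = p≡
  Chain-cong (q ∷ qs) (l ∷ ls) (p≡ , chain) =
    p≡ , Chain-cong qs ls (subst (λ p → Chain _ p qs) (sym l) chain)

  Records-change : ∀ {P P′ Q es ch sz h sz′ h′} → P ⊆ P′ → sz ℕ.≤ sz′ →
    (∀ {x} → x ℕ.< sz → Change P′ (h x) (h′ x)) →
    Records P Q es ch sz h → Records P′ Q es ch sz′ h′
  Records-change {P} {P′} {h = h} {h′ = h′} P⊆ sz≤sz′ changes r = record
    { qs      = qs
    ; chain   = Chain-cong qs (All.map (λ q<sz → Change.link-≡ (changes q<sz)) qs<sz) chain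
    ; qs<sz   = All.map (λ q<sz → ℕₚ.<-≤-trans q<sz sz≤sz′) qs<sz
    ; genuine = All.zipWith (λ (q<sz , g) → Change-Genuine P⊆ (changes q<sz) g) (qs<sz , genuine)
    ; cover   = λ I∈Q → let (q , q∈qs , c) = cover I∈Q in
                  q , q∈qs , Change-Covers (changes (All.lookup qs<sz q∈qs)) c
    ; sorted  = sorted
    ; nonzero = nonzero
    ; listed  = listed
    ; keys    = All.zipWith (λ (q∈qs , k) →
                  trans (Change.key-≡ (changes (All.lookup qs<sz q∈qs))) k) (listed , keys)
    }
    where open Records r

  interval∈𝕊 : ∀ {P x} → P ⊆ 𝕊 → IsLeft P x → interval x ∈ 𝕊
  interval∈𝕊 P⊆ (I , I∈P , refl) =
    subst (_∈ 𝕊) (HasLength⇒≡interval (All.lookup lengths (P⊆ I∈P))) (P⊆ I∈P)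

  module _ {α : ℕ} (maximal : ∀ 𝕁 → IndependentSubset 𝕊 𝕁 → length 𝕁 ℕ.≤ α) where
    -- The records stem from a prefix of the stream only, but its intervals all belong to `𝕊`.
    -- Therefore `α` of the whole stream bounds their number at every moment.
    length-records : ∀ {P Q es ch sz h} → P ⊆ 𝕊 → Records P Q es ch sz h →
                     length es ℕ.≤ 2 ℕ.* α
    length-records {P} {es = es} {h = h} P⊆ r =
      subst (ℕ._≤ 2 ℕ.* α) (Listₚ.length-map left es)
        (ℕₚ.≤-trans (length-everyOther (map left es))
          (ℕₚ.*-monoʳ-≤ 2 (subst (ℕ._≤ α) (Listₚ.length-map interval (everyOther (map left es)))
            (maximal _ (subset , independent)))))
      where
      open Records r
      left : Entry → Carrier
      left e = minLo (h (proj₁ e))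
      left-key : All (λ e → keyOf (left e) ≡ proj₂ e) es
      left-key = All.zipWith (λ (q∈qs , k) → trans (min-key (All.lookup genuine q∈qs)) k) (listed , keys)
      independent : Independent (map interval (everyOther (map left es)))
      independent = AllPairsₚ.map⁺ (AllPairs.map Apart⇒Disjoint (everyOther-apart (AllPairsₚ.map⁺
        (AllPairs-map-All (λ k k′ k<k′ → fromℤ-cancel-< (subst₂ _<_ (sym k) (sym k′) k<k′))
          left-key sorted))))
      subset : map interval (everyOther (map left es)) ⊆ 𝕊
      subset = All.lookup (Allₚ.map⁺ (All-everyOther (Allₚ.map⁺
        (All.map (λ q∈qs → interval∈𝕊 P⊆ (min-left (All.lookup genuine q∈qs))) listed))))

  module _ (I : Interval) (iHi last best : Carrier) (rt : Maybe ℕ) where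
    private
      c = keyOf (lo I)
    open Search R (lo I) iHi len c last best rt []

    Beyond⇒All : ∀ {es} → AllPairs (λ e e′ → proj₂ e < proj₂ e′) es → Beyond es →
                 All (λ e → c < proj₂ e) es
    Beyond⇒All [] _ = []
    Beyond⇒All (ps ∷ _) beyond = ≰⇒> beyond ∷ All.map (λ p → <-trans (≰⇒> beyond) p) ps

    sorted-insert : ∀ xs {e q ys} → AllPairs (λ e e′ → proj₂ e < proj₂ e′) (xs ++ e ∷ ys) →
      proj₂ e < c → Beyond ys → AllPairs (λ e e′ → proj₂ e < proj₂ e′) (xs ++ e ∷ (q , c) ∷ ys)
    sorted-insert [] (ps ∷ pss) e<c beyond = (e<c ∷ ps) ∷ Beyond⇒All pss beyond ∷ pss
    sorted-insert (_ ∷ xs) (ps ∷ pss) e<c beyond =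
      All-insert xs ps (<-trans (All.lookup ps (∈-++⁺ʳ xs (here refl))) e<c) ∷
      sorted-insert xs pss e<c beyond

    module _ {P es k₀ ch sz h es₁ ch′ sz′ h′} (records : Records P P es ch sz h)
             (0<sz : 0 ℕ.< sz) (sz≤sz′ : sz ℕ.≤ sz′)
             (effect : Effect ((0 , k₀) ∷ es) es₁ ch sz h ch′ sz′ h′) where
      open Records records
      private
        Result : Set
        Result = Σ (List Entry) λ es′ → es₁ ≡ (0 , k₀) ∷ es′ × Records (I ∷ P) (I ∷ P) es′ ch′ sz′ h′

        I-left : ∀ {x} → x ≡ lo I → IsLeft (I ∷ P) x
        I-left eq = I , here refl , sym eq

        found-result : ∀ xs {q k ys} → (0 , k₀) ∷ es ≡ xs ++ (q , k) ∷ ys → xs ≡ [] ⊎ k ≤ c →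
                       Found ((0 , k₀) ∷ es) es₁ ch sz h ch′ sz′ h′ q k → Result
        found-result [] refl _ found = contradiction refl (Found.not-dummy found)
        found-result (_ ∷ xs) {q} {k} refl (inj₂ k≤c) found =
          es , entries-≡ , subst (λ p → Records (I ∷ P) (I ∷ P) es p sz′ h′) (sym chain-≡) record
            { Records records′
            ; cover = λ { (here refl) → q , q∈qs , covers ; (there J∈P) → Records.cover records′ J∈P } }
          where
          open Found found
          q∈es : (q , k) ∈ xs ++ (q , k) ∷ _
          q∈es = ∈-++⁺ʳ xs (here refl)
          q∈qs : q ∈ qs
          q∈qs = All.lookup listed q∈es
          q<sz : q ℕ.< sz
          q<sz = All.lookup qs<sz q∈qs
          -- The search provides `k ≤ c` and the test in the leaf `c ≤ k`, so that the record is the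
          -- one for the cell of the new interval.
          key-q : key (h q) ≡ c
          key-q = trans (All.lookup keys q∈es) (antisym k≤c c≤k)
          module W = Widened (widened q<sz)
          stems : ∀ {x x₀} → x ≡ x₀ ⊎ x ≡ lo I → x ≡ x₀ ⊎ (IsLeft (I ∷ P) x × keyOf x ≡ key (h q))
          stems (inj₁ eq) = inj₁ eq
          stems (inj₂ eq) = inj₂ (I-left eq , trans (cong keyOf eq) (sym key-q))
          changes : ∀ {x} → x ℕ.< sz → Change (I ∷ P) (h x) (h′ x)
          changes {x} x<sz with x ℕₚ.≟ q
          ... | no x≢q   = SameRecord⇒Change (others x<sz x≢q)
          ... | yes refl = record
            { key-≡ = W.key-≡ ; link-≡ = W.link-≡ ; min-≤ = W.min-≤ ; ≤-max = W.≤-max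
            ; min-from = stems W.min-from ; max-from = stems W.max-from }
          records′ : Records (I ∷ P) P es ch sz′ h′
          records′ = Records-change there sz≤sz′ changes records
          covers : Covers (h′ q) (lo I)
          covers = record
            { key-≡ = trans W.key-≡ key-q ; min≤ = W.min-≤lo ; ≤max = W.lo≤-max }

        fresh-result : ∀ xs {q k ys} → (0 , k₀) ∷ es ≡ xs ++ (q , k) ∷ ys → xs ≡ [] ⊎ k ≤ c →
                       Beyond ys → Fresh ((0 , k₀) ∷ es) es₁ ch sz h ch′ sz′ h′ xs q k ys → Result
        fresh-result xs {q} {k} {ys} located lower beyond fresh = place xs located lower absent entries-≡
          where
          open Fresh fresh
          records′ : Records (I ∷ P) P es ch sz′ h′
          records′ = Records-change there sz≤sz′ (λ x<sz → SameRecord⇒Change (others x<sz)) records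
          module R′ = Records records′
          new-nonzero : q′ ≢ 0
          new-nonzero q′≡0 = ℕₚ.n≮0 (subst (0 ℕ.<_) q′≡0 (ℕₚ.<-≤-trans 0<sz sz≤q′))
          extend : ∀ {es′} → AllPairs (λ e e′ → proj₂ e < proj₂ e′) es′ →
                   All (λ e → proj₁ e ≢ 0) es′ → All (λ e → proj₁ e ∈ q′ ∷ qs) es′ →
                   All (λ e → key (h′ (proj₁ e)) ≡ proj₂ e) es′ →
                   Records (I ∷ P) (I ∷ P) es′ ch′ sz′ h′
          extend sorted′ nonzero′ listed′ keys′ = record
            { qs      = q′ ∷ qs
            ; chain   = chain-≡ , subst (λ p → Chain h′ p qs) (sym link-new) R′.chain
            ; qs<sz   = q′<sz′ ∷ R′.qs<sz
            ; genuine = record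
                { min-left = I-left min-new ; max-left = I-left max-new
                ; min-key = trans (cong keyOf min-new) (sym key-new)
                ; max-key = trans (cong keyOf max-new) (sym key-new) } ∷ R′.genuine
            ; cover   = λ
                { (here refl) → q′ , here refl , record
                    { key-≡ = key-new ; min≤ = ≤-reflexive min-new ; ≤max = ≤-reflexive (sym max-new) }
                ; (there J∈P) → let (q , q∈ , c) = R′.cover J∈P in q , there q∈ , c }
            ; sorted = sorted′ ; nonzero = nonzero′ ; listed = listed′ ; keys = keys′ }
          listed-there : All (λ e → proj₁ e ∈ q′ ∷ qs) es
          listed-there = All.map there listed
          place : ∀ xs → (0 , k₀) ∷ es ≡ xs ++ (q , k) ∷ ys → xs ≡ [] ⊎ k ≤ c → q ≡ 0 ⊎ ¬ c ≤ k →
                  es₁ ≡ xs ++ (q , k) ∷ (q′ , c) ∷ ys → Result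
          -- The new key is the least one so far; its leaf comes right after the dummy.
          place [] refl _ _ eq = (q′ , c) ∷ es , eq , extend
            (Beyond⇒All sorted beyond ∷ sorted) (new-nonzero ∷ nonzero)
            (here refl ∷ listed-there) (key-new ∷ R′.keys)
          -- Only the first entry is the dummy, as the addresses of all the others are nonzero.
          place (_ ∷ xs) refl _ (inj₁ q≡0) _ =
            contradiction q≡0 (All.lookup nonzero (∈-++⁺ʳ xs (here refl)))
          place (_ ∷ xs) refl (inj₂ k≤c) (inj₂ c≰k) eq = xs ++ (q , k) ∷ (q′ , c) ∷ ys , eq , extend
            (sorted-insert xs sorted (≰⇒> c≰k) beyond) (All-insert xs nonzero new-nonzero)
            (All-insert xs listed-there (here refl)) (All-insert xs R′.keys key-new)

      Records-effect : Result
      Records-effect = result outcome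
        where
        open Effect effect
        result : Found _ _ _ _ _ _ _ _ q k ⊎ Fresh _ _ _ _ _ _ _ _ before q k after → Result
        result (inj₁ found) = found-result before located lower found
        result (inj₂ fresh) = fresh-result before located lower upper fresh

-- The constants of the two bounds.

timeBound : ℕ → ℕ
timeBound H =
  cost Program.prologue ℕ.+ (suc ((1 ℕ.+ 4 ℕ.* H) ℕ.* suc (cost Program.body)) ℕ.+ cost Program.growRoot)

timeBound-≤ : ∀ a b k H L → H ℕ.≤ 2 ℕ.+ L →
  a ℕ.+ (suc ((1 ℕ.+ 4 ℕ.* H) ℕ.* k) ℕ.+ b) ℕ.≤ (a ℕ.+ b ℕ.+ 9 ℕ.* k ℕ.+ 36) ℕ.* (1 ℕ.+ L)
timeBound-≤ a b k H L H≤ = begin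
  a ℕ.+ (suc ((1 ℕ.+ 4 ℕ.* H) ℕ.* k) ℕ.+ b)
    ≤⟨ ℕₚ.+-monoʳ-≤ a (ℕₚ.+-monoˡ-≤ b (s≤s (ℕₚ.*-monoˡ-≤ k (s≤s (ℕₚ.*-monoʳ-≤ 4 H≤))))) ⟩
  a ℕ.+ (suc ((1 ℕ.+ 4 ℕ.* (2 ℕ.+ L)) ℕ.* k) ℕ.+ b)
    ≤⟨ ℕₚ.m≤m+n _ _ ⟩
  -- The added term is the difference of the two sides, so that a ring identity remains.
  a ℕ.+ (suc ((1 ℕ.+ 4 ℕ.* (2 ℕ.+ L)) ℕ.* k) ℕ.+ b) ℕ.+ (35 ℕ.+ (a ℕ.+ b ℕ.+ 5 ℕ.* k ℕ.+ 36) ℕ.* L)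
    ≡⟨ expand a b k L ⟩
  (a ℕ.+ b ℕ.+ 9 ℕ.* k ℕ.+ 36) ℕ.* (1 ℕ.+ L) ∎
  where
  open ℕₚ.≤-Reasoning
  expand : ∀ a b k L →
    a ℕ.+ (suc ((1 ℕ.+ 4 ℕ.* (2 ℕ.+ L)) ℕ.* k) ℕ.+ b) ℕ.+ (35 ℕ.+ (a ℕ.+ b ℕ.+ 5 ℕ.* k ℕ.+ 36) ℕ.* L) ≡
    (a ℕ.+ b ℕ.+ 9 ℕ.* k ℕ.+ 36) ℕ.* (1 ℕ.+ L)
  expand = solve-∀

opaque
  -- Serves for time and space alike. The 9 comes from `1 + 4 * (2 + L)`, the number of iterations,
  -- at `L = 0`; the 36 is for the space bound.
  factor : ℕ
  factor = cost Program.prologue ℕ.+ cost Program.growRoot ℕ.+ 9 ℕ.* suc (cost Program.body) ℕ.+ 36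

  timeBound≤factor : ∀ {H L} → H ℕ.≤ 2 ℕ.+ L → timeBound H ℕ.≤ factor ℕ.* (1 ℕ.+ L)
  timeBound≤factor {H} {L} = timeBound-≤ (cost Program.prologue) (cost Program.growRoot)
    (suc (cost Program.body)) H L

  36≤factor : 36 ℕ.≤ factor
  36≤factor = ℕₚ.m≤n+m 36
    (cost Program.prologue ℕ.+ cost Program.growRoot ℕ.+ 9 ℕ.* suc (cost Program.body))

-- For positive `α` the right-hand side is at most `4 * α`, whence the summand 2; for `α = 0` the
-- height is 0.
2^H≤1+2α⇒H≤2+⌈log₂α⌉ : ∀ {H} α → 2 ℕ.^ H ℕ.≤ suc (2 ℕ.* α) → H ℕ.≤ 2 ℕ.+ ⌈log₂ α ⌉
2^H≤1+2α⇒H≤2+⌈log₂α⌉ {H} zero 2^H≤1 =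
  ℕₚ.≤-trans (subst (ℕ._≤ 0) (⌈log₂2^n⌉≡n H) (⌈log₂⌉-mono-≤ 2^H≤1)) z≤n
2^H≤1+2α⇒H≤2+⌈log₂α⌉ {H} α@(suc α-1) 2^H≤ = begin
  H                            ≡⟨ sym (⌈log₂2^n⌉≡n H) ⟩
  ⌈log₂ 2 ℕ.^ H ⌉              ≤⟨ ⌈log₂⌉-mono-≤ (ℕₚ.≤-trans 2^H≤ 1+2α≤4α) ⟩
  ⌈log₂ 2 ℕ.* (2 ℕ.* α) ⌉      ≡⟨ ⌈log₂2*n⌉≡1+⌈log₂n⌉ (2 ℕ.* α) ⟩
  suc ⌈log₂ 2 ℕ.* α ⌉          ≡⟨ cong suc (⌈log₂2*n⌉≡1+⌈log₂n⌉ α) ⟩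
  2 ℕ.+ ⌈log₂ α ⌉              ∎
  where
  open ℕₚ.≤-Reasoning
  1+2α≤4α : suc (2 ℕ.* α) ℕ.≤ 2 ℕ.* (2 ℕ.* α)
  1+2α≤4α = ℕₚ.+-mono-≤ {1} {2 ℕ.* α} (s≤s z≤n) (ℕₚ.≤-reflexive (sym (ℕₚ.+-identityʳ (2 ℕ.* α))))

-- Handling the intervals and reporting the answer.

module Handling (R : Reals) (len : Reals.Carrier R)
                (0<len : OrderedField._<_ (Reals.orderedField R) (Reals.0# R) len)
                (𝕊 : List (IntervalStreams.Interval R))
                (lengths : All (IntervalStreams.HasLength R len) 𝕊)
                (α : ℕ)
                (maximal : ∀ 𝕁 → IntervalStreams.IndependentSubset R 𝕊 𝕁 → length 𝕁 ℕ.≤ α) where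
  open Reals R using (orderedField; ⌊_⌋)
  open OrderedFieldProperties orderedField
  open Cells R len 0<len
  open IntervalStreams R hiding (module Semantics)
  open IntervalStreams.Semantics R layout
  open Execution R layout
  open Program
  open Dictionary R
  open Greedy R len 0<len
  open Stream R len 0<len 𝕊 lengths

  record Dict (P : List Interval) (a : ℕ) (ch : Pointer) (sz : ℕ) (h : Heap) : Set where
    field
      {H}       : ℕ
      {f}       : Tree
      {es}      : List Entry
      {k₀}      : Carrier
      bal       : Bal H 1 f
      store     : Stored h sz f
      root-is   : root f ≡ just a
      size-is   : sz ≡ nodes f
      entries-≡ : entries f ≡ (0 , k₀) ∷ es
      records   : Records P P es ch sz h
      P⊆        : P ⊆ 𝕊

  record Invariant (P : List Interval) (σ : State) : Set where
    constructor invariant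
    field
      {a₀ a₁ a₃ last tmp best} : Carrier
      {y u d z w v t g}        : Pointer
      {a}                      : ℕ
      {ch}                     : Pointer
      {sz}                     : ℕ
      {h}                      : Heap
      state-≡ : σ ≡ state (a₀ ∷ a₁ ∷ len ∷ a₃ ∷ last ∷ tmp ∷ best ∷ [])
                          (just a ∷ just 0 ∷ ch ∷ y ∷ u ∷ d ∷ z ∷ w ∷ v ∷ t ∷ g ∷ []) sz h []
      dict    : Dict P a ch sz h
      low     : ∀ {J} → J ∈ P → last < lo J

  module _ {P a ch sz h} (D : Dict P a ch sz h) where
    open Dict D

    length-entries : length (entries f) ℕ.≤ suc (2 ℕ.* α)
    length-entries = subst (ℕ._≤ _) (cong length (sym entries-≡)) (s≤s (length-records maximal P⊆ records))

    2^H≤ : 2 ℕ.^ H ℕ.≤ suc (2 ℕ.* α)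
    2^H≤ = ℕₚ.≤-trans (ℕₚ.≤-reflexive (sym (ℕₚ.*-identityˡ (2 ℕ.^ H)))) (ℕₚ.≤-trans (≤-entries bal) length-entries)

    -- All the allocated nodes belong to the tree, by `size-is`, and a tree has at most twice as
    -- many nodes as leaves.
    sz≤ : sz ℕ.≤ 2 ℕ.* suc (2 ℕ.* α)
    sz≤ = subst (ℕ._≤ _) (sym size-is)
      (ℕₚ.≤-trans (ℕₚ.m≤m+n (nodes f) 1) (ℕₚ.≤-trans (nodes-≤ bal) (ℕₚ.*-monoʳ-≤ 2 length-entries)))

    0<sz : 0 ℕ.< sz
    0<sz with Bal⇒bin bal
    ... | _ , _ , _ , _ , refl = subst (0 ℕ.<_) (sym size-is) (s≤s z≤n)

  Invariant-size : ∀ {P σ} → Invariant P σ → size σ ℕ.≤ 2 ℕ.* suc (2 ℕ.* α)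
  Invariant-size (invariant refl dict _) = sz≤ dict

  divide : ∀ {r s t σ} → lookup (realReg σ) t ≢ 0# → exec (floorDiv r s t) σ ≡
    just (assignReal r (fromℤ orderedField ⌊ lookup (realReg σ) s * lookup (realReg σ) t ⁻¹ ⌋) σ)
  divide {t = t} {σ} t≢0 with lookup (realReg σ) t ≟ 0#
  ... | yes t≡0 = contradiction t≡0 t≢0
  ... | no _    = refl

  module _ (I : Interval) (I∈𝕊 : I ∈ 𝕊) where
    private
      c = keyOf (lo I)

    enterTree : Cmd layout
    enterTree =
      cond (isNil pRoot) (instr (new pRoot) ⨾ instr (copyPtr pDummy pRoot)) skip ⨾
      instr (copyPtr pY pRoot) ⨾ instr (copyPtr pG pRoot)

    measured : ∀ {Q a₂ a₃ last tmp best ps sz h out} →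
      (∀ {last′} → last′ < lo I → last′ ≤ last →
       Reach enterTree (state (lo I ∷ hi I ∷ len ∷ c ∷ last′ ∷ tmp ∷ best ∷ []) ps sz h out) Q) →
      Reach prologue (state (lo I ∷ hi I ∷ a₂ ∷ a₃ ∷ last ∷ tmp ∷ best ∷ []) ps sz h out) Q
    measured {a₃ = a₃} {last} {tmp} {best} {ps} {sz} {h} {out} k =
      step (cong (λ x → just (state (lo I ∷ hi I ∷ x ∷ a₃ ∷ last ∷ tmp ∷ best ∷ []) ps sz h out))
                 (All.lookup lengths I∈𝕊))
      (step (divide λ len≡0 → proj₂ 0<len (sym len≡0))
      (via (if-leq
        (λ lo≤last → final refl (k (x-z<x (lo I) 0<len) (≤-trans (<⇒≤ (x-z<x (lo I) 0<len)) lo≤last)))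
        (λ lo≰last → done (k (≰⇒> lo≰last) ≤-refl)))))

    record Started (P : List Interval) (τ : State) : Set where
      constructor started
      field
        {last tmp best}   : Carrier
        {u d z w v t}     : Pointer
        {a}               : ℕ
        {ch}              : Pointer
        {sz}              : ℕ
        {h}               : Heap
        state-≡ : τ ≡ state (lo I ∷ hi I ∷ len ∷ c ∷ last ∷ tmp ∷ best ∷ [])
                    (just a ∷ just 0 ∷ ch ∷ just a ∷ u ∷ d ∷ z ∷ w ∷ v ∷ t ∷ just a ∷ []) sz h []
        dict    : Dict P a ch sz h
        low     : ∀ {J} → J ∈ I ∷ P → last < lo J

    prologue-next : ∀ {P σ} → Invariant P σ → Reach prologue (receive algorithm I σ) (Started P)
    prologue-next (invariant refl dict low) = measured λ last′<lo last′≤last →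
      via (if-false refl (done (step refl (final refl (started refl dict
        λ { (here refl) → last′<lo ; (there J∈P) → ≤-<-trans last′≤last (low J∈P) })))))

    -- The initial state does not satisfy `Invariant`: there is no tree yet, and `rLen` holds 0. The
    -- first interval supplies the length, and its arrival allocates the dummy, which thereby gets
    -- address 0.
    prologue-first : Reach prologue (receive algorithm I initial) (Started [])
    prologue-first = measured λ last′<lo _ →
      via (if-true refl (allocate λ _ u → final refl (step refl (final refl
        (started refl (empty u) λ { (here refl) → last′<lo })))))
      where
      empty : ∀ {h′} → Update (heap initial) 0 blank h′ → Dict [] 0 nothing 1 h′
      empty u = record
        { bal = cons leaf nil
        ; store = stored
            ((cong key (Update.updated u) , cong down (Update.updated u) , cong right (Update.updated u)) , tt , tt)
            (((λ ()) , (λ ()) , λ ()) , tt , tt)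
            (λ { (inj₁ refl) → s≤s z≤n ; (inj₂ (inj₁ ())) ; (inj₂ (inj₂ ())) })
        ; root-is = refl ; size-is = refl ; entries-≡ = refl
        ; records = record
            { qs = [] ; chain = refl ; qs<sz = [] ; genuine = [] ; cover = λ ()
            ; sorted = [] ; nonzero = [] ; listed = [] ; keys = [] }
        ; P⊆ = λ () }

    module _ {last best : Carrier} {a : ℕ} where
      open Search R (lo I) (hi I) len c last best (just a) []

      -- A split of the old root leaves two trees on the top level, which is just enough for the
      -- children of a new root. Copying the key of the old root keeps it the key of the first leaf.
      grown : ∀ {P s y} → P ⊆ 𝕊 → (∀ {J} → J ∈ P → last < lo J) →
        ∀ {H f es k₀ sz′ h′ ch′} → Grown H 1 f → Stored h′ sz′ f → root f ≡ just a → sz′ ≡ nodes f →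
        entries f ≡ (0 , k₀) ∷ es → Records P P es ch′ sz′ h′ →
        Reach growRoot (searchState s nothing y ch′ sz′ h′) (Invariant P)
      grown P⊆ low (inj₁ b@(cons _ nil)) wf refl sz≡ es≡ recs =
        loadPtr refl (proj₂ (proj₂ (proj₁ (rep wf)))) (if-true refl (done (invariant refl
          (record { bal = b ; store = wf ; root-is = refl ; size-is = sz≡ ; entries-≡ = es≡
                  ; records = recs ; P⊆ = P⊆ }) low)))
      grown P⊆ low {f = f} {sz′ = sz′} {h′} (inj₂ bal@(cons _ (cons _ nil))) wf refl sz≡ es≡ recs =
        loadPtr refl (proj₂ (proj₂ (proj₁ (rep wf)))) (if-false refl
          (allocate λ _ u₁ → storePtr refl u₁ λ _ u₂ → loadReal refl
            (trans (cong key (Update.kept u₂ (ℕₚ.<⇒≢ (bounded wf (inj₁ refl))))) (proj₁ (proj₁ (rep wf))))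
            (storeReal refl u₂ λ _ u₃ → final refl (invariant refl (record
              { bal = cons (node ℕₚ.≤-refl (s≤s (s≤s z≤n)) refl bal) nil
              ; store = stored
                  ((cong key (Update.updated u₃) , cong down (Update.updated u₃) , cong right (Update.updated u₃)) ,
                   Rep-cong f (λ p → ≡⇒SameShape (old u₃ (bounded wf p))) (rep wf) , tt)
                  (((λ p → ℕₚ.<-irrefl refl (bounded wf p)) , (λ ()) , (λ _ ())) , separated wf , tt)
                  (λ { (inj₁ refl) → ℕₚ.n<1+n sz′ ; (inj₂ (inj₁ p)) → ℕₚ.m<n⇒m<1+n (bounded wf p)
                     ; (inj₂ (inj₂ ())) })
              ; root-is = refl
              ; size-is = cong suc (trans sz≡ (sym (ℕₚ.+-identityʳ (nodes f))))
              ; entries-≡ = trans (Listₚ.++-identityʳ (entries f)) es≡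
              ; records = Records-change (λ p → p) (ℕₚ.n≤1+n sz′)
                  (λ x<sz → SameRecord⇒Change (≡⇒SameRecord (old u₃ x<sz))) recs
              ; P⊆ = P⊆ }) low))))
        where
        old : ∀ {n h″ x} → Update h′ sz′ n h″ → x ℕ.< sz′ → h″ x ≡ h′ x
        old u x<sz = Update.kept u (ℕₚ.<⇒≢ x<sz)

    loop-growRoot : ∀ {P τ} → Started P τ → Σ State λ υ → Σ ℕ λ t →
      ⟨ loop ⨾ growRoot , τ ⟩⇓⟨ υ , t ⟩ × Invariant (I ∷ P) υ ×
      Σ ℕ λ H → 2 ℕ.^ H ℕ.≤ suc (2 ℕ.* α) ×
        t ℕ.≤ suc ((1 ℕ.+ 4 ℕ.* H) ℕ.* suc (cost body)) ℕ.+ cost growRoot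
    loop-growRoot {P} (started {last} {best = best} {a = a} {ch} {sz} {h} refl dict low)
      with Search.loop-correct R (lo I) (hi I) len c last best (just a) []
             (Dict.H dict) 0 (Dict.bal dict) (Dict.store dict)
    ... | result rewrite Dict.root-is dict = finish-up result
      where
      open Search R (lo I) (hi I) len c last best (just a) []
      open Dict dict
      finish-up : ∀ {σ} → Loops (1 ℕ.+ 4 ℕ.* H) σ (Post (Grown H 1) f ch sz h) →
        Σ State λ υ → Σ ℕ λ t →
        ⟨ loop ⨾ growRoot , σ ⟩⇓⟨ υ , t ⟩ × Invariant (I ∷ P) υ ×
        Σ ℕ λ H → 2 ℕ.^ H ℕ.≤ suc (2 ℕ.* α) ×
          t ℕ.≤ suc ((1 ℕ.+ 4 ℕ.* H) ℕ.* suc (cost body)) ℕ.+ cost growRoot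
      finish-up (_ , t₁ , r₁ , t₁≤ , post {sz′ = sz′} {f′ = f′} refl shape stored′ local effect)
        with Records-effect I (hi I) last best (just a) records (0<sz dict) (size-≤ local)
               (subst (λ es → Effect es _ _ _ _ _ _ _) entries-≡ effect)
      ... | es′ , entries′ , records′
        with grown (λ { (here refl) → I∈𝕊 ; (there J∈P) → P⊆ J∈P }) low shape stored′
               (trans (root-≡ local) root-is) sz′≡ entries′ records′
        where
        sz′≡ : sz′ ≡ nodes f′
        -- `count` says without subtraction that the heap has grown by as many nodes as the tree.
        sz′≡ = ℕₚ.+-cancelʳ-≡ (nodes f) _ _ (trans (count local)
          (trans (cong (ℕ._+ nodes f′) size-is) (ℕₚ.+-comm (nodes f) (nodes f′))))
      ... | υ , t₂ , r₂ , inv = υ , t₁ ℕ.+ t₂ , seq-⇓ r₁ r₂ , inv , H , 2^H≤ dict ,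
        ℕₚ.+-mono-≤ (ℕₚ.≤-trans t₁≤ (ℕₚ.≤-reflexive (ticks-≡ (1 ℕ.+ 4 ℕ.* H))))
                    (time≤cost growRoot _ r₂)

    handle-correct : ∀ {P σ} → Reach prologue (receive algorithm I σ) (Started P) →
      Σ State λ υ → Σ ℕ λ t → ⟨ handle , receive algorithm I σ ⟩⇓⟨ υ , t ⟩ ×
        t ℕ.≤ factor ℕ.* (1 ℕ.+ ⌈log₂ α ⌉) × Invariant (I ∷ P) υ
    handle-correct (_ , t₀ , r₀ , s) with loop-growRoot s
    ... | υ , t , r , inv , H , 2^H≤ , t≤ = υ , t₀ ℕ.+ t , seq-⇓ r₀ r ,
      ℕₚ.≤-trans (ℕₚ.+-mono-≤ (time≤cost prologue _ r₀) t≤)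
        (timeBound≤factor {H} {⌈log₂ α ⌉} (2^H≤1+2α⇒H≤2+⌈log₂α⌉ α 2^H≤)) , inv

  -- The list of intervals read so far grows at its head, opposite to the order of the stream, so
  -- that only inclusions are asserted.
  pass-correct : ∀ {P σ} 𝕀 → 𝕀 ⊆ 𝕊 → Invariant P σ →
    Σ State λ υ → Σ (List ℕ) λ ts → Pass algorithm σ 𝕀 υ ts ×
      All (ℕ._≤ factor ℕ.* (1 ℕ.+ ⌈log₂ α ⌉)) ts ×
      Σ (List Interval) λ P′ → Invariant P′ υ × P ⊆ P′ × 𝕀 ⊆ P′
  pass-correct [] _ inv = _ , [] , [] , [] , _ , inv , (λ p → p) , λ ()
  pass-correct (I ∷ 𝕀) 𝕀⊆ inv with handle-correct I (𝕀⊆ (here refl)) (prologue-next I (𝕀⊆ (here refl)) inv)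
  ... | _ , t , r , t≤ , inv′ with pass-correct 𝕀 (λ p → 𝕀⊆ (there p)) inv′
  ... | υ , ts , rs , ts≤ , P′ , inv″ , P⊆ , 𝕀⊆P′ =
    υ , t ∷ ts , r ∷ rs , t≤ ∷ ts≤ , P′ , inv″ , (λ p → P⊆ (there p)) ,
    λ { (here refl) → P⊆ (here refl) ; (there p) → 𝕀⊆P′ p }

  -- The record that accounts for a member of `𝕁` has the key of its cell, and so have both its
  -- ends; they are the replacements offered for that member.
  sandwiches : ∀ {P es ch sz h} (records : Records P P es ch sz h) 𝕁 → 𝕁 ⊆ P →
    Σ (List (Sandwich (_∈ values h (Records.qs records) []))) λ ss → map Sandwich.x ss ≡ map lo 𝕁
  sandwiches records [] _ = [] , refl
  sandwiches {h = h} records (J ∷ 𝕁) 𝕁⊆P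
    with Records.cover records (𝕁⊆P (here refl)) | sandwiches records 𝕁 (λ p → 𝕁⊆P (there p))
  ... | q , q∈qs , covers | ss , eq = record
      { low = minLo (h q) ; x = lo J ; high = maxLo (h q)
      ; low∈V = min∈values q∈qs ; high∈V = max∈values q∈qs
      ; low≤x = min≤ ; x≤high = ≤max
      ; cell-low = keyOf-injective (trans (min-key genuine) key-≡)
      ; cell-high = keyOf-injective (trans (max-key genuine) key-≡)
      } ∷ ss , cong (lo J ∷_) eq
    where
    open Covers covers
    open Genuine using (min-key; max-key)
    genuine = All.lookup (Records.genuine records) q∈qs

  independent-left : ∀ {𝕁} → 𝕁 ⊆ 𝕊 → Independent 𝕁 → AllPairs Apart (map lo 𝕁)
  independent-left {𝕁} 𝕁⊆ indep = AllPairsₚ.map⁺ (AllPairs-map-All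
    (λ I≡ J≡ disjoint → Disjoint⇒Apart (subst₂ Disjoint I≡ J≡ disjoint))
    (All.tabulate λ J∈ → HasLength⇒≡interval (All.lookup lengths (𝕁⊆ J∈))) indep)

  finishing-correct : ∀ {P σ} → 𝕊 ⊆ P → Invariant P σ →
    (∃ λ 𝕁 → IndependentSubset 𝕊 𝕁 × length 𝕁 ≡ α) →
    Reach finish σ λ τ → size τ ≡ size σ × IndependentSubset 𝕊 (output τ) ×
      2 ℕ.* α ℕ.≤ 3 ℕ.* length (output τ)
  finishing-correct {P} 𝕊⊆P
    (invariant {a₀} {a₁} {a₃} {u = u} {d} {z} {w} {v} {t} {a = a} {ch} {sz} {h} refl dict low)
    (𝕁 , (𝕁⊆ , indep) , length-𝕁) =
    let (τ , t , r , size-≡ , disjoint , inside , optimal) =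
          finish-correct a₀ a₁ a₃ (just a) (just 0) u d z w v t ch sz h qs chain {_∈ 𝕊}
            (All-values (All.map (λ g → interval∈𝕊 P⊆ (min-left g) , interval∈𝕊 P⊆ (max-left g)) genuine) [])
            (All-values (All.map (λ g → above (min-left g) , above (max-left g)) genuine) [])
    in τ , t , r , size-≡ , (All.lookup inside , disjoint) , two-thirds ss ss-apart ss-length optimal
    where
    open Dict dict
    open Records records
    open Genuine using (min-left; max-left)
    above : ∀ {x} → IsLeft P x → _ < x
    above (I , I∈P , refl) = low I∈P
    ss = proj₁ (sandwiches records 𝕁 (λ p → 𝕊⊆P (𝕁⊆ p)))
    ss≡ : map Sandwich.x ss ≡ map lo 𝕁
    ss≡ = proj₂ (sandwiches records 𝕁 (λ p → 𝕊⊆P (𝕁⊆ p)))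
    ss-apart : AllPairs (λ s s′ → Apart (Sandwich.x s) (Sandwich.x s′)) ss
    ss-apart = AllPairsₚ.map⁻ (subst (AllPairs Apart) (sym ss≡) (independent-left 𝕁⊆ indep))
    ss-length : length ss ≡ α
    ss-length = trans (sym (Listₚ.length-map Sandwich.x ss))
      (trans (cong length ss≡) (trans (Listₚ.length-map lo 𝕁) length-𝕁))

  run-correct : ∀ I 𝕀 → I ∷ 𝕀 ⊆ 𝕊 → 𝕊 ⊆ I ∷ 𝕀 →
    (∃ λ 𝕁 → IndependentSubset 𝕊 𝕁 × length 𝕁 ≡ α) →
    Σ (Run algorithm (I ∷ 𝕀)) λ run →
      (IndependentSubset 𝕊 (answer run) × 2 ℕ.* α ℕ.≤ 3 ℕ.* length (answer run)) ×
      size (Run.final run) ℕ.≤ 2 ℕ.* suc (2 ℕ.* α) ×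
      All (ℕ._≤ factor ℕ.* (1 ℕ.+ ⌈log₂ α ⌉)) (times run)
  run-correct I 𝕀 ⊆𝕊 𝕊⊆ witness
    with handle-correct I (⊆𝕊 (here refl)) {σ = initial} (prologue-first I (⊆𝕊 (here refl)))
  ... | _ , t , r , t≤ , inv with pass-correct 𝕀 (λ p → ⊆𝕊 (there p)) inv
  ... | υ , ts , rs , ts≤ , P , inv′ , I⊆ , 𝕀⊆
    with finishing-correct (λ p → all-in (𝕊⊆ p)) inv′ witness
    where
    all-in : ∀ {J} → J ∈ I ∷ 𝕀 → J ∈ P
    all-in (here refl) = I⊆ (here refl)
    all-in (there p)   = 𝕀⊆ p
  ... | τ , _ , r′ , size-≡ , good =
    record { pass = r ∷ rs ; finishing = r′ } , good ,
    ℕₚ.≤-trans (ℕₚ.≤-reflexive size-≡) (Invariant-size inv′) , t≤ ∷ ts≤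

open import Data.Nat.Base using (_+_; _*_; _≤_)

theorem15 : (R : Reals) →
    let module ℝ = Reals R
        open IntervalStreams R
    in
    Σ[ A ∈ StreamAlgorithm ] Σ[ C ∈ ℕ ]
      ((len : ℝ.Carrier) → ℝ.0# ℝ.< len →
       (𝕀 : List Interval) → Unique 𝕀 → All (HasLength len) 𝕀 →
       (α : ℕ) → IsIndependenceNumber 𝕀 α →
       Σ[ run ∈ Run A 𝕀 ]
         (IndependentSubset 𝕀 (answer run) × 2 * α ≤ 3 * length (answer run)) ×
         space run ≤ C * (1 + α) ×
         All (λ t → t ≤ C * (1 + ⌈log₂ α ⌉)) (times run))
theorem15 R = Program.algorithm , factor , correct
  where
  open IntervalStreams R
  open IntervalStreams.Semantics R layout
  open Execution R layout using (Reach; step; stop)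

  -- There are `7 + 11` registers and `3 + 3` slots in each node; the total of `30 + 24 * α` is at
  -- most `36 * (1 + α)`.
  space-≤ : ∀ {s α} → s ≤ 2 * ℕ.suc (2 * α) → 18 + s * 6 ≤ factor * (1 + α)
  space-≤ {s} {α} s≤ = ℕₚ.≤-trans (ℕₚ.+-monoʳ-≤ 18 (ℕₚ.*-monoˡ-≤ 6 s≤))
    (ℕₚ.≤-trans (ℕₚ.m≤m+n _ (6 + 12 * α)) (ℕₚ.≤-trans (ℕₚ.≤-reflexive (regroup α))
      (ℕₚ.*-monoˡ-≤ (1 + α) 36≤factor)))
    where
    regroup : ∀ α → 18 + 2 * ℕ.suc (2 * α) * 6 + (6 + 12 * α) ≡ 36 * (1 + α)
    regroup = solve-∀

  empty-finish : Reach Program.finish initial (λ τ → τ ≡ initial)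
  empty-finish = step refl (stop refl refl)

  correct : ∀ len → OrderedField._<_ (Reals.orderedField R) (Reals.0# R) len →
    ∀ 𝕀 → Unique 𝕀 → All (HasLength len) 𝕀 → ∀ α → IsIndependenceNumber 𝕀 α →
    Σ[ run ∈ Run Program.algorithm 𝕀 ]
      (IndependentSubset 𝕀 (answer run) × 2 * α ≤ 3 * length (answer run)) ×
      space run ≤ factor * (1 + α) × All (λ t → t ≤ factor * (1 + ⌈log₂ α ⌉)) (times run)
  -- On the empty stream nothing has set up the tree, and the chain is nil; `finish` stops at once
  -- with an empty output, which is right as `α` is 0.
  correct len _ [] _ _ α ((𝕁 , (𝕁⊆ , _) , refl) , _) with 𝕁 | empty-finish
  ... | [] | τ , t , r , refl = record { pass = [] ; finishing = r } ,
    (((λ ()) , []) , z≤n) , space-≤ {0} {0} z≤n , []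
  ... | _ ∷ _ | _ with 𝕁⊆ (here refl)
  ... | ()
  correct len 0<len 𝕀@(I ∷ 𝕀′) _ lengths α (witness , maximal) =
    let open Handling R len 0<len 𝕀 lengths α maximal
        (run , good , size≤ , time≤) = run-correct I 𝕀′ (λ p → p) (λ p → p) witness
    in run , good , space-≤ size≤ , time≤
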